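{- Let $G$ be an $n$-vertex connected graph with diameter $d$. Then $m_G[0,n-2)\ge d-1$. Moreover, if $3\le d\le n-3$, then \[ m_G[0,n-d+1)\ge \begin{cases} d & \text{if } 3\le d\le n-5,\\ d-1 & \text{otherwise.}\end{cases} \]
   Context: All graphs are simple and finite, with at least one vertex. The signless Laplacian matrix of a graph $G$ is $Q(G)=D(G)+A(G)$, where $D(G)$ is the diagonal matrix of vertex degrees and $A(G)$ is the adjacency matrix; its eigenvalues are the signless Laplacian eigenvalues of $G$. For an $n$-vertex graph $G$ they are all real and lie in $[0,2n-2]$. For a real interval $I$, $m_GI$ denotes the number of signless Laplacian eigenvalues of $G$ lying in $I$, counted with multiplicity. The diameter of a connected graph is the greatest distance between two of its vertices. -}

module Defs where

open import Level using (0ℓ)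
open import Algebra.Bundles using (RawRing)
import Algebra.Definitions.RawMonoid as RawMonoidDefs
import Algebra.Definitions.RawSemiring as RawSemiringDefs
open import Data.Bool.Base using (Bool; true; false; if_then_else_)
open import Data.Fin.Base using (Fin; zero; suc; toℕ; punchIn)
import Data.Fin.Properties as Fin
open import Data.Integer.Base using (ℤ; +_)
open import Data.Nat.Base as ℕ using (ℕ; zero; suc)
import Data.Nat.Properties as ℕ
open import Data.Product.Base using (Σ; _×_; _,_; ∃-syntax)
open import Data.Rational.Base as ℚ using (ℚ; 0ℚ; 1ℚ; ½; ∣_∣)
import Data.Rational.Properties as ℚ
open import Data.Rational.Solver using (module +-*-Solver)
open import Data.Vec.Functional using (Vector)
open import Function.Bundles using (_↣_; Injection)
open import Relation.Binary.PropositionalEquality using (_≡_; refl; sym; subst; cong; module ≡-Reasoning)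
open import Relation.Nullary.Decidable.Core using (does)
open import Relation.Unary using (Pred; _∈_)

IsCauchy : (ℕ → ℚ) → Set
IsCauchy x = ∀ ε → 0ℚ ℚ.< ε →
  ∃[ N ] (∀ m n → N ℕ.≤ m → N ℕ.≤ n → ∣ x m ℚ.- x n ∣ ℚ.< ε)

record ℝ : Set where
  constructor mkℝ
  field
    seq      : ℕ → ℚ
    isCauchy : IsCauchy seq

open ℝ public

infix 4 _≈_ _≤_ _<_

-- Different sequences may represent the same real, so equality of reals is _≈_, not _≡_.
_≈_ : ℝ → ℝ → Set
x ≈ y = ∀ ε → 0ℚ ℚ.< ε → ∃[ N ] (∀ n → N ℕ.≤ n → ∣ seq x n ℚ.- seq y n ∣ ℚ.< ε)

_≤_ : ℝ → ℝ → Set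
x ≤ y = ∀ ε → 0ℚ ℚ.< ε → ∃[ N ] (∀ n → N ℕ.≤ n → seq x n ℚ.< seq y n ℚ.+ ε)

-- The gap ε must be uniform: pointwise seq x n < seq y n would allow equal limits.
_<_ : ℝ → ℝ → Set
x < y = ∃[ ε ] (0ℚ ℚ.< ε × ∃[ N ] (∀ n → N ℕ.≤ n → seq x n ℚ.+ ε ℚ.< seq y n))

private
  halve : ∀ ε → 0ℚ ℚ.< ε → 0ℚ ℚ.< ½ ℚ.* ε
  halve ε 0<ε = subst (ℚ._< ½ ℚ.* ε) (ℚ.*-zeroʳ ½) (ℚ.*-monoʳ-<-pos ½ 0<ε)

  halves : ∀ ε → ½ ℚ.* ε ℚ.+ ½ ℚ.* ε ≡ ε
  halves = solve 1 (λ e → con ½ :* e :+ con ½ :* e := e) refl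
    where open +-*-Solver

  bound : ∀ x → IsCauchy x →
    ∃[ B ] (0ℚ ℚ.< B × ∃[ N ] (∀ n → N ℕ.≤ n → ∣ x n ∣ ℚ.< B))
  bound x cx with cx 1ℚ (ℚ.positive⁻¹ 1ℚ)
  ... | N , h = B , 0<B , N , below
    where
    B : ℚ
    B = 1ℚ ℚ.+ ∣ x N ∣
    0<B : 0ℚ ℚ.< B
    0<B = ℚ.+-mono-<-≤ (ℚ.positive⁻¹ 1ℚ) (ℚ.0≤∣p∣ (x N))
    split : ∀ p q → (p ℚ.- q) ℚ.+ q ≡ p
    split = solve 2 (λ p q → (p :- q) :+ q := p) refl
      where open +-*-Solver
    below : ∀ n → N ℕ.≤ n → ∣ x n ∣ ℚ.< B
    below n N≤n = begin-strict
      ∣ x n ∣                          ≡⟨ cong ∣_∣ (split (x n) (x N)) ⟨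
      ∣ (x n ℚ.- x N) ℚ.+ x N ∣        ≤⟨ ℚ.∣p+q∣≤∣p∣+∣q∣ (x n ℚ.- x N) (x N) ⟩
      ∣ x n ℚ.- x N ∣ ℚ.+ ∣ x N ∣      <⟨ ℚ.+-monoˡ-< ∣ x N ∣ (h n N N≤n ℕ.≤-refl) ⟩
      1ℚ ℚ.+ ∣ x N ∣                   ∎
      where open ℚ.≤-Reasoning

  scaled : ∀ B → 0ℚ ℚ.< B → ∀ ε → 0ℚ ℚ.< ε →
    ∃[ δ ] (0ℚ ℚ.< δ × (∀ p q → ∣ p ∣ ℚ.< δ → ∣ q ∣ ℚ.< B → ∣ p ℚ.* q ∣ ℚ.< ε))
  scaled B 0<B ε 0<ε = δ , 0<δ , small
    where
    instance
      B⁺ : ℚ.Positive B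
      B⁺ = ℚ.positive 0<B
      B≢0 : ℚ.NonZero B
      B≢0 = ℚ.pos⇒nonZero B
      B⁻¹⁺ : ℚ.Positive (ℚ.1/ B)
      B⁻¹⁺ = ℚ.1/pos⇒pos B
      ε⁺ : ℚ.Positive ε
      ε⁺ = ℚ.positive 0<ε
    δ : ℚ
    δ = ε ℚ.* ℚ.1/ B
    instance
      δ⁺ : ℚ.Positive δ
      δ⁺ = ℚ.pos*pos⇒pos ε (ℚ.1/ B)
    0<δ : 0ℚ ℚ.< δ
    0<δ = ℚ.positive⁻¹ δ
    δB : δ ℚ.* B ≡ ε
    δB = begin
      (ε ℚ.* ℚ.1/ B) ℚ.* B   ≡⟨ ℚ.*-assoc ε (ℚ.1/ B) B ⟩
      ε ℚ.* (ℚ.1/ B ℚ.* B)   ≡⟨ cong (ε ℚ.*_) (ℚ.*-inverseˡ B) ⟩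
      ε ℚ.* 1ℚ               ≡⟨ ℚ.*-identityʳ ε ⟩
      ε                      ∎
      where open ≡-Reasoning
    small : ∀ p q → ∣ p ∣ ℚ.< δ → ∣ q ∣ ℚ.< B → ∣ p ℚ.* q ∣ ℚ.< ε
    small p q p<δ q<B = begin-strict
      ∣ p ℚ.* q ∣          ≡⟨ ℚ.∣p*q∣≡∣p∣*∣q∣ p q ⟩
      ∣ p ∣ ℚ.* ∣ q ∣      ≤⟨ ℚ.*-monoʳ-≤-nonNeg ∣ q ∣ {{ℚ.nonNegative (ℚ.0≤∣p∣ q)}} (ℚ.<⇒≤ p<δ) ⟩
      δ ℚ.* ∣ q ∣          <⟨ ℚ.*-monoʳ-<-pos δ q<B ⟩
      δ ℚ.* B              ≡⟨ δB ⟩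
      ε                    ∎
      where open ℚ.≤-Reasoning

  sum< : ∀ ε p q → ∣ p ∣ ℚ.< ½ ℚ.* ε → ∣ q ∣ ℚ.< ½ ℚ.* ε → ∣ p ℚ.+ q ∣ ℚ.< ε
  sum< ε p q p< q< = begin-strict
    ∣ p ℚ.+ q ∣              ≤⟨ ℚ.∣p+q∣≤∣p∣+∣q∣ p q ⟩
    ∣ p ∣ ℚ.+ ∣ q ∣          <⟨ ℚ.+-mono-< p< q< ⟩
    ½ ℚ.* ε ℚ.+ ½ ℚ.* ε      ≡⟨ halves ε ⟩
    ε                        ∎
    where open ℚ.≤-Reasoning

  const-cauchy : ∀ q → IsCauchy (λ _ → q)
  const-cauchy q ε 0<ε =
    0 , λ _ _ _ _ → subst (λ r → ∣ r ∣ ℚ.< ε) (sym (ℚ.+-inverseʳ q)) 0<ε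

  +-cauchy : ∀ x y → IsCauchy x → IsCauchy y → IsCauchy (λ n → x n ℚ.+ y n)
  +-cauchy x y cx cy ε 0<ε
    with cx (½ ℚ.* ε) (halve ε 0<ε) | cy (½ ℚ.* ε) (halve ε 0<ε)
  ... | M , hx | N , hy = M ℕ.⊔ N , λ m n m≥ n≥ →
    subst (λ r → ∣ r ∣ ℚ.< ε) (sym (regroup (x m) (y m) (x n) (y n)))
      (sum< ε (x m ℚ.- x n) (y m ℚ.- y n)
        (hx m n (ℕ.m⊔n≤o⇒m≤o M N m≥) (ℕ.m⊔n≤o⇒m≤o M N n≥))
        (hy m n (ℕ.m⊔n≤o⇒n≤o M N m≥) (ℕ.m⊔n≤o⇒n≤o M N n≥)))
    where
    regroup : ∀ a b c d → (a ℚ.+ b) ℚ.- (c ℚ.+ d) ≡ (a ℚ.- c) ℚ.+ (b ℚ.- d)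
    regroup = solve 4 (λ a b c d → (a :+ b) :- (c :+ d) := (a :- c) :+ (b :- d)) refl
      where open +-*-Solver

  neg-cauchy : ∀ x → IsCauchy x → IsCauchy (λ n → ℚ.- x n)
  neg-cauchy x cx ε 0<ε with cx ε 0<ε
  ... | N , h = N , λ m n m≥ n≥ →
    subst (λ r → ∣ r ∣ ℚ.< ε) (swap (x m) (x n)) (h n m n≥ m≥)
    where
    swap : ∀ a b → b ℚ.- a ≡ (ℚ.- a) ℚ.- (ℚ.- b)
    swap = solve 2 (λ a b → b :- a := (:- a) :- (:- b)) refl
      where open +-*-Solver

  *-regroup : ∀ a b c d →
    (a ℚ.* b) ℚ.- (c ℚ.* d) ≡ ((a ℚ.- c) ℚ.* b) ℚ.+ ((b ℚ.- d) ℚ.* c)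
  *-regroup = solve 4 (λ a b c d →
    (a :* b) :- (c :* d) := ((a :- c) :* b) :+ ((b :- d) :* c)) refl
    where open +-*-Solver

  *-cauchy : ∀ x y → IsCauchy x → IsCauchy y → IsCauchy (λ n → x n ℚ.* y n)
  *-cauchy x y cx cy ε 0<ε =
    let A , 0<A , K , x<A = bound x cx
        B , 0<B , L , y<B = bound y cy
        α , 0<α , byA     = scaled A 0<A (½ ℚ.* ε) (halve ε 0<ε)
        β , 0<β , byB     = scaled B 0<B (½ ℚ.* ε) (halve ε 0<ε)
        M , hx            = cx β 0<β
        N , hy            = cy α 0<α
    in (K ℕ.⊔ L) ℕ.⊔ (M ℕ.⊔ N) ,
       close A B α β K L M N x<A y<B byA byB hx hy
    where
    close : ∀ A B α β K L M N →
      (∀ n → K ℕ.≤ n → ∣ x n ∣ ℚ.< A) →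
      (∀ n → L ℕ.≤ n → ∣ y n ∣ ℚ.< B) →
      (∀ p q → ∣ p ∣ ℚ.< α → ∣ q ∣ ℚ.< A → ∣ p ℚ.* q ∣ ℚ.< ½ ℚ.* ε) →
      (∀ p q → ∣ p ∣ ℚ.< β → ∣ q ∣ ℚ.< B → ∣ p ℚ.* q ∣ ℚ.< ½ ℚ.* ε) →
      (∀ m n → M ℕ.≤ m → M ℕ.≤ n → ∣ x m ℚ.- x n ∣ ℚ.< β) →
      (∀ m n → N ℕ.≤ m → N ℕ.≤ n → ∣ y m ℚ.- y n ∣ ℚ.< α) →
      ∀ m n → (K ℕ.⊔ L) ℕ.⊔ (M ℕ.⊔ N) ℕ.≤ m → (K ℕ.⊔ L) ℕ.⊔ (M ℕ.⊔ N) ℕ.≤ n →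
      ∣ (x m ℚ.* y m) ℚ.- (x n ℚ.* y n) ∣ ℚ.< ε
    close A B α β K L M N x<A y<B byA byB hx hy m n m≥ n≥ = begin-strict
      ∣ (x m ℚ.* y m) ℚ.- (x n ℚ.* y n) ∣
        ≡⟨ cong ∣_∣ (*-regroup (x m) (y m) (x n) (y n)) ⟩
      ∣ ((x m ℚ.- x n) ℚ.* y m) ℚ.+ ((y m ℚ.- y n) ℚ.* x n) ∣
        <⟨ sum< ε ((x m ℚ.- x n) ℚ.* y m) ((y m ℚ.- y n) ℚ.* x n)
             (byB (x m ℚ.- x n) (y m)
               (hx m n (ℕ.m⊔n≤o⇒m≤o M N m≥MN) (ℕ.m⊔n≤o⇒m≤o M N n≥MN))
               (y<B m (ℕ.m⊔n≤o⇒n≤o K L m≥KL)))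
             (byA (y m ℚ.- y n) (x n)
               (hy m n (ℕ.m⊔n≤o⇒n≤o M N m≥MN) (ℕ.m⊔n≤o⇒n≤o M N n≥MN))
               (x<A n (ℕ.m⊔n≤o⇒m≤o K L n≥KL))) ⟩
      ε ∎
      where
      open ℚ.≤-Reasoning
      m≥KL = ℕ.m⊔n≤o⇒m≤o (K ℕ.⊔ L) (M ℕ.⊔ N) m≥
      n≥KL = ℕ.m⊔n≤o⇒m≤o (K ℕ.⊔ L) (M ℕ.⊔ N) n≥
      m≥MN = ℕ.m⊔n≤o⇒n≤o (K ℕ.⊔ L) (M ℕ.⊔ N) m≥
      n≥MN = ℕ.m⊔n≤o⇒n≤o (K ℕ.⊔ L) (M ℕ.⊔ N) n≥

fromℚ : ℚ → ℝ
fromℚ q = mkℝ (λ _ → q) (const-cauchy q)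

fromℤ : ℤ → ℝ
fromℤ i = fromℚ (i ℚ./ 1)

fromℕ : ℕ → ℝ
fromℕ k = fromℤ (+ k)

0ℝ 1ℝ : ℝ
0ℝ = fromℚ 0ℚ
1ℝ = fromℚ 1ℚ

infixl 6 _+_ _-_
infixl 7 _*_
infix  8 -_

_+_ : ℝ → ℝ → ℝ
x + y = mkℝ (λ n → seq x n ℚ.+ seq y n) (+-cauchy (seq x) (seq y) (isCauchy x) (isCauchy y))

_*_ : ℝ → ℝ → ℝ
x * y = mkℝ (λ n → seq x n ℚ.* seq y n) (*-cauchy (seq x) (seq y) (isCauchy x) (isCauchy y))

-_ : ℝ → ℝ
- x = mkℝ (λ n → ℚ.- seq x n) (neg-cauchy (seq x) (isCauchy x))

_-_ : ℝ → ℝ → ℝ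
x - y = x + (- y)

ℝ-rawRing : RawRing 0ℓ 0ℓ
ℝ-rawRing = record
  { Carrier = ℝ
  ; _≈_     = _≈_
  ; _+_     = _+_
  ; _*_     = _*_
  ; -_      = -_
  ; 0#      = 0ℝ
  ; 1#      = 1ℝ
  }

open RawSemiringDefs (RawRing.rawSemiring ℝ-rawRing) public using (sum; product; _^_)

[_,_⟩ : ℝ → ℝ → Pred ℝ 0ℓ
[ a , b ⟩ x = a ≤ x × x < b

Matrix : Set → ℕ → Set
Matrix A n = Fin n → Fin n → A

-- Laplace expansion along the first row.
det : ∀ {n} → Matrix ℝ n → ℝ
det {zero}  M = 1ℝ
det {suc n} M = sum λ j →
  (- 1ℝ) ^ toℕ j * M zero j * det (λ i k → M (suc i) (punchIn j k))

scalar : ∀ {n} → ℝ → Matrix ℝ n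
scalar x i j = if does (i Fin.≟ j) then x else 0ℝ

charPoly : ∀ {n} → Matrix ℝ n → ℝ → ℝ
charPoly M x = det (λ i j → scalar x i j - M i j)

-- μ lists the eigenvalues of M with multiplicity: det (xI - M) = ∏ᵢ (x - μᵢ).
-- The order of the list is arbitrary.
IsSpectrum : ∀ {n} → Matrix ℝ n → Vector ℝ n → Set
IsSpectrum M μ = ∀ x → charPoly M x ≈ product (λ i → x - μ i)

-- If μ lists the eigenvalues of M, this says that at least k of them, counted
-- with multiplicity, lie in I: the injection picks distinct positions of the list.
-- A positive formulation is used since the order on ℝ is undecidable.
AtLeast_of_lieIn_ : ∀ {n} → ℕ → Vector ℝ n → Pred ℝ 0ℓ → Set
AtLeast_of_lieIn_ {n} k μ I =
  Σ (Fin k ↣ Fin n) λ f → ∀ j → μ (Injection.to f j) ∈ I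

record Graph (n : ℕ) : Set where
  field
    adj        : Fin n → Fin n → Bool
    adj-sym    : ∀ u v → adj u v ≡ adj v u
    adj-irrefl : ∀ u → adj u u ≡ false

open Graph public

data Walk {n} (G : Graph n) : ℕ → Fin n → Fin n → Set where
  here : ∀ {u} → Walk G 0 u u
  step : ∀ {k u v w} → adj G u v ≡ true → Walk G k v w → Walk G (suc k) u w

Connected : ∀ {n} → Graph n → Set
Connected G = ∀ u v → ∃[ k ] Walk G k u v

Distance : ∀ {n} → Graph n → Fin n → Fin n → ℕ → Set
Distance G u v k = Walk G k u v × (∀ l → Walk G l u v → k ℕ.≤ l)

Diameter : ∀ {n} → Graph n → ℕ → Set
Diameter G d =
  (∃[ u ] ∃[ v ] Distance G u v d) × (∀ u v k → Distance G u v k → k ℕ.≤ d)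

adjacency : ∀ {n} → Graph n → Matrix ℕ n
adjacency G u v = if adj G u v then 1 else 0

degree : ∀ {n} → Graph n → Fin n → ℕ
degree G u = RawMonoidDefs.sum ℕ.+-0-rawMonoid (adjacency G u)

degreeMatrix : ∀ {n} → Graph n → Matrix ℕ n
degreeMatrix G u v = if does (u Fin.≟ v) then degree G u else 0

signlessLaplacian : ∀ {n} → Graph n → Matrix ℝ n
signlessLaplacian G u v = fromℕ (degreeMatrix G u v ℕ.+ adjacency G u v)

{-# OPTIONS --safe #-}
module Submission where

-- G is a subgraph of the graph in which the distance layers V₀, …, V_d from the end of a diametral path
-- are cliques and consecutive layers are completely joined.  If sᵢ is the sum of a vector x over Vᵢ and qᵢ
-- the sum of the squares, then the form of cI - Q at x is therefore at least
--   Σᵢ (c + 2 - |Vᵢ₋₁| - |Vᵢ| - |Vᵢ₊₁|) qᵢ - sᵢ (sᵢ₋₁ + sᵢ + sᵢ₊₁).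
-- If s vanishes on a suitable set Z of layers containing all those with several vertices, this dominates a
-- sum of squares of differences of s, hence a positive multiple of |x|² by a discrete Poincaré inequality, and
-- all but |Z| eigenvalues are below c.  Since Σ (|Vᵢ| - 1) = n - d - 1, there is a small enough Z; only for
-- d = 2 a test vector is needed that is not given by layer sums.
--
-- The eigenvalues are only known as the roots of the characteristic polynomial.  Orthogonal eigenvectors are
-- found one at a time, by column operations that split a linear factor off det (xI - M), in the
-- double-negation monad.  This suffices: as the multiple of |x|² is rational, each eigenvalue can be decided
-- to be below c or above some c′ < c, and too many of the latter kind would be a contradiction.

-- Let m = n - d - 1 be the surplus. Three consecutive layers have at most m + 3 vertices, so for c
-- ≥ m + 2 a layer whose sum vanishes never has a negative coefficient. A layer outside `Z` is a
-- single vertex, and its coefficient c + 2 - (three layer sizes) pays 1 for its own square, 1 for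
-- the difference with the layer below, and 1 for the difference with the layer above if that one is
-- outside `Z` too. The difference with the layer below is always kept, since the Poincaré
-- inequality climbs from the empty layer 0. Hence the one-sided term `free T Z (2 + i)` and the
-- asymmetric choices of `Z`. Inverting a real requires a bound away from zero, so elimination,
-- orthogonalisation and the final estimate are written without division: c - 1/b appears only
-- multiplied by b. The characteristic polynomial is known only as a function, and a factor x - a is
-- cancelled by means of the infinitely many points at which it does not vanish.

open import Level using (0ℓ)
open import Algebra.Bundles using (CommutativeRing; Semiring; RawMonoid; RawRing)
import Algebra.Definitions.RawMonoid as RawMonoidDefs
open import Data.Sum.Base using (_⊎_; inj₁; inj₂)
open import Relation.Nullary.Negation.Core using (¬_)

-- A ring solver with integer coefficients for any commutative ring.

module IntegerSolver (R : CommutativeRing 0ℓ 0ℓ) where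
  open CommutativeRing R
  -- With this multiplication the coefficients 1 and 2 of a solver goal reduce to `1#` and
  -- `1# + 1#`, without a trailing zero, and so match the goals as they are written.
  open import Algebra.Properties.Semiring.Mult.TCOptimised semiring
    using (_×_; 1+×; ×-homo-+; ×1-homo-*)
  open import Algebra.Properties.Ring ring
    using (-0#≈0#; -‿distribˡ-*; -‿distribʳ-*; -‿involutive; -‿+-comm)
  open import Algebra.Solver.Ring.AlmostCommutativeRing
    using (fromCommutativeRing; _-Raw-AlmostCommutative⟶_; Induced-equivalence)
  open import Data.Integer.Base as ℤ using (ℤ; +_; -[1+_]; _⊖_)
  import Data.Integer.Properties as ℤ
  open import Data.Maybe.Base using (just; nothing)
  open import Data.Nat.Base as ℕ using (ℕ; zero; suc)
  open import Relation.Binary.Definitions using (WeaklyDecidable)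
  import Relation.Binary.PropositionalEquality as ≡
  open import Relation.Binary.Reasoning.Setoid setoid
  open import Relation.Nullary.Decidable.Core using (yes; no)

  fromInt : ℤ → Carrier
  fromInt (+ n)    = n × 1#
  fromInt -[1+ n ] = - (suc n × 1#)

  private
    cancel₁ : ∀ x y → x - y ≈ (1# + x) - (1# + y)
    cancel₁ x y = begin
      x - y                   ≈⟨ +-congʳ (+-identityʳ x) ⟨
      (x + 0#) - y            ≈⟨ +-congʳ (+-congˡ (-‿inverseʳ 1#)) ⟨
      (x + (1# - 1#)) - y     ≈⟨ +-congʳ (+-assoc x 1# (- 1#)) ⟨
      (x + 1#) - 1# - y       ≈⟨ +-assoc (x + 1#) (- 1#) (- y) ⟩
      (x + 1#) + (- 1# - y)   ≈⟨ +-cong (+-comm x 1#) (-‿+-comm 1# y) ⟩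
      (1# + x) - (1# + y)     ∎

    fromInt-⊖ : ∀ m n → fromInt (m ⊖ n) ≈ m × 1# - n × 1#
    fromInt-⊖ zero zero = sym (-‿inverseʳ 0#)
    fromInt-⊖ zero (suc n) = sym (+-identityˡ _)
    fromInt-⊖ (suc m) zero = sym (trans (+-congˡ -0#≈0#) (+-identityʳ _))
    fromInt-⊖ (suc m) (suc n) = begin
      fromInt (suc m ⊖ suc n)       ≡⟨ ≡.cong fromInt (ℤ.[1+m]⊖[1+n]≡m⊖n m n) ⟩
      fromInt (m ⊖ n)               ≈⟨ fromInt-⊖ m n ⟩
      m × 1# - n × 1#               ≈⟨ cancel₁ _ _ ⟩
      (1# + m × 1#) - (1# + n × 1#) ≈⟨ +-cong (1+× m 1#) (-‿cong (1+× n 1#)) ⟨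
      suc m × 1# - suc n × 1#       ∎

    fromInt-+ : ∀ i j → fromInt (i ℤ.+ j) ≈ fromInt i + fromInt j
    fromInt-+ (+ m) (+ n) = ×-homo-+ 1# m n
    fromInt-+ (+ m) -[1+ n ] = fromInt-⊖ m (suc n)
    fromInt-+ -[1+ m ] (+ n) = trans (fromInt-⊖ n (suc m)) (+-comm _ _)
    fromInt-+ -[1+ m ] -[1+ n ] = begin
      - (suc (suc (m ℕ.+ n)) × 1#)       ≡⟨ ≡.cong (λ k → - (suc k × 1#)) (ℕ-suc m n) ⟨
      - ((suc m ℕ.+ suc n) × 1#)         ≈⟨ -‿cong (×-homo-+ 1# (suc m) (suc n)) ⟩
      - (suc m × 1# + suc n × 1#)        ≈⟨ -‿+-comm _ _ ⟨
      - (suc m × 1#) - (suc n × 1#)      ∎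
      where
      import Data.Nat.Properties as ℕₚ
      ℕ-suc : ∀ m n → m ℕ.+ suc n ≡.≡ suc (m ℕ.+ n)
      ℕ-suc = ℕₚ.+-suc

    fromInt-neg : ∀ i → fromInt (ℤ.- i) ≈ - fromInt i
    fromInt-neg (+ zero) = sym -0#≈0#
    fromInt-neg (+ suc n) = refl
    fromInt-neg -[1+ n ] = sym (-‿involutive _)

    fromInt-pos* : ∀ m j → fromInt (+ m ℤ.* j) ≈ m × 1# * fromInt j
    fromInt-pos* m (+ n) = begin
      fromInt (+ m ℤ.* + n)   ≡⟨ ≡.cong fromInt (ℤ.pos-* m n) ⟨
      (m ℕ.* n) × 1#          ≈⟨ ×1-homo-* m n ⟩
      m × 1# * (n × 1#)       ∎
    fromInt-pos* m -[1+ n ] = begin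
      fromInt (+ m ℤ.* -[1+ n ])          ≡⟨ ≡.cong fromInt (ℤ.neg-distribʳ-* (+ m) (+ suc n)) ⟨
      fromInt (ℤ.- (+ m ℤ.* + suc n))     ≈⟨ fromInt-neg (+ m ℤ.* + suc n) ⟩
      - fromInt (+ m ℤ.* + suc n)         ≈⟨ -‿cong (fromInt-pos* m (+ suc n)) ⟩
      - (m × 1# * (suc n × 1#))           ≈⟨ -‿distribʳ-* _ _ ⟩
      m × 1# * - (suc n × 1#)             ∎

    fromInt-* : ∀ i j → fromInt (i ℤ.* j) ≈ fromInt i * fromInt j
    fromInt-* (+ m) j = fromInt-pos* m j
    fromInt-* -[1+ m ] j = begin
      fromInt (-[1+ m ] ℤ.* j)            ≡⟨ ≡.cong fromInt (ℤ.neg-distribˡ-* (+ suc m) j) ⟨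
      fromInt (ℤ.- (+ suc m ℤ.* j))       ≈⟨ fromInt-neg (+ suc m ℤ.* j) ⟩
      - fromInt (+ suc m ℤ.* j)           ≈⟨ -‿cong (fromInt-pos* (suc m) j) ⟩
      - (suc m × 1# * fromInt j)          ≈⟨ -‿distribˡ-* _ _ ⟩
      - (suc m × 1#) * fromInt j          ∎

    morphism : ℤ.+-*-rawRing -Raw-AlmostCommutative⟶ fromCommutativeRing R
    morphism = record
      { ⟦_⟧    = fromInt
      ; +-homo = fromInt-+
      ; *-homo = fromInt-*
      ; -‿homo = fromInt-neg
      ; 0-homo = refl
      ; 1-homo = refl
      }

    _≟_ : WeaklyDecidable (Induced-equivalence morphism)
    i ≟ j with i ℤ.≟ j
    ... | yes ≡.refl = just refl
    ... | no _       = nothing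

  open import Algebra.Solver.Ring ℤ.+-*-rawRing (fromCommutativeRing R) morphism _≟_ public

-- Finite sums and products.

module Sums (R : CommutativeRing 0ℓ 0ℓ) where
  open CommutativeRing R hiding (zero) renaming (Carrier to K)
  import Algebra.Definitions.RawSemiring (Semiring.rawSemiring semiring) as Raw
  import Algebra.Properties.Semiring.Sum semiring as Sum
  open import Data.Fin.Base using (Fin; zero; suc; punchIn)
  import Data.Fin.Properties as Fin
  open import Data.Nat.Base using (zero; suc)
  open import Function.Base using (_∘_)
  open import Relation.Binary.PropositionalEquality using (_≢_)
  open import Relation.Binary.Reasoning.Setoid setoid

  -- Opaque, so that the summand can be inferred by unification.
  opaque
    sum product : ∀ {n} → (Fin n → K) → K
    sum     = Raw.sum
    product = Raw.product

  opaque
    unfolding sum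

    sum-raw : ∀ {n} {f g : Fin n → K} → (∀ i → f i ≈ g i) → sum f ≈ Raw.sum g
    sum-raw = Sum.sum-cong-≋

    product-raw : ∀ {n} (f : Fin n → K) → product f ≈ Raw.product f
    product-raw f = refl

    sum-[] : {f : Fin 0 → K} → sum f ≈ 0#
    sum-[] = refl

    product-[] : {f : Fin 0 → K} → product f ≈ 1#
    product-[] = refl

    sum-∷ : ∀ {n} {f : Fin (suc n) → K} → sum f ≈ f zero + sum (f ∘ suc)
    sum-∷ = refl

    product-∷ : ∀ {n} {f : Fin (suc n) → K} → product f ≈ f zero * product (f ∘ suc)
    product-∷ = refl

    sum-cong : ∀ {n} {f g : Fin n → K} → (∀ i → f i ≈ g i) → sum f ≈ sum g
    sum-cong = Sum.sum-cong-≋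

    sum-+ : ∀ {n} {f g : Fin n → K} → sum (λ i → f i + g i) ≈ sum f + sum g
    sum-+ {f = f} {g} = Sum.∑-distrib-+ f g

    sum-*ˡ : ∀ {n} {x} {f : Fin n → K} → x * sum f ≈ sum (λ i → x * f i)
    sum-*ˡ {x = x} {f} = Sum.*-distribˡ-sum x f

    sum-*ʳ : ∀ {n} {x} {f : Fin n → K} → sum f * x ≈ sum (λ i → f i * x)
    sum-*ʳ {x = x} {f} = Sum.*-distribʳ-sum x f

    sum-comm : ∀ {m n} {f : Fin m → Fin n → K} →
      sum (λ i → sum (λ j → f i j)) ≈ sum (λ j → sum (λ i → f i j))
    sum-comm {f = f} = Sum.∑-comm f

    sum-punchIn : ∀ {n} {f : Fin (suc n) → K} i → sum f ≈ f i + sum (f ∘ punchIn i)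
    sum-punchIn {f = f} i = Sum.sum-remove {i = i} f

    sum-zero : ∀ {n} {f : Fin n → K} → (∀ i → f i ≈ 0#) → sum f ≈ 0#
    sum-zero {n} f≈0 = trans (sum-cong f≈0) (Sum.sum-replicate-zero n)

  product-cong : ∀ {n} {f g : Fin n → K} → (∀ i → f i ≈ g i) → product f ≈ product g
  product-cong {zero}  h = trans product-[] (sym product-[])
  product-cong {suc n} h =
    trans product-∷ (trans (*-cong (h zero) (product-cong (h ∘ suc))) (sym product-∷))

  product-zero : ∀ {n} {f : Fin n → K} p → f p ≈ 0# → product f ≈ 0#
  product-zero zero    h = trans product-∷ (trans (*-congʳ h) (zeroˡ _))
  product-zero (suc p) h = trans product-∷ (trans (*-congˡ (product-zero p h)) (zeroʳ _))

  product-scale : ∀ {n} {f g : Fin n → K} {a} p → (∀ i → i ≢ p → f i ≈ g i) → f p ≈ a * g p →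
    product f ≈ a * product g
  product-scale {f = f} {g} {a} zero off at = begin
    product f                            ≈⟨ product-∷ ⟩
    f zero * product (f ∘ suc)           ≈⟨ *-cong at (product-cong λ i → off (suc i) λ ()) ⟩
    a * g zero * product (g ∘ suc)       ≈⟨ *-assoc _ _ _ ⟩
    a * (g zero * product (g ∘ suc))     ≈⟨ *-congˡ product-∷ ⟨
    a * product g                        ∎
  product-scale {f = f} {g} {a} (suc p) off at = begin
    product f                            ≈⟨ product-∷ ⟩
    f zero * product (f ∘ suc)           ≈⟨ *-cong (off zero λ ()) (product-scale p (λ i i≢p →
                                              off (suc i) (i≢p ∘ Fin.suc-injective)) at) ⟩
    g zero * (a * product (g ∘ suc))     ≈⟨ *-assoc _ _ _ ⟨
    g zero * a * product (g ∘ suc)       ≈⟨ *-congʳ (*-comm _ _) ⟩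
    a * g zero * product (g ∘ suc)       ≈⟨ *-assoc _ _ _ ⟩
    a * (g zero * product (g ∘ suc))     ≈⟨ *-congˡ product-∷ ⟨
    a * product g                        ∎

  sum-single : ∀ {n} {f : Fin n → K} p → (∀ i → i ≢ p → f i ≈ 0#) → sum f ≈ f p
  sum-single {f = f} zero h = begin
    sum f                    ≈⟨ sum-∷ ⟩
    f zero + sum (f ∘ suc)   ≈⟨ +-congˡ (sum-zero λ i → h (suc i) λ ()) ⟩
    f zero + 0#              ≈⟨ +-identityʳ _ ⟩
    f zero                   ∎
  sum-single {f = f} (suc p) h = begin
    sum f                    ≈⟨ sum-∷ ⟩
    f zero + sum (f ∘ suc)   ≈⟨ +-cong (h zero λ ()) (sum-single p λ i i≢p →
                                  h (suc i) (i≢p ∘ Fin.suc-injective)) ⟩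
    0# + f (suc p)           ≈⟨ +-identityˡ _ ⟩
    f (suc p)                ∎

  sum-linear : ∀ {n} {α β} {f g : Fin n → K} →
    sum (λ i → α * f i + β * g i) ≈ α * sum f + β * sum g
  sum-linear {α = α} {β} {f} {g} = begin
    sum (λ i → α * f i + β * g i)                ≈⟨ sum-+ ⟩
    sum (λ i → α * f i) + sum (λ i → β * g i)    ≈⟨ +-cong sum-*ˡ sum-*ˡ ⟨
    α * sum f + β * sum g                        ∎

  sum-neg : ∀ {n} {f : Fin n → K} → sum (λ i → - f i) ≈ - sum f
  sum-neg {f = f} = begin
    sum (λ i → - f i)          ≈⟨ sum-cong (λ i → -1*x≈-x (f i)) ⟨
    sum (λ i → - 1# * f i)     ≈⟨ sum-*ˡ ⟨
    - 1# * sum f               ≈⟨ -1*x≈-x _ ⟩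
    - sum f                    ∎
    where open import Algebra.Properties.Ring ring using (-1*x≈-x)

  sum-- : ∀ {n} {f g : Fin n → K} → sum (λ i → f i - g i) ≈ sum f - sum g
  sum-- = trans sum-+ (+-congˡ sum-neg)

-- Determinants under column operations.

module Determinant (R : CommutativeRing 0ℓ 0ℓ) where
  open CommutativeRing R hiding (zero) renaming (Carrier to K)
  open IntegerSolver R using (solve; con; _:=_; _:+_; _:*_; :-_; _:-_)
  open import Algebra.Definitions.RawSemiring (Semiring.rawSemiring semiring) using (_^_)
  open Sums R
  open import Data.Empty using (⊥-elim)
  open import Data.Fin.Base using (Fin; zero; suc; toℕ; punchIn; punchOut; inject₁)
  import Data.Fin.Induction as Fin
  import Data.Fin.Properties as Fin
  open import Data.Integer.Base using (+_)
  open import Data.Nat.Base as ℕ using (ℕ; zero; suc)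
  import Data.Nat.Properties as ℕ
  open import Data.Product.Base using (∃-syntax; _×_; _,_)
  open import Function.Base using (_∘_; _$_)
  open import Relation.Binary.PropositionalEquality as ≡ using (_≡_; _≢_; _≗_; ≢-sym)
  open import Relation.Binary.Definitions using (tri<; tri≈; tri>)
  open import Relation.Binary.Reasoning.Setoid setoid
  open import Relation.Nullary.Decidable.Core using (yes; no)
  open import Data.Vec.Functional using (tail)

  Matrix : ℕ → Set
  Matrix n = Fin n → Fin n → K

  minor : ∀ {n} → Matrix (suc n) → Fin (suc n) → Matrix n
  minor M j i k = M (suc i) (punchIn j k)

  det : ∀ {n} → Matrix n → K
  det {zero}  M = 1#
  det {suc n} M = sum λ j → (- 1#) ^ toℕ j * M zero j * det (minor M j)

  det-cong : ∀ {n} {A B : Matrix n} → (∀ i j → A i j ≈ B i j) → det A ≈ det B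
  det-cong {zero}  A≈B = refl
  det-cong {suc n} A≈B = sum-cong λ j →
    *-cong (*-congˡ (A≈B zero j)) (det-cong λ i k → A≈B (suc i) (punchIn j k))

  det-linear : ∀ {n} (k : Fin n) α β {A B C : Matrix n} →
    (∀ i j → j ≢ k → A i j ≈ B i j) → (∀ i j → j ≢ k → A i j ≈ C i j) →
    (∀ i → A i k ≈ α * B i k + β * C i k) →
    det A ≈ α * det B + β * det C
  det-linear {suc n} k α β {A} {B} {C} A≈B A≈C Aₖ =
    trans (sum-cong term) sum-linear
    where
    term : ∀ j → (- 1#) ^ toℕ j * A zero j * det (minor A j) ≈
      α * ((- 1#) ^ toℕ j * B zero j * det (minor B j)) +
      β * ((- 1#) ^ toℕ j * C zero j * det (minor C j))
    term j with k Fin.≟ j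
    ... | yes ≡.refl = begin
      s * A zero k * det (minor A k)
        ≈⟨ *-congʳ (*-congˡ (Aₖ zero)) ⟩
      s * (α * B zero k + β * C zero k) * det (minor A k)
        ≈⟨ solve 6 (λ s α b β c d →
             s :* (α :* b :+ β :* c) :* d := α :* (s :* b :* d) :+ β :* (s :* c :* d))
             refl s α (B zero k) β (C zero k) (det (minor A k)) ⟩
      α * (s * B zero k * det (minor A k)) + β * (s * C zero k * det (minor A k))
        ≈⟨ +-cong (*-congˡ (*-congˡ (det-cong λ i l → A≈B (suc i) _ (Fin.punchInᵢ≢i k l))))
                  (*-congˡ (*-congˡ (det-cong λ i l → A≈C (suc i) _ (Fin.punchInᵢ≢i k l)))) ⟩
      α * (s * B zero k * det (minor B k)) + β * (s * C zero k * det (minor C k)) ∎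
      where s = (- 1#) ^ toℕ k
    ... | no k≢j = begin
      s * A zero j * det (minor A j)
        ≈⟨ *-congˡ (det-linear k′ α β
             (λ i l l≢ → A≈B (suc i) _ (off l≢)) (λ i l l≢ → A≈C (suc i) _ (off l≢))
             (λ i → ≡.subst (λ h → A (suc i) h ≈ α * B (suc i) h + β * C (suc i) h)
                      (≡.sym at) (Aₖ (suc i)))) ⟩
      s * A zero j * (α * det (minor B j) + β * det (minor C j))
        ≈⟨ solve 6 (λ s a α b β c →
             s :* a :* (α :* b :+ β :* c) := α :* (s :* a :* b) :+ β :* (s :* a :* c))
             refl s (A zero j) α (det (minor B j)) β (det (minor C j)) ⟩
      α * (s * A zero j * det (minor B j)) + β * (s * A zero j * det (minor C j))
        ≈⟨ +-cong (*-congˡ (*-congʳ (*-congˡ (A≈B zero j (≢-sym k≢j)))))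
                  (*-congˡ (*-congʳ (*-congˡ (A≈C zero j (≢-sym k≢j))))) ⟩
      α * (s * B zero j * det (minor B j)) + β * (s * C zero j * det (minor C j)) ∎
      where
      s = (- 1#) ^ toℕ j
      k′ = punchOut (≢-sym k≢j)
      at : punchIn j k′ ≡ k
      at = Fin.punchIn-punchOut (≢-sym k≢j)
      off : ∀ {l} → l ≢ k′ → punchIn j l ≢ k
      off l≢k′ eq = l≢k′ (Fin.punchIn-injective j _ _ (≡.trans eq (≡.sym at)))

  -- This is the shape of a Laplace expansion with two equal adjacent columns: only two terms
  -- survive, and their signs are opposite.
  alternating-sum : ∀ {n} (k : Fin n) (g : Fin (suc n) → K) →
    g (inject₁ k) ≈ g (suc k) → (∀ j → j ≢ inject₁ k → j ≢ suc k → g j ≈ 0#) →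
    sum (λ j → (- 1#) ^ toℕ j * g j) ≈ 0#
  alternating-sum {suc n} zero g eq h = begin
    sum (λ j → (- 1#) ^ toℕ j * g j)
      ≈⟨ trans sum-∷ (+-congˡ sum-∷) ⟩
    1# * g zero + (- 1# * 1# * g (suc zero) + sum (λ j → (- 1#) ^ toℕ (suc (suc j)) * g (suc (suc j))))
      ≈⟨ +-cong (*-congˡ eq) (+-congˡ (sum-zero λ j →
           trans (*-congˡ (h (suc (suc j)) (λ ()) (λ ()))) (zeroʳ _))) ⟩
    1# * g (suc zero) + (- 1# * 1# * g (suc zero) + 0#)
      ≈⟨ solve 1 (λ x → con (+ 1) :* x :+ (:- con (+ 1) :* con (+ 1) :* x :+ con (+ 0)) := con (+ 0))
           refl (g (suc zero)) ⟩
    0# ∎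
  alternating-sum {suc n} (suc k) g eq h = begin
    sum (λ j → (- 1#) ^ toℕ j * g j)
      ≈⟨ sum-∷ ⟩
    1# * g zero + sum (λ j → - 1# * (- 1#) ^ toℕ j * g (suc j))
      ≈⟨ +-cong (*-congˡ (h zero (λ ()) (λ ())))
                (sum-cong λ j → *-assoc (- 1#) ((- 1#) ^ toℕ j) (g (suc j))) ⟩
    1# * 0# + sum (λ j → - 1# * ((- 1#) ^ toℕ j * g (suc j)))
      ≈⟨ +-cong (zeroʳ 1#) (sym sum-*ˡ) ⟩
    0# + - 1# * sum (λ j → (- 1#) ^ toℕ j * g (suc j))
      ≈⟨ +-congˡ (*-congˡ (alternating-sum k (g ∘ suc) eq λ j j≢ j≢′ →
           h (suc j) (j≢ ∘ Fin.suc-injective) (j≢′ ∘ Fin.suc-injective))) ⟩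
    0# + - 1# * 0#
      ≈⟨ trans (+-identityˡ _) (zeroʳ _) ⟩
    0# ∎

  private
    -- Leaving out column k or column k + 1 gives the same list of columns, except that one position
    -- shows k + 1 in the first case and k in the second.
    punchIn-adjacent : ∀ {n} (k : Fin n) (l : Fin n) →
      punchIn (inject₁ k) l ≡ punchIn (suc k) l ⊎
      (punchIn (inject₁ k) l ≡ suc k × punchIn (suc k) l ≡ inject₁ k)
    punchIn-adjacent zero    zero    = inj₂ (≡.refl , ≡.refl)
    punchIn-adjacent zero    (suc l) = inj₁ ≡.refl
    punchIn-adjacent (suc k) zero    = inj₁ ≡.refl
    punchIn-adjacent (suc k) (suc l) with punchIn-adjacent k l
    ... | inj₁ eq        = inj₁ (≡.cong suc eq)
    ... | inj₂ (e₁ , e₂) = inj₂ (≡.cong suc e₁ , ≡.cong suc e₂)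

    -- Leaving out any other column keeps both columns, and keeps them adjacent, so that induction
    -- applies to the minor.
    punchOut-adjacent : ∀ {n} (k : Fin (suc n)) (j : Fin (suc (suc n))) →
      j ≢ inject₁ k → j ≢ suc k →
      ∃[ k′ ] (punchIn j (inject₁ {n} k′) ≡ inject₁ k × punchIn j (suc k′) ≡ suc k)
    punchOut-adjacent zero zero j≢ _ = ⊥-elim (j≢ ≡.refl)
    punchOut-adjacent zero (suc zero) _ j≢ = ⊥-elim (j≢ ≡.refl)
    punchOut-adjacent {suc n} zero (suc (suc j)) _ _ = zero , ≡.refl , ≡.refl
    punchOut-adjacent {suc n} (suc k) zero _ _ = k , ≡.refl , ≡.refl
    punchOut-adjacent {suc n} (suc k) (suc j) j≢ j≢′
      with punchOut-adjacent k j (j≢ ∘ ≡.cong suc) (j≢′ ∘ ≡.cong suc)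
    ... | k′ , e₁ , e₂ = suc k′ , ≡.cong suc e₁ , ≡.cong suc e₂

  -- In the expansion along the first row, every minor that retains both columns vanishes by
  -- induction, and the two remaining minors coincide.
  det-adjacent : ∀ {n} (k : Fin n) (A : Matrix (suc n)) →
    (∀ i → A i (inject₁ k) ≈ A i (suc k)) → det A ≈ 0#
  det-adjacent {suc n} k A eq = trans
    (sum-cong λ j → *-assoc ((- 1#) ^ toℕ j) (A zero j) (det (minor A j)))
    (alternating-sum k (λ j → A zero j * det (minor A j))
      (*-cong (eq zero) (det-cong same)) vanish)
    where
    same : ∀ i l → minor A (inject₁ k) i l ≈ minor A (suc k) i l
    same i l with punchIn-adjacent k l
    ... | inj₁ e = reflexive (≡.cong (A (suc i)) e)
    ... | inj₂ (e₁ , e₂) = begin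
      A (suc i) (punchIn (inject₁ k) l)  ≡⟨ ≡.cong (A (suc i)) e₁ ⟩
      A (suc i) (suc k)                  ≈⟨ eq (suc i) ⟨
      A (suc i) (inject₁ k)              ≡⟨ ≡.cong (A (suc i)) e₂ ⟨
      A (suc i) (punchIn (suc k) l)      ∎
    vanish : ∀ j → j ≢ inject₁ k → j ≢ suc k → A zero j * det (minor A j) ≈ 0#
    vanish j j≢ j≢′ with punchOut-adjacent k j j≢ j≢′
    ... | k′ , e₁ , e₂ = trans (*-congˡ (det-adjacent k′ (minor A j) λ i → begin
      A (suc i) (punchIn j (inject₁ k′))  ≡⟨ ≡.cong (A (suc i)) e₁ ⟩
      A (suc i) (inject₁ k)               ≈⟨ eq (suc i) ⟩
      A (suc i) (suc k)                   ≡⟨ ≡.cong (A (suc i)) e₂ ⟨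
      A (suc i) (punchIn j (suc k′))      ∎)) (zeroʳ _)

  setColumn : ∀ {n} → Matrix n → Fin n → (Fin n → K) → Matrix n
  setColumn A k v i j with j Fin.≟ k
  ... | yes _ = v i
  ... | no  _ = A i j

  setColumn-at : ∀ {n} (A : Matrix n) k v i → setColumn A k v i k ≡ v i
  setColumn-at A k v i with k Fin.≟ k
  ... | yes _  = ≡.refl
  ... | no k≢k = ⊥-elim (k≢k ≡.refl)

  setColumn-off : ∀ {n} (A : Matrix n) {k} v i {j} → j ≢ k → setColumn A k v i j ≡ A i j
  setColumn-off A {k} v i {j} j≢k with j Fin.≟ k
  ... | yes j≡k = ⊥-elim (j≢k j≡k)
  ... | no  _   = ≡.refl

  det-column-+ : ∀ {n} (A : Matrix n) k u v →
    det (setColumn A k (λ i → u i + v i)) ≈ det (setColumn A k u) + det (setColumn A k v)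
  det-column-+ A k u v = begin
    det (setColumn A k (λ i → u i + v i))
      ≈⟨ det-linear k 1# 1#
           (λ i j j≢k → reflexive (≡.trans (setColumn-off A _ i j≢k) (≡.sym (setColumn-off A u i j≢k))))
           (λ i j j≢k → reflexive (≡.trans (setColumn-off A _ i j≢k) (≡.sym (setColumn-off A v i j≢k))))
           (λ i → begin
             setColumn A k (λ i → u i + v i) i k   ≡⟨ setColumn-at A k _ i ⟩
             u i + v i                             ≈⟨ +-cong (*-identityˡ _) (*-identityˡ _) ⟨
             1# * u i + 1# * v i
               ≡⟨ ≡.cong₂ (λ x y → 1# * x + 1# * y) (setColumn-at A k u i) (setColumn-at A k v i) ⟨
             1# * setColumn A k u i k + 1# * setColumn A k v i k ∎) ⟩
    1# * det (setColumn A k u) + 1# * det (setColumn A k v)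
      ≈⟨ +-cong (*-identityˡ _) (*-identityˡ _) ⟩
    det (setColumn A k u) + det (setColumn A k v) ∎

  setColumns : ∀ {n} → Matrix n → (p q : Fin n) → (u v : Fin n → K) → Matrix n
  setColumns A p q u v = setColumn (setColumn A p u) q v

  private
    setColumns-swap : ∀ {n} (A : Matrix n) {p q} u v → p ≢ q →
      ∀ i j → setColumns A p q u v i j ≡ setColumn (setColumn A q v) p u i j
    setColumns-swap A {p} {q} u v p≢q i j with j Fin.≟ q | j Fin.≟ p
    ... | yes ≡.refl | yes ≡.refl = ⊥-elim (p≢q ≡.refl)
    ... | yes ≡.refl | no _       = ≡.sym (setColumn-at A j v i)
    ... | no j≢q     | yes ≡.refl = setColumn-at A j u i
    ... | no j≢q     | no j≢p     =
      ≡.trans (setColumn-off A u i j≢p) (≡.sym (setColumn-off A v i j≢q))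

  -- Polarisation: expand the vanishing determinant that has u + v in both columns.
  det-alternating-swap : ∀ {n} {p q : Fin n} → p ≢ q →
    (∀ A → (∀ i → A i p ≈ A i q) → det A ≈ 0#) →
    ∀ A u v → det (setColumns A p q u v) + det (setColumns A p q v u) ≈ 0#
  det-alternating-swap {n} {p} {q} p≢q alt A u v = begin
    D u v + D v u
      ≈⟨ +-cong (+-identityˡ _) (+-identityʳ _) ⟨
    (0# + D u v) + (D v u + 0#)
      ≈⟨ +-cong (+-congʳ (twice u)) (+-congˡ (twice v)) ⟨
    (D u u + D u v) + (D v u + D v v)
      ≈⟨ +-cong (det-column-+ (setColumn A p u) q u v) (det-column-+ (setColumn A p v) q u v) ⟨
    D u w + D v w
      ≈⟨ +-cong (swapped u w) (swapped v w) ⟩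
    det (setColumn (setColumn A q w) p u) + det (setColumn (setColumn A q w) p v)
      ≈⟨ det-column-+ (setColumn A q w) p u v ⟨
    det (setColumn (setColumn A q w) p w)
      ≈⟨ swapped w w ⟨
    D w w
      ≈⟨ twice w ⟩
    0# ∎
    where
    w : Fin n → K
    w i = u i + v i
    D : (x y : Fin n → K) → K
    D x y = det (setColumns A p q x y)
    swapped : ∀ x y → D x y ≈ det (setColumn (setColumn A q y) p x)
    swapped x y = det-cong λ i j → reflexive (setColumns-swap A x y p≢q i j)
    twice : ∀ x → D x x ≈ 0#
    twice x = alt _ λ i → reflexive (≡.trans (setColumn-off (setColumn A p x) x i p≢q)
      (≡.trans (setColumn-at A p x i) (≡.sym (setColumn-at (setColumn A p x) q x i))))

  private
    setColumns-id : ∀ {n} (A : Matrix n) p q i j →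
      setColumns A p q (λ i → A i p) (λ i → A i q) i j ≡ A i j
    setColumns-id A p q i j with j Fin.≟ q
    ... | yes ≡.refl = ≡.refl
    ... | no _ with j Fin.≟ p
    ...   | yes ≡.refl = ≡.refl
    ...   | no _       = ≡.refl

    -- Induction on the right-hand column. Exchanging it with its left neighbour only changes the
    -- sign and brings it one place closer to p, until the two equal columns are adjacent.
    det-alternating-< : ∀ {n} (q p : Fin (suc n)) → toℕ p ℕ.< toℕ q →
      ∀ A → (∀ i → A i p ≈ A i q) → det A ≈ 0#
    det-alternating-< {n} = Fin.<-weakInduction P (λ _ ()) next
      where
      P : Fin (suc n) → Set
      P q = ∀ p → toℕ p ℕ.< toℕ q → ∀ A → (∀ i → A i p ≈ A i q) → det A ≈ 0#
      next : ∀ k → P (inject₁ k) → P (suc k)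
      next k ih p p<k A eq with p Fin.≟ inject₁ k
      ... | yes ≡.refl = det-adjacent k A eq
      ... | no p≢k = begin
        det A
          ≈⟨ det-cong (λ i j → reflexive (setColumns-id A (inject₁ k) (suc k) i j)) ⟨
        det (setColumns A (inject₁ k) (suc k) u v)
          ≈⟨ +-identityʳ _ ⟨
        det (setColumns A (inject₁ k) (suc k) u v) + 0#
          ≈⟨ +-congˡ (ih p p<k′ B agree) ⟨
        det (setColumns A (inject₁ k) (suc k) u v) + det B
          ≈⟨ det-alternating-swap k≢ (det-adjacent k) A u v ⟩
        0# ∎
        where
        u v : Fin (suc n) → K
        u i = A i (inject₁ k)
        v i = A i (suc k)
        B = setColumns A (inject₁ k) (suc k) v u
        k≢ : inject₁ k ≢ suc k
        k≢ e = ℕ.1+n≢n (≡.trans (≡.sym (≡.cong toℕ e)) (Fin.toℕ-inject₁ k))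
        p<k′ : toℕ p ℕ.< toℕ (inject₁ k)
        p<k′ = ℕ.≤∧≢⇒< (≡.subst (toℕ p ℕ.≤_) (≡.sym (Fin.toℕ-inject₁ k)) (ℕ.s≤s⁻¹ p<k))
                 (p≢k ∘ Fin.toℕ-injective)
        p≢sk : p ≢ suc k
        p≢sk e = ℕ.<-irrefl (≡.cong toℕ e) p<k
        agree : ∀ i → B i p ≈ B i (inject₁ k)
        agree i = begin
          B i p            ≡⟨ setColumn-off (setColumn A (inject₁ k) v) u i p≢sk ⟩
          setColumn A (inject₁ k) v i p  ≡⟨ setColumn-off A v i p≢k ⟩
          A i p            ≈⟨ eq i ⟩
          A i (suc k)      ≡⟨ setColumn-at A (inject₁ k) v i ⟨
          setColumn A (inject₁ k) v i (inject₁ k)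
            ≡⟨ setColumn-off (setColumn A (inject₁ k) v) u i k≢ ⟨
          B i (inject₁ k)  ∎

  det-alternating : ∀ {n} {p q : Fin n} → p ≢ q →
    ∀ A → (∀ i → A i p ≈ A i q) → det A ≈ 0#
  det-alternating {suc n} {p} {q} p≢q A eq with ℕ.<-cmp (toℕ p) (toℕ q)
  ... | tri< p<q _ _ = det-alternating-< q p p<q A eq
  ... | tri≈ _ p≡q _ = ⊥-elim (p≢q (Fin.toℕ-injective p≡q))
  ... | tri> _ _ q<p = det-alternating-< p q q<p A (sym ∘ eq)

  -- The computation behind Cramer's rule: by linearity in column p, each column l other than p
  -- enters next to a second copy of itself and contributes nothing.
  det-column-combination : ∀ {n} (p : Fin n) (z : Fin n → K) {A B : Matrix n} →
    (∀ i j → j ≢ p → B i j ≈ A i j) → (∀ i → B i p ≈ sum λ l → z l * A i l) →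
    det B ≈ z p * det A
  det-column-combination {n} p z {A} {B} off at = begin
    det B
      ≈⟨ det-cong entry ⟩
    det (setColumn A p (λ i → sum λ l → z l * A i l))
      ≈⟨ expand z (λ l i → A i l) ⟩
    sum (λ l → z l * det (setColumn A p (λ i → A i l)))
      ≈⟨ sum-single p (λ l l≢p → trans (*-congˡ (vanish l l≢p)) (zeroʳ _)) ⟩
    z p * det (setColumn A p (λ i → A i p))
      ≈⟨ *-congˡ (det-cong λ i j → reflexive (same i j)) ⟩
    z p * det A ∎
    where
    entry : ∀ i j → B i j ≈ setColumn A p (λ i → sum λ l → z l * A i l) i j
    entry i j with j Fin.≟ p
    ... | yes ≡.refl = at i
    ... | no j≢p     = off i j j≢p
    same : ∀ i j → setColumn A p (λ i → A i p) i j ≡ A i j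
    same i j with j Fin.≟ p
    ... | yes ≡.refl = ≡.refl
    ... | no _       = ≡.refl
    vanish : ∀ l → l ≢ p → det (setColumn A p (λ i → A i l)) ≈ 0#
    vanish l l≢p = det-alternating l≢p _ λ i → reflexive
      (≡.trans (setColumn-off A _ i l≢p) (≡.sym (setColumn-at A p _ i)))
    expand : ∀ {m} (z : Fin m → K) (V : Fin m → Fin n → K) →
      det (setColumn A p (λ i → sum λ l → z l * V l i)) ≈
      sum (λ l → z l * det (setColumn A p (V l)))
    expand {zero} z V = begin
      det (setColumn A p (λ i → sum λ l → z l * V l i))
        ≈⟨ det-linear p 0# 0# {C = A} (λ i j j≢p → reflexive (setColumn-off A _ i j≢p))
             (λ i j j≢p → reflexive (setColumn-off A _ i j≢p))
             (λ i → trans (trans (reflexive (setColumn-at A p _ i)) sum-[])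
                      (sym (trans (+-cong (zeroˡ (A i p)) (zeroˡ (A i p))) (+-identityˡ 0#)))) ⟩
      0# * det A + 0# * det A
        ≈⟨ trans (+-cong (zeroˡ _) (zeroˡ _)) (trans (+-identityˡ 0#) (sym sum-[])) ⟩
      sum (λ l → z l * det (setColumn A p (V l))) ∎
    expand {suc m} z V = begin
      det (setColumn A p (λ i → sum λ l → z l * V l i))
        ≈⟨ det-linear p (z zero) 1#
             (λ i j j≢p → reflexive (≡.trans (setColumn-off A _ i j≢p)
               (≡.sym (setColumn-off A (V zero) i j≢p))))
             (λ i j j≢p → reflexive (≡.trans (setColumn-off A _ i j≢p)
               (≡.sym (setColumn-off A w i j≢p))))
             (λ i → trans (trans (reflexive (setColumn-at A p _ i)) sum-∷) (sym (+-cong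
               (*-congˡ (reflexive (setColumn-at A p (V zero) i)))
               (trans (*-identityˡ _) (reflexive (setColumn-at A p w i)))))) ⟩
      z zero * det (setColumn A p (V zero)) + 1# * det (setColumn A p w)
        ≈⟨ +-congˡ (trans (*-identityˡ _) (expand (z ∘ suc) (V ∘ suc))) ⟩
      z zero * det (setColumn A p (V zero)) + sum (λ l → z (suc l) * det (setColumn A p (V (suc l))))
        ≈⟨ sum-∷ ⟨
      sum (λ l → z l * det (setColumn A p (V l))) ∎
      where
      w : Fin n → K
      w i = sum λ l → z (suc l) * V (suc l) i

  det-shear : ∀ {n} {p j : Fin n} → j ≢ p → ∀ α β {A B : Matrix n} →
    (∀ i l → l ≢ p → B i l ≈ A i l) → (∀ i → B i p ≈ α * A i p + β * A i j) →
    det B ≈ α * det A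
  det-shear {n} {p} {j} j≢p α β {A} {B} off at = begin
    det B
      ≈⟨ det-linear p α β {C = C} off
           (λ i l l≢p → trans (off i l l≢p) (reflexive (≡.sym (setColumn-off A _ i l≢p))))
           (λ i → trans (at i) (+-congˡ (*-congˡ (reflexive (≡.sym (setColumn-at A p _ i)))))) ⟩
    α * det A + β * det C
      ≈⟨ +-congˡ (*-congˡ (det-alternating j≢p C λ i → reflexive
           (≡.trans (setColumn-off A _ i j≢p) (≡.sym (setColumn-at A p _ i))))) ⟩
    α * det A + β * 0#
      ≈⟨ trans (+-congˡ (zeroʳ β)) (+-identityʳ _) ⟩
    α * det A ∎
    where C = setColumn A p (λ i → A i j)

  -- Columns are replaced one at a time, the first one last.
  replace-columns : ∀ {n} {V : Set} (F : (Fin n → V) → K) →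
    (∀ {c c′} → c ≗ c′ → F c ≈ F c′) → ∀ (a a′ : Fin n → V) (α : Fin n → K) →
    (∀ p c c′ → (∀ l → c l ≡ a l ⊎ c l ≡ a′ l) → c p ≡ a p → c′ p ≡ a′ p →
      (∀ l → l ≢ p → c′ l ≡ c l) → F c′ ≈ α p * F c) →
    F a′ ≈ product α * F a
  replace-columns {zero} F F-cong a a′ α h = trans (F-cong λ ()) (sym (trans (*-congʳ product-[]) (*-identityˡ _)))
  replace-columns {suc n} {V} F F-cong a a′ α h = begin
    F a′                                ≈⟨ F-cong (λ { zero → ≡.refl ; (suc l) → ≡.refl }) ⟩
    G (tail a′)                         ≈⟨ replace-columns G
                                             (λ e → F-cong λ { zero → ≡.refl ; (suc l) → e l })
                                             (tail a) (tail a′) (tail α) step ⟩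
    product (tail α) * G (tail a)       ≈⟨ *-congˡ (h zero a (a′ zero ∷ tail a) (λ _ → inj₁ ≡.refl)
                                             ≡.refl ≡.refl
                                             λ { zero 0≢0 → ⊥-elim (0≢0 ≡.refl) ; (suc l) _ → ≡.refl }) ⟩
    product (tail α) * (α zero * F a)   ≈⟨ solve 3 (λ x y z → x :* (y :* z) := y :* x :* z) refl
                                             (product (tail α)) (α zero) (F a) ⟩
    α zero * product (tail α) * F a     ≈⟨ *-congʳ product-∷ ⟨
    product α * F a                     ∎
    where
    open import Data.Vec.Functional using (_∷_)
    G : (Fin n → V) → K
    G c = F (a′ zero ∷ c)
    step : ∀ p c c′ → (∀ l → c l ≡ a (suc l) ⊎ c l ≡ a′ (suc l)) → c p ≡ a (suc p) →
      c′ p ≡ a′ (suc p) → (∀ l → l ≢ p → c′ l ≡ c l) → G c′ ≈ α (suc p) * G c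
    step p c c′ mix e e′ off = h (suc p) (a′ zero ∷ c) (a′ zero ∷ c′)
      (λ { zero → inj₂ ≡.refl ; (suc l) → mix l }) e e′
      (λ { zero _ → ≡.refl ; (suc l) l≢ → off l (l≢ ∘ ≡.cong suc) })

  -- Column j is fixed by the conditions on `α j` and `β j`, so at every stage, whichever columns
  -- have been replaced already, it is available for shearing the next one.
  det-eliminate : ∀ {n} (j : Fin n) (α β : Fin n → K) {A B : Matrix n} →
    α j ≈ 1# → β j ≈ 0# → (∀ i l → B i l ≈ α l * A i l + β l * A i j) →
    det B ≈ product α * det A
  det-eliminate {n} j α β {A} {B} αⱼ βⱼ eq =
    replace-columns (λ c → det λ i l → c l i) (λ e → det-cong λ i l → reflexive (≡.cong (_$ i) (e l)))
      (λ l i → A i l) (λ l i → B i l) α step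
    where
    Bⱼ : ∀ i → B i j ≈ A i j
    Bⱼ i = begin
      B i j                         ≈⟨ eq i j ⟩
      α j * A i j + β j * A i j     ≈⟨ +-cong (*-congʳ αⱼ) (*-congʳ βⱼ) ⟩
      1# * A i j + 0# * A i j       ≈⟨ +-cong (*-identityˡ _) (zeroˡ _) ⟩
      A i j + 0#                    ≈⟨ +-identityʳ _ ⟩
      A i j                         ∎
    step : ∀ p (c c′ : Fin n → Fin n → K) →
      (∀ l → c l ≡ (λ i → A i l) ⊎ c l ≡ (λ i → B i l)) →
      c p ≡ (λ i → A i p) → c′ p ≡ (λ i → B i p) → (∀ l → l ≢ p → c′ l ≡ c l) →
      det (λ i l → c′ l i) ≈ α p * det (λ i l → c l i)
    step p c c′ mix e e′ off with j Fin.≟ p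
    ... | yes ≡.refl = trans (det-cong same) (sym (trans (*-congʳ αⱼ) (*-identityˡ _)))
      where
      same : ∀ i l → c′ l i ≈ c l i
      same i l with l Fin.≟ j
      ... | yes ≡.refl = trans (reflexive (≡.cong (_$ i) e′)) (trans (Bⱼ i) (reflexive (≡.cong (_$ i) (≡.sym e))))
      ... | no l≢j     = reflexive (≡.cong (_$ i) (off l l≢j))
    ... | no j≢p = det-shear j≢p (α p) (β p)
      (λ i l l≢p → reflexive (≡.cong (_$ i) (off l l≢p)))
      (λ i → trans (reflexive (≡.cong (_$ i) e′)) (trans (eq i p)
        (+-cong (*-congˡ (reflexive (≡.cong (_$ i) (≡.sym e)))) (*-congˡ (cⱼ i)))))
      where
      cⱼ : ∀ i → A i j ≈ c j i
      cⱼ i with mix j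
      ... | inj₁ eⱼ = reflexive (≡.cong (_$ i) (≡.sym eⱼ))
      ... | inj₂ eⱼ = trans (sym (Bⱼ i)) (reflexive (≡.cong (_$ i) (≡.sym eⱼ)))

-- Sums, products and powers formed with operations that are pointwise equal to those of R.
module RawOperations (R : CommutativeRing 0ℓ 0ℓ) where
  open CommutativeRing R hiding (zero) renaming (Carrier to K)
  open Sums R
  open Determinant R
  open import Algebra.Definitions.RawSemiring (Semiring.rawSemiring semiring) using (_^_)
  open import Data.Fin.Base using (Fin; zero; suc)
  open import Data.Nat.Base using (ℕ; zero; suc)
  open import Data.Vec.Functional using (foldr)
  open import Function.Base using (_∘_)
  open import Relation.Binary.PropositionalEquality as ≡ using (_≡_)

  power : {A : Set} → (A → A → A) → A → A → ℕ → A
  power _∙_ e x zero    = e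
  power _∙_ e x (suc k) = x ∙ power _∙_ e x k

  module _ (M : RawMonoid 0ℓ 0ℓ) where
    open RawMonoid M using (_∙_; ε)
    open RawMonoidDefs M using () renaming (_×_ to _×ᴹ_)

    power≡× : ∀ x k → power _∙_ ε x k ≡ k ×ᴹ x
    power≡× x zero    = ≡.refl
    power≡× x (suc k) = ≡.cong (x ∙_) (power≡× x k)

  module _ (_+′_ : K → K → K) (+≡ : ∀ x y → x + y ≡ x +′ y) where
    sum-foldr : ∀ {n} {f g : Fin n → K} → (∀ i → f i ≈ g i) → sum f ≈ foldr _+′_ 0# g
    sum-foldr {zero}  h = sum-[]
    sum-foldr {suc n} h = trans sum-∷ (trans (+-cong (h zero) (sum-foldr (h ∘ suc))) (reflexive (+≡ _ _)))

  module _ (_*′_ : K → K → K) (*≡ : ∀ x y → x * y ≡ x *′ y) where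
    product-foldr : ∀ {n} {f g : Fin n → K} → (∀ i → f i ≈ g i) → product f ≈ foldr _*′_ 1# g
    product-foldr {zero}  h = product-[]
    product-foldr {suc n} h =
      trans product-∷ (trans (*-cong (h zero) (product-foldr (h ∘ suc))) (reflexive (*≡ _ _)))

    power-cong : ∀ x y → x ≡ y → ∀ k → x ^ k ≈ power _*′_ 1# y k
    power-cong x y x≡y zero    = refl
    power-cong x y x≡y (suc k) = trans (*-cong (reflexive x≡y) (power-cong x y x≡y k)) (reflexive (*≡ _ _))

-- Double negation and ordered rings with a weak trichotomy.

-- Classical reasoning takes place in the double-negation monad, which commutes with finite products.
module Classical where
  open import Data.Fin.Base using (Fin; zero; suc)
  open import Data.Nat.Base using (zero; suc)
  open import Data.Product.Base using (∃; _,_)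

  pure : {A : Set} → A → ¬ ¬ A
  pure a k = k a

  infixl 1 _>>=_
  _>>=_ : {A B : Set} → ¬ ¬ A → (A → ¬ ¬ B) → ¬ ¬ B
  (m >>= f) k = m λ a → f a k

  em : (A : Set) → ¬ ¬ (A ⊎ ¬ A)
  em A k = k (inj₂ λ a → k (inj₁ a))

  find : {A : Set} (P : A → Set) → ¬ ¬ (∃ P ⊎ (∀ a → ¬ P a))
  find P = em (∃ P) >>= λ where
    (inj₁ p)  → pure (inj₁ p)
    (inj₂ ¬p) → pure (inj₂ λ a pa → ¬p (a , pa))

  finite-choice : ∀ {n} {P : Fin n → Set} → (∀ i → ¬ ¬ P i) → ¬ ¬ (∀ i → P i)
  finite-choice {zero}  h = pure λ ()
  finite-choice {suc n} h = h zero >>= λ p → finite-choice (λ i → h (suc i)) >>= λ q →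
    pure λ { zero → p ; (suc i) → q i }

-- What Cauchy reals offer constructively: the sign of a number is known only under double negation,
-- but a doubly negated equation may be used as an equation. Cancellation then follows from the
-- positivity of squares, without inverses.
record PositiveCone (R : CommutativeRing 0ℓ 0ℓ) : Set₁ where
  open CommutativeRing R
  field
    Pos        : Carrier → Set
    Pos-resp   : ∀ {x y} → x ≈ y → Pos x → Pos y
    Pos-+      : ∀ {x y} → Pos x → Pos y → Pos (x + y)
    Pos-*      : ∀ {x y} → Pos x → Pos y → Pos (x * y)
    Pos-1      : Pos 1#
    Pos⇒≉0     : ∀ {x} → Pos x → ¬ x ≈ 0#
    trichotomy : ∀ x → ¬ ¬ (Pos x ⊎ x ≈ 0# ⊎ Pos (- x))
    stable     : ∀ {x y} → ¬ ¬ x ≈ y → x ≈ y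

module Ordered (R : CommutativeRing 0ℓ 0ℓ) (C : PositiveCone R) where
  open CommutativeRing R hiding (zero) renaming (Carrier to K)
  open PositiveCone C public
  open Classical
  open Sums R
  open IntegerSolver R using (solve; _:=_; _:*_; :-_)
  open import Algebra.Properties.Ring ring using (-0#≈0#)
  open import Data.Empty using (⊥; ⊥-elim)
  open import Data.Fin.Base using (Fin; zero; suc)
  open import Data.Nat.Base using (zero; suc)
  open import Function.Base using (_∘_)
  open import Data.Integer.Base using (+_)
  open import Algebra.Properties.Semiring.Mult semiring using (_×_)

  -- Being a negation, this can be proved inside the double-negation monad and taken out of it.
  Nonneg : K → Set
  Nonneg x = ¬ Pos (- x)

  ¬Pos-both : ∀ {x} → Pos x → Pos (- x) → ⊥
  ¬Pos-both p q = Pos⇒≉0 (Pos-+ p q) (-‿inverseʳ _)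

  ¬Pos-0 : ¬ Pos 0#
  ¬Pos-0 p = Pos⇒≉0 p refl

  Nonneg-resp : ∀ {x y} → x ≈ y → Nonneg x → Nonneg y
  Nonneg-resp x≈y n p = n (Pos-resp (-‿cong (sym x≈y)) p)

  Pos⇒Nonneg : ∀ {x} → Pos x → Nonneg x
  Pos⇒Nonneg = ¬Pos-both

  Nonneg-0 : Nonneg 0#
  Nonneg-0 p = ¬Pos-0 (Pos-resp -0#≈0# p)

  Nonneg-cases : ∀ {x} → Nonneg x → ¬ ¬ (Pos x ⊎ x ≈ 0#)
  Nonneg-cases {x} n = trichotomy x >>= λ where
    (inj₁ p)        → pure (inj₁ p)
    (inj₂ (inj₁ e)) → pure (inj₂ e)
    (inj₂ (inj₂ q)) → ⊥-elim (n q)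

  Pos-+-Nonneg : ∀ {x y} → Pos x → Nonneg y → ¬ ¬ Pos (x + y)
  Pos-+-Nonneg p n = Nonneg-cases n >>= λ where
    (inj₁ q) → pure (Pos-+ p q)
    (inj₂ e) → pure (Pos-resp (sym (trans (+-congˡ e) (+-identityʳ _))) p)

  Nonneg-+ : ∀ {x y} → Nonneg x → Nonneg y → Nonneg (x + y)
  Nonneg-+ {x} {y} n m p = (Nonneg-cases n >>= λ where
    (inj₁ q) → Pos-+-Nonneg q m
    (inj₂ e) → ⊥-elim (m (Pos-resp (-‿cong (trans (+-congʳ e) (+-identityˡ y))) p)))
    λ q → ¬Pos-both q p

  Nonneg-* : ∀ {x y} → Nonneg x → Nonneg y → Nonneg (x * y)
  Nonneg-* {x} {y} n m p = (Nonneg-cases n >>= λ where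
    (inj₂ e) → ⊥-elim (¬Pos-0 (Pos-resp (trans (-‿cong (trans (*-congʳ e) (zeroˡ y))) -0#≈0#) p))
    (inj₁ q) → Nonneg-cases m >>= λ where
      (inj₂ e) → ⊥-elim (¬Pos-0 (Pos-resp (trans (-‿cong (trans (*-congˡ e) (zeroʳ x))) -0#≈0#) p))
      (inj₁ r) → pure (Pos-* q r))
    λ q → ¬Pos-both q p

  ≉0-cases : ∀ {x} → ¬ x ≈ 0# → ¬ ¬ (Pos x ⊎ Pos (- x))
  ≉0-cases {x} x≉0 = trichotomy x >>= λ where
    (inj₁ p)        → pure (inj₁ p)
    (inj₂ (inj₁ e)) → ⊥-elim (x≉0 e)
    (inj₂ (inj₂ q)) → pure (inj₂ q)

  neg*neg : ∀ x y → - x * - y ≈ x * y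
  neg*neg = solve 2 (λ x y → :- x :* :- y := x :* y) refl

  Pos-square : ∀ {x} → ¬ x ≈ 0# → ¬ ¬ Pos (x * x)
  Pos-square {x} x≉0 = ≉0-cases x≉0 >>= λ where
    (inj₁ p) → pure (Pos-* p p)
    (inj₂ p) → pure (Pos-resp (neg*neg x x) (Pos-* p p))

  Nonneg-square : ∀ x → Nonneg (x * x)
  Nonneg-square x p = (em (x ≈ 0#) >>= λ where
    (inj₁ e)   → ⊥-elim (¬Pos-0 (Pos-resp (trans (-‿cong (trans (*-congʳ e) (zeroˡ x))) -0#≈0#) p))
    (inj₂ x≉0) → Pos-square x≉0)
    λ q → ¬Pos-both q p

  *-≉0 : ∀ {x y} → ¬ x ≈ 0# → ¬ y ≈ 0# → ¬ x * y ≈ 0#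
  *-≉0 {x} {y} x≉0 y≉0 e = (Pos-square x≉0 >>= λ p → Pos-square y≉0 >>= λ q → pure (Pos-* p q))
    λ r → Pos⇒≉0 r (begin
      x * x * (y * y)   ≈⟨ solve 2 (λ x y → x :* x :* (y :* y) := (x :* y) :* (x :* y)) refl x y ⟩
      x * y * (x * y)   ≈⟨ *-congʳ e ⟩
      0# * (x * y)      ≈⟨ zeroˡ _ ⟩
      0#                ∎)
    where open import Relation.Binary.Reasoning.Setoid setoid

  -- The substitute for division by a nonzero number.
  *-cancel-0 : ∀ {x y} → ¬ x ≈ 0# → x * y ≈ 0# → y ≈ 0#
  *-cancel-0 x≉0 e = stable λ y≉0 → *-≉0 x≉0 y≉0 e

  square≈0 : ∀ {x} → x * x ≈ 0# → x ≈ 0#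
  square≈0 e = stable λ x≉0 → *-≉0 x≉0 x≉0 e

  Nonneg-sum : ∀ {n} {f : Fin n → K} → (∀ i → Nonneg (f i)) → Nonneg (sum f)
  Nonneg-sum {zero}  h = Nonneg-resp (sym sum-[]) Nonneg-0
  Nonneg-sum {suc n} h = Nonneg-resp (sym sum-∷) (Nonneg-+ (h zero) (Nonneg-sum (h ∘ suc)))

  Pos-sum : ∀ {n} {f : Fin n → K} → (∀ i → Nonneg (f i)) → ∀ i → Pos (f i) → ¬ ¬ Pos (sum f)
  Pos-sum h zero p = Pos-+-Nonneg p (Nonneg-sum (h ∘ suc)) >>= λ q → pure (Pos-resp (sym sum-∷) q)
  Pos-sum {f = f} h (suc i) p = Pos-sum (h ∘ suc) i p >>= λ q → Pos-+-Nonneg q (h zero) >>= λ r →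
    pure (Pos-resp (trans (+-comm _ (f zero)) (sym sum-∷)) r)

  sum≈0 : ∀ {n} {f : Fin n → K} → (∀ i → Nonneg (f i)) → sum f ≈ 0# → ∀ i → f i ≈ 0#
  sum≈0 h e i = stable λ fi≉0 → (Nonneg-cases (h i) >>= λ where
    (inj₂ e′) → ⊥-elim (fi≉0 e′)
    (inj₁ p)  → Pos-sum h i p) λ p → Pos⇒≉0 p e

  product-≉0 : ∀ {n} {f : Fin n → K} → (∀ i → ¬ f i ≈ 0#) → ¬ product f ≈ 0#
  product-≉0 {zero}  h e = Pos⇒≉0 Pos-1 (trans (sym product-[]) e)
  product-≉0 {suc n} h e = *-≉0 (h zero) (product-≉0 (h ∘ suc)) (trans (sym product-∷) e)

  Pos-suc : ∀ k → Pos (suc k × 1#)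
  Pos-suc zero    = Pos-resp (sym (+-identityʳ 1#)) Pos-1
  Pos-suc (suc k) = Pos-+ Pos-1 (Pos-suc k)

  Nonneg-× : ∀ k → Nonneg (k × 1#)
  Nonneg-× zero    = Nonneg-0
  Nonneg-× (suc k) = Pos⇒Nonneg (Pos-suc k)

-- Polynomial functions and cancellation of linear factors.

module Polynomials (R : CommutativeRing 0ℓ 0ℓ) (C : PositiveCone R) where
  open CommutativeRing R hiding (zero) renaming (Carrier to K)
  open Ordered R C
  open Sums R
  open Determinant R
  open IntegerSolver R using (solve; con; _:=_; _:+_; _:*_; :-_; _:-_)
  open import Algebra.Properties.Ring ring using (-1*x≈-x)
  open import Algebra.Properties.Semiring.Mult semiring using (_×_)
  open import Data.Fin.Base using (Fin; zero; suc)
  open import Data.Integer.Base using (+_)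
  open import Data.List.Base using (List; []; _∷_; length)
  open import Data.Nat.Base as ℕ using (ℕ; zero; suc)
  open import Data.Product.Base using (Σ; _,_)
  open import Function.Base using (_∘_)
  open import Relation.Binary.PropositionalEquality as ≡ using (_≡_)
  open import Relation.Binary.Reasoning.Setoid setoid

  eval : List K → K → K
  eval []       x = 0#
  eval (c ∷ cs) x = c + x * eval cs x

  -- A property of functions rather than a type of formal polynomials, because the hypothesis on the
  -- spectrum is an equation between values at every x.
  IsPolynomial : (K → K) → Set
  IsPolynomial f = Σ (List K) λ cs → ∀ x → f x ≈ eval cs x

  private
    add : List K → List K → List K
    add []       ds       = ds
    add (c ∷ cs) []       = c ∷ cs
    add (c ∷ cs) (d ∷ ds) = c + d ∷ add cs ds

    scale : K → List K → List K
    scale a []       = []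
    scale a (c ∷ cs) = a * c ∷ scale a cs

    mul : List K → List K → List K
    mul []       ds = []
    mul (c ∷ cs) ds = add (scale c ds) (0# ∷ mul cs ds)

    eval-add : ∀ cs ds x → eval (add cs ds) x ≈ eval cs x + eval ds x
    eval-add []       ds       x = sym (+-identityˡ _)
    eval-add (c ∷ cs) []       x = sym (+-identityʳ _)
    eval-add (c ∷ cs) (d ∷ ds) x = trans (+-congˡ (*-congˡ (eval-add cs ds x)))
      (solve 5 (λ c d x p q → c :+ d :+ x :* (p :+ q) := (c :+ x :* p) :+ (d :+ x :* q))
        refl c d x (eval cs x) (eval ds x))

    eval-scale : ∀ a cs x → eval (scale a cs) x ≈ a * eval cs x
    eval-scale a []       x = sym (zeroʳ a)
    eval-scale a (c ∷ cs) x = trans (+-congˡ (*-congˡ (eval-scale a cs x)))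
      (solve 4 (λ a c x p → a :* c :+ x :* (a :* p) := a :* (c :+ x :* p)) refl a c x (eval cs x))

    eval-mul : ∀ cs ds x → eval (mul cs ds) x ≈ eval cs x * eval ds x
    eval-mul []       ds x = sym (zeroˡ _)
    eval-mul (c ∷ cs) ds x = begin
      eval (add (scale c ds) (0# ∷ mul cs ds)) x
        ≈⟨ eval-add (scale c ds) (0# ∷ mul cs ds) x ⟩
      eval (scale c ds) x + (0# + x * eval (mul cs ds) x)
        ≈⟨ +-cong (eval-scale c ds x) (+-congˡ (*-congˡ (eval-mul cs ds x))) ⟩
      c * eval ds x + (0# + x * (eval cs x * eval ds x))
        ≈⟨ solve 4 (λ c x p q → c :* q :+ (con (+ 0) :+ x :* (p :* q)) := (c :+ x :* p) :* q)
             refl c x (eval cs x) (eval ds x) ⟩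
      (c + x * eval cs x) * eval ds x ∎

  polynomial-const : ∀ c → IsPolynomial (λ _ → c)
  polynomial-const c = c ∷ [] , λ x → sym (trans (+-congˡ (zeroʳ x)) (+-identityʳ c))

  polynomial-id : IsPolynomial (λ x → x)
  polynomial-id = 0# ∷ 1# ∷ [] , λ x →
    solve 1 (λ x → x := con (+ 0) :+ x :* (con (+ 1) :+ x :* con (+ 0))) refl x

  polynomial-+ : ∀ {f g} → IsPolynomial f → IsPolynomial g → IsPolynomial (λ x → f x + g x)
  polynomial-+ (cs , p) (ds , q) = add cs ds , λ x →
    trans (+-cong (p x) (q x)) (sym (eval-add cs ds x))

  polynomial-* : ∀ {f g} → IsPolynomial f → IsPolynomial g → IsPolynomial (λ x → f x * g x)
  polynomial-* (cs , p) (ds , q) = mul cs ds , λ x →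
    trans (*-cong (p x) (q x)) (sym (eval-mul cs ds x))

  polynomial-resp : ∀ {f g} → (∀ x → f x ≈ g x) → IsPolynomial f → IsPolynomial g
  polynomial-resp e (cs , p) = cs , λ x → trans (sym (e x)) (p x)

  polynomial-neg : ∀ {f} → IsPolynomial f → IsPolynomial (λ x → - f x)
  polynomial-neg p = polynomial-resp (λ x → -1*x≈-x _) (polynomial-* (polynomial-const (- 1#)) p)

  polynomial-sum : ∀ {n} {f : Fin n → K → K} → (∀ i → IsPolynomial (f i)) →
    IsPolynomial (λ x → sum λ i → f i x)
  polynomial-sum {zero}  h = polynomial-resp (λ _ → sym sum-[]) (polynomial-const 0#)
  polynomial-sum {suc n} h =
    polynomial-resp (λ _ → sym sum-∷) (polynomial-+ (h zero) (polynomial-sum (h ∘ suc)))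

  polynomial-product : ∀ {n} {f : Fin n → K → K} → (∀ i → IsPolynomial (f i)) →
    IsPolynomial (λ x → product λ i → f i x)
  polynomial-product {zero}  h = polynomial-resp (λ _ → sym product-[]) (polynomial-const 1#)
  polynomial-product {suc n} h =
    polynomial-resp (λ _ → sym product-∷) (polynomial-* (h zero) (polynomial-product (h ∘ suc)))

  polynomial-det : ∀ {n} {M : K → Matrix n} → (∀ i j → IsPolynomial (λ x → M x i j)) →
    IsPolynomial (λ x → det (M x))
  polynomial-det {zero}  h = polynomial-const 1#
  polynomial-det {suc n} h = polynomial-sum λ j →
    polynomial-* (polynomial-* (polynomial-const _) (h zero j))
      (polynomial-det λ i k → h (suc i) _)

  eval-cong : ∀ cs {x y} → x ≈ y → eval cs x ≈ eval cs y
  eval-cong []       e = refl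
  eval-cong (c ∷ cs) e = +-congˡ (*-cong e (eval-cong cs e))

  private
    -- Synthetic division by x - a.
    divide : K → List K → List K
    divide a []           = []
    divide a (c ∷ [])     = []
    divide a (c ∷ d ∷ cs) = eval (d ∷ cs) a ∷ divide a (d ∷ cs)

    length-divide : ∀ a c cs → length (divide a (c ∷ cs)) ≡ length cs
    length-divide a c []       = ≡.refl
    length-divide a c (d ∷ cs) = ≡.cong suc (length-divide a d cs)

    eval-divide : ∀ a cs x → eval cs x ≈ eval cs a + (x - a) * eval (divide a cs) x
    eval-divide a []           x =
      solve 2 (λ x a → con (+ 0) := con (+ 0) :+ (x :- a) :* con (+ 0)) refl x a
    eval-divide a (c ∷ [])     x = solve 3 (λ c x a →
      c :+ x :* con (+ 0) := c :+ a :* con (+ 0) :+ (x :- a) :* con (+ 0)) refl c x a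
    eval-divide a (c ∷ d ∷ cs) x = trans (+-congˡ (*-congˡ (eval-divide a (d ∷ cs) x)))
      (solve 5 (λ c x a p q → c :+ x :* (p :+ (x :- a) :* q) :=
                              c :+ a :* p :+ (x :- a) :* (p :+ x :* q))
        refl c x a (eval (d ∷ cs) a) (eval (divide a (d ∷ cs)) x))

    -- Induction on the number of coefficients: the root a + 1 is divided out, and the quotient
    -- still vanishes at a + 2, a + 3, ..., whose distances from a + 1 are positive and can be
    -- cancelled.
    eval-vanish : ∀ n cs → length cs ≡ n → ∀ a → (∀ m → eval cs (a + suc m × 1#) ≈ 0#) →
      ∀ x → eval cs x ≈ 0#
    eval-vanish n       []       l a h x = refl
    eval-vanish (suc n) (c ∷ cs) l a h x = begin
      eval (c ∷ cs) x       ≈⟨ factor x ⟩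
      (x - b) * q x         ≈⟨ *-congˡ (eval-vanish n (divide b (c ∷ cs))
                                 (≡.trans (length-divide b c cs) (≡.cong ℕ.pred l)) b q≈0 x) ⟩
      (x - b) * 0#          ≈⟨ zeroʳ _ ⟩
      0#                    ∎
      where
      b = a + 1 × 1#
      q : K → K
      q = eval (divide b (c ∷ cs))
      factor : ∀ x → eval (c ∷ cs) x ≈ (x - b) * q x
      factor x = trans (eval-divide b (c ∷ cs) x) (trans (+-congʳ (h 0)) (+-identityˡ _))
      q≈0 : ∀ m → q (b + suc m × 1#) ≈ 0#
      q≈0 m = *-cancel-0 (Pos⇒≉0 (Pos-suc m)) (begin
        suc m × 1# * q y      ≈⟨ *-congʳ (solve 2 (λ b k → k := b :+ k :- b) refl b (suc m × 1#)) ⟩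
        (y - b) * q y         ≈⟨ factor y ⟨
        eval (c ∷ cs) y       ≈⟨ eval-cong (c ∷ cs) (solve 3 (λ a i k →
                                   (a :+ (i :+ con (+ 0))) :+ (i :+ k) := a :+ (i :+ (i :+ k)))
                                   refl a 1# (m × 1#)) ⟩
        eval (c ∷ cs) (a + suc (suc m) × 1#)  ≈⟨ h (suc m) ⟩
        0#                    ∎)
        where y = b + suc m × 1#

  -- At x = a nothing can be cancelled pointwise, but the zeros of f at a + 1, a + 2, ... already
  -- force f to vanish everywhere.
  polynomial-cancel : ∀ {f} → IsPolynomial f → ∀ a → (∀ x → (x - a) * f x ≈ 0#) → ∀ x → f x ≈ 0#
  polynomial-cancel {f} (cs , p) a h x = trans (p x) (eval-vanish (length cs) cs ≡.refl a (λ m →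
    trans (sym (p _)) (*-cancel-0 (Pos⇒≉0 (Pos-suc m)) (trans
      (*-congʳ (solve 2 (λ a k → k := a :+ k :- a) refl a (suc m × 1#))) (h _)))) x)

-- Kernel vectors by elimination without division.

module Kernel (R : CommutativeRing 0ℓ 0ℓ) (C : PositiveCone R) where
  open CommutativeRing R hiding (zero) renaming (Carrier to K)
  open Classical
  open Ordered R C
  open Sums R
  open Determinant R
  open IntegerSolver R using (solve; con; _:=_; _:+_; _:*_; :-_; _:-_)
  open import Algebra.Definitions.RawSemiring (Semiring.rawSemiring semiring) using (_^_)
  open import Algebra.Properties.Ring ring using (-0#≈0#; -‿involutive)
  open import Data.Empty using (⊥-elim)
  open import Data.Fin.Base using (Fin; zero; suc; punchIn; toℕ)
  import Data.Fin.Properties as Fin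
  open import Data.Integer.Base using (+_)
  open import Data.Nat.Base as ℕ using (ℕ; zero; suc; _<_; s≤s)
  import Data.Nat.Properties as ℕ
  open import Data.Product.Base using (∃; ∃-syntax; _×_; _,_)
  open import Data.Vec.Functional using (insertAt)
  open import Data.Vec.Functional.Properties using (insertAt-lookup; insertAt-punchIn)
  open import Function.Base using (_∘_)
  open import Relation.Binary.PropositionalEquality as ≡ using (_≡_; _≢_)
  open import Relation.Binary.Reasoning.Setoid setoid
  open import Relation.Nullary.Decidable.Core using (yes; no)

  Nonzero : ∀ {n} → (Fin n → K) → Set
  Nonzero x = ∃ λ i → ¬ x i ≈ 0#

  HasKernel : ∀ {m n} → (Fin m → Fin n → K) → Set
  HasKernel A = ∃[ x ] (Nonzero x × (∀ i → sum (λ j → A i j * x j) ≈ 0#))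

  private
    -- Solves the equation with coefficients a for the unknown j. All other unknowns are scaled by
    -- the pivot `a j`, so that no quotient is formed.
    back-substitute : ∀ {n} → (Fin (suc n) → K) → Fin (suc n) → (Fin n → K) → Fin (suc n) → K
    back-substitute a j y = insertAt (λ l → a j * y l) j (- sum λ l → a (punchIn j l) * y l)

    back-substitute-sum : ∀ {n} (a b : Fin (suc n) → K) j y →
      sum (λ i → b i * back-substitute a j y i) ≈
      sum (λ l → (a j * b (punchIn j l) - a (punchIn j l) * b j) * y l)
    back-substitute-sum a b j y = begin
      sum (λ i → b i * x i)
        ≈⟨ sum-punchIn j ⟩
      b j * x j + sum (λ l → b (punchIn j l) * x (punchIn j l))
        ≈⟨ +-cong (*-congˡ (reflexive (insertAt-lookup _ j _)))
                  (sum-cong λ l → *-congˡ (reflexive (insertAt-punchIn _ j _ l))) ⟩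
      b j * - sum (λ l → a (punchIn j l) * y l) + sum (λ l → b (punchIn j l) * (a j * y l))
        ≈⟨ +-congʳ (trans (*-congˡ (sym sum-neg)) sum-*ˡ) ⟩
      sum (λ l → b j * - (a (punchIn j l) * y l)) + sum (λ l → b (punchIn j l) * (a j * y l))
        ≈⟨ sum-+ ⟨
      sum (λ l → b j * - (a (punchIn j l) * y l) + b (punchIn j l) * (a j * y l))
        ≈⟨ sum-cong (λ l → solve 5 (λ bj al y bl aj →
             bj :* (:- (al :* y)) :+ bl :* (aj :* y) := (aj :* bl :- al :* bj) :* y)
             refl (b j) (a (punchIn j l)) (y l) (b (punchIn j l)) (a j)) ⟩
      sum (λ l → (a j * b (punchIn j l) - a (punchIn j l) * b j) * y l) ∎
      where x = back-substitute a j y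

    -- The Schur complement of the pivot in row 0 and column j, multiplied by the pivot.
    eliminated : ∀ {m n} → (Fin (suc m) → Fin (suc n) → K) → Fin (suc n) → Fin m → Fin n → K
    eliminated A j r l =
      A zero j * A (suc r) (punchIn j l) - A zero (punchIn j l) * A (suc r) j

    extend-kernel : ∀ {m n} (A : Fin (suc m) → Fin (suc n) → K) j → ¬ A zero j ≈ 0# →
      HasKernel (eliminated A j) → HasKernel A
    extend-kernel A j p (y , (i , yi≉0) , Ay≈0) = back-substitute (A zero) j y ,
      (punchIn j i , λ e → *-≉0 p yi≉0 (trans (reflexive (≡.sym (insertAt-punchIn _ j _ i))) e)) , λ where
        zero → trans (back-substitute-sum (A zero) (A zero) j y) (sum-zero λ l →
          solve 3 (λ a b y → (a :* b :- b :* a) :* y := con (+ 0)) refl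
            (A zero j) (A zero (punchIn j l)) (y l))
        (suc r) → trans (back-substitute-sum (A zero) (A (suc r)) j y) (Ay≈0 r)

    skip-row : ∀ {m n} (A : Fin (suc m) → Fin n → K) → (∀ j → ¬ ¬ A zero j ≈ 0#) →
      HasKernel (A ∘ suc) → HasKernel A
    skip-row A h (x , x≉0 , Ax≈0) = x , x≉0 , λ where
      zero    → sum-zero λ j → trans (*-congʳ (stable (h j))) (zeroˡ _)
      (suc r) → Ax≈0 r

  wide⇒kernel : ∀ {m n} → m < n → (A : Fin m → Fin n → K) → ¬ ¬ HasKernel A
  wide⇒kernel {zero} {suc n} m<n A = pure ((λ _ → 1#) , (zero , Pos⇒≉0 Pos-1) , λ ())
  wide⇒kernel {suc m} {suc n} (s≤s m<n) A = find (λ j → ¬ A zero j ≈ 0#) >>= λ where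
    (inj₁ (j , p)) → wide⇒kernel m<n (eliminated A j) >>= λ k → pure (extend-kernel A j p k)
    (inj₂ h)       → wide⇒kernel (ℕ.m<n⇒m<1+n m<n) (A ∘ suc) >>= λ k → pure (skip-row A h k)

  sign≉0 : ∀ k → ¬ (- 1#) ^ k ≈ 0#
  sign≉0 zero    = Pos⇒≉0 Pos-1
  sign≉0 (suc k) = *-≉0 (λ e → Pos⇒≉0 Pos-1 (begin
    1#       ≈⟨ -‿involutive 1# ⟨
    - - 1#   ≈⟨ -‿cong e ⟩
    - 0#     ≈⟨ -0#≈0# ⟩
    0#       ∎)) (sign≉0 k)

  -- If the first row has a pivot, column operations clear the rest of that row, and expanding along
  -- it shows that the Schur complement is singular as well. If not, the first row is zero and the
  -- remaining rows are fewer than the unknowns.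
  singular⇒kernel : ∀ {n} (A : Matrix n) → det A ≈ 0# → ¬ ¬ HasKernel A
  singular⇒kernel {zero}  A e = ⊥-elim (Pos⇒≉0 Pos-1 e)
  singular⇒kernel {suc n} A e = find (λ j → ¬ A zero j ≈ 0#) >>= λ
    { (inj₂ h)       → wide⇒kernel (ℕ.n<1+n n) (A ∘ suc) >>= λ k → pure (skip-row A h k)
    ; (inj₁ (j , p)) → singular⇒kernel (eliminated A j) (reduced j p) >>= λ k →
        pure (extend-kernel A j p k)
    }
    where
    reduced : ∀ j → ¬ A zero j ≈ 0# → det (eliminated A j) ≈ 0#
    reduced j p = *-cancel-0 (*-≉0 (sign≉0 (toℕ j)) p) (begin
      (- 1#) ^ toℕ j * A zero j * det (eliminated A j)
        ≈⟨ *-cong (*-congˡ Bⱼ) (det-cong λ r l → Bₗ (suc r) _ (Fin.punchInᵢ≢i j l)) ⟨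
      (- 1#) ^ toℕ j * B zero j * det (minor B j)
        ≈⟨ sum-single j (λ l l≢j → trans (*-congʳ (trans (*-congˡ (trans (Bₗ zero l l≢j)
             (trans (+-congˡ (-‿cong (*-comm _ _))) (-‿inverseʳ _)))) (zeroʳ _))) (zeroˡ _)) ⟨
      det B
        ≈⟨ det-eliminate j α β {A} {B} αⱼ βⱼ (λ _ _ → refl) ⟩
      product α * det A
        ≈⟨ trans (*-congˡ e) (zeroʳ _) ⟩
      0# ∎)
      where
      α β : Fin (suc n) → K
      α l with l Fin.≟ j
      ... | yes _ = 1#
      ... | no  _ = A zero j
      β l with l Fin.≟ j
      ... | yes _ = 0#
      ... | no  _ = - A zero l
      αⱼ : α j ≈ 1#
      αⱼ with j Fin.≟ j
      ... | yes _  = refl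
      ... | no j≢j = ⊥-elim (j≢j ≡.refl)
      βⱼ : β j ≈ 0#
      βⱼ with j Fin.≟ j
      ... | yes _  = refl
      ... | no j≢j = ⊥-elim (j≢j ≡.refl)
      B : Matrix (suc n)
      B i l = α l * A i l + β l * A i j
      Bⱼ : B zero j ≈ A zero j
      Bⱼ = trans (+-cong (trans (*-congʳ αⱼ) (*-identityˡ _)) (trans (*-congʳ βⱼ) (zeroˡ _)))
             (+-identityʳ _)
      Bₗ : ∀ i l → l ≢ j → B i l ≈ A zero j * A i l - A zero l * A i j
      Bₗ i l l≢j with l Fin.≟ j
      ... | yes l≡j = ⊥-elim (l≢j l≡j)
      ... | no  _   = +-congˡ (sym (-‿distribˡ-* _ _))
        where open import Algebra.Properties.Ring ring using (-‿distribˡ-*)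

-- Inner products and orthogonal eigenvectors of a symmetric matrix.

module InnerProduct (R : CommutativeRing 0ℓ 0ℓ) where
  open CommutativeRing R hiding (zero) renaming (Carrier to K)
  open Sums R
  open Determinant R using (Matrix)
  open IntegerSolver R using (solve; _:=_; _:+_; _:*_)
  open import Data.Fin.Base using (Fin)
  open import Relation.Binary.Reasoning.Setoid setoid

  ⟪_,_⟫ : ∀ {n} → (Fin n → K) → (Fin n → K) → K
  ⟪ u , v ⟫ = sum λ i → u i * v i

  apply : ∀ {n} → Matrix n → (Fin n → K) → Fin n → K
  apply M u i = sum λ j → M i j * u j

  inner-cong : ∀ {n} {u u′ v v′ : Fin n → K} → (∀ i → u i ≈ u′ i) → (∀ i → v i ≈ v′ i) →
    ⟪ u , v ⟫ ≈ ⟪ u′ , v′ ⟫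
  inner-cong p q = sum-cong λ i → *-cong (p i) (q i)

  inner-comm : ∀ {n} (u v : Fin n → K) → ⟪ u , v ⟫ ≈ ⟪ v , u ⟫
  inner-comm u v = sum-cong λ i → *-comm (u i) (v i)

  inner-scale : ∀ {n} a (u v : Fin n → K) → ⟪ u , (λ i → a * v i) ⟫ ≈ a * ⟪ u , v ⟫
  inner-scale a u v = trans
    (sum-cong λ i → solve 3 (λ a x y → x :* (a :* y) := a :* (x :* y)) refl a (u i) (v i))
    (sym sum-*ˡ)

  inner-linear : ∀ {n} a b (u v w : Fin n → K) →
    ⟪ u , (λ i → a * v i + b * w i) ⟫ ≈ a * ⟪ u , v ⟫ + b * ⟪ u , w ⟫
  inner-linear a b u v w = trans
    (sum-cong λ i → solve 5 (λ a b x y z → x :* (a :* y :+ b :* z) := a :* (x :* y) :+ b :* (x :* z))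
      refl a b (u i) (v i) (w i))
    sum-linear

  inner-sum : ∀ {m n} (u : Fin n → K) (y : Fin m → K) (w : Fin m → Fin n → K) →
    ⟪ u , (λ i → sum λ l → y l * w l i) ⟫ ≈ sum (λ l → y l * ⟪ u , w l ⟫)
  inner-sum u y w = begin
    sum (λ i → u i * sum λ l → y l * w l i)     ≈⟨ sum-cong (λ i → sum-*ˡ) ⟩
    sum (λ i → sum λ l → u i * (y l * w l i))   ≈⟨ sum-comm ⟩
    sum (λ l → sum λ i → u i * (y l * w l i))   ≈⟨ sum-cong (λ l → inner-scale (y l) u (w l)) ⟩
    sum (λ l → y l * ⟪ u , w l ⟫)               ∎

  apply-linear : ∀ {n} (M : Matrix n) a b v w i →
    apply M (λ i → a * v i + b * w i) i ≈ a * apply M v i + b * apply M w i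
  apply-linear M a b v w i = inner-linear a b (M i) v w

  apply-sum : ∀ {m n} (M : Matrix n) (y : Fin m → K) (w : Fin m → Fin n → K) i →
    apply M (λ i → sum λ l → y l * w l i) i ≈ sum (λ l → y l * apply M (w l) i)
  apply-sum M y w i = inner-sum (M i) y w

  apply-symmetric : ∀ {n} {M : Matrix n} → (∀ i j → M i j ≈ M j i) → ∀ u v →
    ⟪ apply M u , v ⟫ ≈ ⟪ u , apply M v ⟫
  apply-symmetric {M = M} M-sym u v = begin
    sum (λ i → (sum λ j → M i j * u j) * v i)     ≈⟨ sum-cong (λ i → sum-*ʳ) ⟩
    sum (λ i → sum λ j → M i j * u j * v i)       ≈⟨ sum-comm ⟩
    sum (λ j → sum λ i → M i j * u j * v i)       ≈⟨ sum-cong (λ j → sum-cong λ i →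
      trans (*-congʳ (*-congʳ (M-sym i j))) (solve 3 (λ m a b → m :* a :* b := a :* (m :* b))
        refl (M j i) (u j) (v i))) ⟩
    sum (λ j → sum λ i → u j * (M j i * v i))     ≈⟨ sum-cong (λ j → sum-*ˡ) ⟨
    sum (λ j → u j * sum λ i → M j i * v i)       ∎

module Spectral (R : CommutativeRing 0ℓ 0ℓ) (C : PositiveCone R) where
  open CommutativeRing R hiding (zero) renaming (Carrier to K)
  open Classical
  open Ordered R C
  open Polynomials R C
  open Sums R
  open Determinant R
  open Kernel R C
  open InnerProduct R
  open IntegerSolver R using (solve; con; _:=_; _:+_; _:*_; :-_; _:-_)
  open import Algebra.Properties.Ring ring using (-0#≈0#; x∙y⁻¹≈ε⇒x≈y)
  open import Data.Empty using (⊥-elim)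
  open import Data.Fin.Base using (Fin; zero; suc; toℕ; fromℕ<)
  import Data.Fin.Properties as Fin
  open import Data.Integer.Base using (+_)
  open import Data.Nat.Base as ℕ using (ℕ; zero; suc; _<_)
  import Data.Nat.Properties as ℕ
  open import Data.Product.Base using (∃; _×_; _,_)
  open import Function.Base using (_∘_)
  open import Relation.Binary.PropositionalEquality as ≡ using (_≡_; _≢_; ≢-sym)
  open import Relation.Binary.Reasoning.Setoid setoid
  open import Relation.Nullary.Decidable.Core using (Dec; yes; no)

  select : {P : Set} → Dec P → K → K → K
  select (yes _) a b = a
  select (no  _) a b = b

  select-yes : {P : Set} (d : Dec P) {a b : K} → P → select d a b ≈ a
  select-yes (yes _) p = refl
  select-yes (no ¬p) p = ⊥-elim (¬p p)

  select-no : {P : Set} (d : Dec P) {a b : K} → ¬ P → select d a b ≈ b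
  select-no (yes p) ¬p = ⊥-elim (¬p p)
  select-no (no  _) ¬p = refl

  δ : ∀ {n} → Fin n → Fin n → K
  δ i j = select (i Fin.≟ j) 1# 0#

  sum-δ : ∀ {n} (f : Fin n → K) p → sum (λ l → δ l p * f l) ≈ f p
  sum-δ f p = trans (sum-single p λ l l≢p → trans (*-congʳ (select-no (l Fin.≟ p) l≢p)) (zeroˡ _))
    (trans (*-congʳ (select-yes (p Fin.≟ p) ≡.refl)) (*-identityˡ _))

  module _ {n : ℕ} (μ : Fin n → K) where
    -- Factors that have been split off are replaced by 1 instead of being removed, so that all
    -- products run over the whole of `Fin n`.
    factor : ℕ → K → Fin n → K
    factor k x l = select (toℕ l ℕ.<? k) 1# (x - μ l)

    remaining : ℕ → K → K
    remaining k x = product (factor k x)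

  polynomial-select : ∀ {P : Set} (d : Dec P) {f g} → IsPolynomial f → IsPolynomial g →
    IsPolynomial (λ x → select d (f x) (g x))
  polynomial-select (yes _) p q = p
  polynomial-select (no  _) p q = q

  polynomial-linear : ∀ a → IsPolynomial (λ x → x - a)
  polynomial-linear a = polynomial-+ polynomial-id (polynomial-const (- a))

  -- A linear factor has a zero and cannot be cancelled at every x, so the factors are cancelled one
  -- after the other as polynomials.
  product-cancel : ∀ {n} {P : Fin n → Set} (d : ∀ l → Dec (P l)) (μ : Fin n → K) {g} → IsPolynomial g →
    (∀ x → product (λ l → select (d l) 1# (x - μ l)) * g x ≈ 0#) → ∀ x → g x ≈ 0#
  product-cancel {zero} d μ g h x =
    trans (sym (trans (*-congʳ product-[]) (*-identityˡ _))) (h x)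
  product-cancel {suc n} d μ {g} pg h = product-cancel (d ∘ suc) (μ ∘ suc) pg rest
    where
    f : K → K
    f x = product (λ l → select (d (suc l)) 1# (x - μ (suc l))) * g x
    h′ : ∀ x → select (d zero) 1# (x - μ zero) * f x ≈ 0#
    h′ x = trans (sym (trans (*-congʳ product-∷) (*-assoc _ _ _))) (h x)
    pf : IsPolynomial f
    pf = polynomial-* (polynomial-product λ l →
      polynomial-select (d (suc l)) (polynomial-const 1#) (polynomial-linear _)) pg
    rest : ∀ x → f x ≈ 0#
    rest with d zero | h′
    ... | yes _ | e = λ x → trans (sym (*-identityˡ _)) (e x)
    ... | no  _ | e = polynomial-cancel pf (μ zero) e

  module _ {n : ℕ} (M : Matrix n) (M-sym : ∀ i j → M i j ≈ M j i) (μ : Fin n → K)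
           (charPoly : ∀ x → det (λ i j → x * δ i j - M i j) ≈ product (λ l → x - μ l)) where

    -- The matrix (xI - M) W, where W has the columns `w l`, after the first k columns (x - μ l) (w
    -- l) have been divided by x - μ l.
    column : ℕ → (Fin n → Fin n → K) → K → Matrix n
    column k w x i l = select (toℕ l ℕ.<? k) (w l i) (x * w l i - apply M (w l) i)

    -- The first k of the vectors w are orthogonal eigenvectors for μ₀, …, μₖ₋₁, the others are
    -- orthogonal to these.  The determinant ensures independence and keeps track of multiplicities.
    record Flag (k : ℕ) : Set where
      field
        w      : Fin n → Fin n → K
        κ      : K
        κ≉0    : ¬ κ ≈ 0#
        eigen  : ∀ l → toℕ l < k → ∀ i → apply M (w l) i ≈ μ l * w l i
        orth   : ∀ l l′ → toℕ l < k → l ≢ l′ → ⟪ w l , w l′ ⟫ ≈ 0#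
        norm≉0 : ∀ l → toℕ l < k → ¬ ⟪ w l , w l ⟫ ≈ 0#
        det-κ  : ∀ x → det (column k w x) ≈ κ * remaining μ k x

    flag₀ : Flag 0
    flag₀ = record
      { w = λ l i → δ i l
      ; κ = 1#
      ; κ≉0 = Pos⇒≉0 Pos-1
      ; eigen = λ _ ()
      ; orth = λ _ _ ()
      ; norm≉0 = λ _ ()
      ; det-κ = λ x → begin
          det (column 0 (λ l i → δ i l) x)
            ≈⟨ det-cong (λ i l → (+-congˡ (-‿cong
                 (trans (sum-cong λ j → *-comm _ _) (sum-δ (M i) l))))) ⟩
          det (λ i j → x * δ i j - M i j)
            ≈⟨ charPoly x ⟩
          product (λ l → x - μ l)
            ≈⟨ product-cong (λ l → refl) ⟨
          remaining μ 0 x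
            ≈⟨ *-identityˡ _ ⟨
          1# * remaining μ 0 x ∎
      }

    module Step (q : Fin n) where
      k = toℕ q

      -- The coefficients of the next eigenvector in terms of `w`. A nonzero coefficient at q allows
      -- it to take the place of `w q` without losing independence.
      record NextVector (F : Flag k) : Set where
        open Flag F
        field
          y      : Fin n → K
          y<k    : ∀ l → toℕ l < k → y l ≈ 0#
          y-q    : ¬ y q ≈ 0#
          y-ker  : ∀ i → sum (λ l → column k w (μ q) i l * y l) ≈ 0#

      -- Pair the relation between the columns with `w l`. All other columns are orthogonal to it:
      -- the earlier ones by assumption, and those of the form (μ q - M) (w l′) because M is
      -- symmetric and `w l` is an eigenvector.
      kernel⇒next : (F : Flag k) → (let open Flag F) → ∀ y →
        (∀ i → sum (λ l → column k w (μ q) i l * y l) ≈ 0#) → ∀ l → toℕ l < k → y l ≈ 0#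
      kernel⇒next F y Cy≈0 l l<k = *-cancel-0 (norm≉0 l l<k) (begin
        ⟪ w l , w l ⟫ * y l
          ≈⟨ *-comm _ _ ⟩
        y l * ⟪ w l , w l ⟫
          ≈⟨ *-congˡ (inner-cong (λ _ → refl) λ i → select-yes (toℕ l ℕ.<? k) l<k) ⟨
        y l * ⟪ w l , (λ i → column k w (μ q) i l) ⟫
          ≈⟨ sum-single l (λ l′ l′≢l → trans (*-congˡ (other l′ l′≢l)) (zeroʳ _)) ⟨
        sum (λ l′ → y l′ * ⟪ w l , (λ i → column k w (μ q) i l′) ⟫)
          ≈⟨ inner-sum (w l) y (λ l′ i → column k w (μ q) i l′) ⟨
        ⟪ w l , (λ i → sum λ l′ → y l′ * column k w (μ q) i l′) ⟫
          ≈⟨ sum-zero (λ i → trans (*-congˡ (trans (sum-cong λ l′ → *-comm _ _) (Cy≈0 i))) (zeroʳ _)) ⟩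
        0# ∎)
        where
        open Flag F
        other : ∀ l′ → l′ ≢ l → ⟪ w l , (λ i → column k w (μ q) i l′) ⟫ ≈ 0#
        other l′ l′≢l with toℕ l′ ℕ.<? k
        ... | yes _ = orth l l′ l<k (≢-sym l′≢l)
        ... | no  _ = begin
          ⟪ w l , (λ i → μ q * w l′ i - apply M (w l′) i) ⟫
            ≈⟨ sum-cong (λ i → solve 4 (λ x m y z → x :* (m :* y :- z) := m :* (x :* y) :+ :- con (+ 1) :* (x :* z))
                 refl (w l i) (μ q) (w l′ i) (apply M (w l′) i)) ⟩
          sum (λ i → μ q * (w l i * w l′ i) + - 1# * (w l i * apply M (w l′) i))
            ≈⟨ sum-linear ⟩
          μ q * ⟪ w l , w l′ ⟫ + - 1# * ⟪ w l , apply M (w l′) ⟫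
            ≈⟨ +-cong (*-congˡ (orth l l′ l<k (≢-sym l′≢l))) (*-congˡ (begin
                 ⟪ w l , apply M (w l′) ⟫    ≈⟨ apply-symmetric M-sym (w l) (w l′) ⟨
                 ⟪ apply M (w l) , w l′ ⟫    ≈⟨ inner-cong (eigen l l<k) (λ _ → refl) ⟩
                 ⟪ (λ i → μ l * w l i) , w l′ ⟫   ≈⟨ inner-comm _ _ ⟩
                 ⟪ w l′ , (λ i → μ l * w l i) ⟫   ≈⟨ inner-scale (μ l) (w l′) (w l) ⟩
                 μ l * ⟪ w l′ , w l ⟫        ≈⟨ *-congˡ (trans (inner-comm _ _) (orth l l′ l<k (≢-sym l′≢l))) ⟩
                 μ l * 0#                    ∎)) ⟩
          μ q * 0# + - 1# * (μ l * 0#)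
            ≈⟨ solve 2 (λ a b → a :* con (+ 0) :+ :- con (+ 1) :* (b :* con (+ 0)) := con (+ 0)) refl (μ q) (μ l) ⟩
          0# ∎

      -- If y_q vanishes, subtracting w_q from w_p makes the coefficient of w_q equal to y_p.
      module Pivot (F : Flag k) (p : Fin n) (p≢q : p ≢ q) (k≤p : ¬ toℕ p < k) where
        open Flag F

        w′ : Fin n → Fin n → K
        w′ l i = 1# * w l i + - δ l p * w q i

        δ≈0 : ∀ {l} → toℕ l < k → δ l p ≈ 0#
        δ≈0 {l} l<k = select-no (l Fin.≟ p) λ { ≡.refl → k≤p l<k }

        w′-off : ∀ {l} → l ≢ p → ∀ i → w′ l i ≈ w l i
        w′-off {l} l≢p i = trans (+-cong (*-identityˡ _)
          (trans (*-congʳ (trans (-‿cong (select-no (l Fin.≟ p) l≢p)) -0#≈0#)) (zeroˡ _))) (+-identityʳ _)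

        w′-< : ∀ {l} → toℕ l < k → ∀ i → w′ l i ≈ w l i
        w′-< l<k = w′-off λ { ≡.refl → k≤p l<k }

        column-w′ : ∀ x i l → column k w′ x i l ≈ 1# * column k w x i l + - δ l p * column k w x i q
        column-w′ x i l with toℕ l ℕ.<? k
        ... | yes l<k = trans (w′-< l<k i) (sym (trans (+-cong (*-identityˡ _)
          (trans (*-congʳ (trans (-‿cong (δ≈0 l<k)) -0#≈0#)) (zeroˡ _))) (+-identityʳ _)))
        ... | no  _   = begin
          x * w′ l i - apply M (w′ l) i
            ≈⟨ +-congˡ (-‿cong (apply-linear M 1# (- δ l p) (w l) (w q) i)) ⟩
          x * (1# * w l i + - δ l p * w q i) - (1# * apply M (w l) i + - δ l p * apply M (w q) i)
            ≈⟨ solve 6 (λ x a b c d e → x :* (con (+ 1) :* a :+ :- e :* b) :- (con (+ 1) :* c :+ :- e :* d) :=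
                 con (+ 1) :* (x :* a :- c) :+ :- e :* (x :* b :- d)) refl
                 x (w l i) (w q i) (apply M (w l) i) (apply M (w q) i) (δ l p) ⟩
          1# * (x * w l i - apply M (w l) i) + - δ l p * (x * w q i - apply M (w q) i)
            ≈⟨ +-congˡ (*-congˡ (select-no (k ℕ.<? k) (ℕ.<-irrefl ≡.refl))) ⟨
          1# * (x * w l i - apply M (w l) i) + - δ l p * column k w x i q ∎

        flag′ : Flag k
        flag′ = record
          { w = w′ ; κ = κ ; κ≉0 = κ≉0
          ; eigen = λ l l<k i → begin
              apply M (w′ l) i   ≈⟨ sum-cong (λ j → *-congˡ (w′-< l<k j)) ⟩
              apply M (w l) i    ≈⟨ eigen l l<k i ⟩
              μ l * w l i        ≈⟨ *-congˡ (w′-< l<k i) ⟨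
              μ l * w′ l i       ∎
          ; orth = λ l l′ l<k l≢l′ → begin
              ⟪ w′ l , w′ l′ ⟫
                ≈⟨ inner-cong (w′-< l<k) (λ _ → refl) ⟩
              ⟪ w l , w′ l′ ⟫
                ≈⟨ inner-linear 1# (- δ l′ p) (w l) (w l′) (w q) ⟩
              1# * ⟪ w l , w l′ ⟫ + - δ l′ p * ⟪ w l , w q ⟫
                ≈⟨ +-cong (*-congˡ (orth l l′ l<k l≢l′)) (*-congˡ (orth l q l<k λ { ≡.refl → ℕ.<-irrefl ≡.refl l<k })) ⟩
              1# * 0# + - δ l′ p * 0#
                ≈⟨ trans (+-cong (zeroʳ _) (zeroʳ _)) (+-identityˡ _) ⟩
              0# ∎
          ; norm≉0 = λ l l<k e → norm≉0 l l<k (trans (sym (inner-cong (w′-< l<k) (w′-< l<k))) e)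
          ; det-κ = λ x → begin
              det (column k w′ x)   ≈⟨ det-shear (≢-sym p≢q) 1# (- 1#)
                (λ i l l≢p → trans (column-w′ x i l) (trans (+-cong (*-identityˡ _)
                  (trans (*-congʳ (trans (-‿cong (select-no (l Fin.≟ p) l≢p)) -0#≈0#)) (zeroˡ _))) (+-identityʳ _)))
                (λ i → trans (column-w′ x i p) (+-congˡ (*-congʳ (-‿cong (select-yes (p Fin.≟ p) ≡.refl))))) ⟩
              1# * det (column k w x)   ≈⟨ *-identityˡ _ ⟩
              det (column k w x)        ≈⟨ det-κ x ⟩
              κ * remaining μ k x       ∎
          }

        -- Since w p = w′ p + w q, the same vector is expressed in the new family by adding y p to
        -- the coefficient at q.
        y′-ker : ∀ (y : Fin n → K) → (∀ i → sum (λ l → column k w (μ q) i l * y l) ≈ 0#) →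
          ∀ i → sum (λ l → column k w′ (μ q) i l * (y l + δ l q * y p)) ≈ 0#
        y′-ker y h i = begin
          sum (λ l → column k w′ (μ q) i l * (y l + δ l q * y p))
            ≈⟨ sum-cong (λ l → trans (*-congʳ (column-w′ (μ q) i l))
                 (solve 6 (λ a b c d e f → (con (+ 1) :* a :+ :- e :* b) :* (c :+ f :* d) :=
                   a :* c :+ ((f :* (a :* d) :+ :- con (+ 1) :* (e :* (b :* c))) :+ e :* (:- b :* (f :* d))))
                   refl (c l) (c q) (y l) (y p) (δ l p) (δ l q))) ⟩
          sum (λ l → c l * y l + ((δ l q * (c l * y p) + - 1# * (δ l p * (c q * y l))) + δ l p * (- c q * (δ l q * y p))))
            ≈⟨ trans sum-+ (+-cong (h i) (trans sum-+ (+-congʳ (trans sum-+ (+-congˡ (sym sum-*ˡ)))))) ⟩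
          0# + ((sum (λ l → δ l q * (c l * y p)) + - 1# * sum (λ l → δ l p * (c q * y l))) +
            sum (λ l → δ l p * (- c q * (δ l q * y p))))
            ≈⟨ +-congˡ (+-cong (+-cong (sum-δ (λ l → c l * y p) q) (*-congˡ (sum-δ (λ l → c q * y l) p)))
                 (trans (sum-δ (λ l → - c q * (δ l q * y p)) p) (*-congˡ (*-congʳ (select-no (p Fin.≟ q) p≢q))))) ⟩
          0# + ((c q * y p + - 1# * (c q * y p)) + - c q * (0# * y p))
            ≈⟨ solve 2 (λ a b → con (+ 0) :+ ((a :* b :+ :- con (+ 1) :* (a :* b)) :+ :- a :* (con (+ 0) :* b)) := con (+ 0))
                 refl (c q) (y p) ⟩
          0# ∎
          where
          c : Fin n → K
          c l = column k w (μ q) i l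

      -- At x = μ q the factor with index q vanishes, so the matrix is singular. If its kernel
      -- vector is zero at q, any nonzero coordinate p serves as the pivot; by `kernel⇒next` it does
      -- not lie below k.
      next-vector : Flag k → ¬ ¬ ∃ NextVector
      next-vector F = singular⇒kernel (column k w (μ q)) singular >>= λ { (y , (p , yp≉0) , ker) →
        em (y q ≈ 0#) >>= λ
          { (inj₂ yq≉0) → pure (F , record { y = y ; y<k = kernel⇒next F y ker ; y-q = yq≉0 ; y-ker = ker })
          ; (inj₁ yq≈0) →
            let p≢q = λ { ≡.refl → yp≉0 yq≈0 }
                open Pivot F p p≢q (λ p<k → yp≉0 (kernel⇒next F y ker p p<k))
            in pure (flag′ , record
              { y = λ l → y l + δ l q * y p
              ; y<k = kernel⇒next flag′ _ (y′-ker y ker)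
              ; y-q = λ e → yp≉0 (trans (sym (trans (+-cong yq≈0 (trans (*-congʳ (select-yes (q Fin.≟ q) ≡.refl))
                  (*-identityˡ _))) (+-identityˡ _))) e)
              ; y-ker = y′-ker y ker
              })
          } }
        where
        open Flag F
        singular : det (column k w (μ q)) ≈ 0#
        singular = trans (det-κ (μ q)) (trans (*-congˡ (product-zero q
          (trans (select-no (k ℕ.<? k) (ℕ.<-irrefl ≡.refl)) (-‿inverseʳ _)))) (zeroʳ _))

      module Extend (F : Flag k) (N : NextVector F) where
        open Flag F
        open NextVector N

        z : Fin n → K
        z i = sum λ l → y l * w l i

        ζ : K
        ζ = ⟪ z , z ⟫

        -- The first k columns lack the factor xI - M, but the coefficients y vanish there.
        Mz-x : ∀ x i → sum (λ l → column k w x i l * y l) ≈ x * z i - apply M z i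
        Mz-x x i = begin
          sum (λ l → column k w x i l * y l)
            ≈⟨ sum-cong term ⟩
          sum (λ l → x * (y l * w l i) + - 1# * (y l * apply M (w l) i))
            ≈⟨ sum-linear ⟩
          x * z i + - 1# * sum (λ l → y l * apply M (w l) i)
            ≈⟨ +-congˡ (trans (-1*x≈-x _) (-‿cong (sym (apply-sum M y w i)))) ⟩
          x * z i - apply M z i ∎
          where
          open import Algebra.Properties.Ring ring using (-1*x≈-x)
          term : ∀ l → column k w x i l * y l ≈ x * (y l * w l i) + - 1# * (y l * apply M (w l) i)
          term l with toℕ l ℕ.<? k
          ... | yes l<k = trans (*-congˡ (y<k l l<k)) (trans (zeroʳ _) (sym (trans
            (+-cong (*-congˡ (trans (*-congʳ (y<k l l<k)) (zeroˡ _)))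
                    (*-congˡ (trans (*-congʳ (y<k l l<k)) (zeroˡ _))))
            (trans (+-cong (zeroʳ _) (zeroʳ _)) (+-identityˡ _)))))
          ... | no _ = solve 4 (λ x a b y → (x :* a :- b) :* y := x :* (y :* a) :+ :- con (+ 1) :* (y :* b))
            refl x (w l i) (apply M (w l) i) (y l)

        z-eigen : ∀ i → apply M z i ≈ μ q * z i
        z-eigen i = sym (x∙y⁻¹≈ε⇒x≈y _ _ (trans (sym (Mz-x (μ q) i)) (y-ker i)))

        Mz : ∀ x i → sum (λ l → column k w x i l * y l) ≈ (x - μ q) * z i
        Mz x i = trans (Mz-x x i) (trans (+-congˡ (-‿cong (z-eigen i)))
          (solve 3 (λ x m z → x :* z :- m :* z := (x :- m) :* z) refl x (μ q) (z i)))

        ⟨w,z⟩≈0 : ∀ l → toℕ l < k → ⟪ w l , z ⟫ ≈ 0#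
        ⟨w,z⟩≈0 l l<k = trans (inner-sum (w l) y w) (sum-zero term)
          where
          term : ∀ l′ → y l′ * ⟪ w l , w l′ ⟫ ≈ 0#
          term l′ with l Fin.≟ l′
          ... | yes ≡.refl = trans (*-congʳ (y<k l l<k)) (zeroˡ _)
          ... | no l≢l′    = trans (*-congˡ (orth l l′ l<k l≢l′)) (zeroʳ _)

        B : K → Matrix n
        B x = setColumn (column k w x) q z

        remaining-step : ∀ x → remaining μ k x ≈ (x - μ q) * remaining μ (suc k) x
        remaining-step x = product-scale q off
          (trans (select-no (k ℕ.<? k) (ℕ.<-irrefl ≡.refl)) (sym (trans
            (*-congˡ (select-yes (k ℕ.<? suc k) (ℕ.n<1+n k))) (*-identityʳ _))))
          where
          off : ∀ l → l ≢ q → factor μ k x l ≈ factor μ (suc k) x l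
          off l l≢q with toℕ l ℕ.<? k
          ... | yes l<k = sym (select-yes (toℕ l ℕ.<? suc k) (ℕ.m<n⇒m<1+n l<k))
          ... | no  l≮k = sym (select-no (toℕ l ℕ.<? suc k) λ l<1+k →
            l≮k (ℕ.≤∧≢⇒< (ℕ.s≤s⁻¹ l<1+k) (l≢q ∘ Fin.toℕ-injective)))

        -- Multiplying column q of `B x` by x - μ q turns it into the combination of the columns
        -- with coefficients y, which multiplies the old determinant by y q. So both sides agree
        -- after multiplication by x - μ q, and this factor is cancelled as a polynomial to include
        -- x = μ q.
        det-B : ∀ x → det (B x) ≈ y q * κ * remaining μ (suc k) x
        det-B x = x∙y⁻¹≈ε⇒x≈y _ _ (polynomial-cancel g-poly (μ q) vanish x)
          where
          g : K → K
          g x = det (B x) - y q * κ * remaining μ (suc k) x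
          B-poly : ∀ i j → IsPolynomial (λ x → B x i j)
          B-poly i j with j Fin.≟ q
          ... | yes _ = polynomial-const _
          ... | no  _ = polynomial-select (toℕ j ℕ.<? k) (polynomial-const _)
            (polynomial-+ (polynomial-* polynomial-id (polynomial-const _)) (polynomial-const _))
          g-poly : IsPolynomial g
          g-poly = polynomial-+ (polynomial-det B-poly) (polynomial-neg (polynomial-*
            (polynomial-const _) (polynomial-product λ l →
              polynomial-select (toℕ l ℕ.<? suc k) (polynomial-const 1#) (polynomial-linear _))))
          vanish : ∀ x → (x - μ q) * g x ≈ 0#
          vanish x = begin
            (x - μ q) * (det (B x) - y q * κ * remaining μ (suc k) x)
              ≈⟨ solve 5 (λ a d y c r → a :* (d :- y :* c :* r) := a :* d :- y :* (c :* (a :* r)))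
                   refl (x - μ q) (det (B x)) (y q) κ (remaining μ (suc k) x) ⟩
            (x - μ q) * det (B x) - y q * (κ * ((x - μ q) * remaining μ (suc k) x))
              ≈⟨ +-cong scaled (-‿cong (*-congˡ (*-congˡ (sym (remaining-step x))))) ⟩
            y q * det (column k w x) - y q * (κ * remaining μ k x)
              ≈⟨ +-congʳ (*-congˡ (det-κ x)) ⟩
            y q * (κ * remaining μ k x) - y q * (κ * remaining μ k x)
              ≈⟨ -‿inverseʳ _ ⟩
            0# ∎
            where
            scaled : (x - μ q) * det (B x) ≈ y q * det (column k w x)
            scaled = begin
              (x - μ q) * det (B x)
                ≈⟨ det-eliminate-scale ⟨
              det (setColumn (column k w x) q (λ i → (x - μ q) * z i))
                ≈⟨ det-column-combination q y
                     (λ i j j≢q → reflexive (setColumn-off (column k w x) _ i j≢q))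
                     (λ i → trans (reflexive (setColumn-at (column k w x) q _ i))
                        (trans (sym (Mz x i)) (sum-cong λ l → *-comm _ _))) ⟩
              y q * det (column k w x) ∎
              where
              det-eliminate-scale : det (setColumn (column k w x) q (λ i → (x - μ q) * z i)) ≈ (x - μ q) * det (B x)
              det-eliminate-scale = trans
                (det-linear q (x - μ q) 0# {C = B x}
                  (λ i j j≢q → reflexive (≡.trans (setColumn-off (column k w x) _ i j≢q)
                    (≡.sym (setColumn-off (column k w x) _ i j≢q))))
                  (λ i j j≢q → reflexive (≡.trans (setColumn-off (column k w x) _ i j≢q)
                    (≡.sym (setColumn-off (column k w x) _ i j≢q))))
                  (λ i → trans (reflexive (setColumn-at (column k w x) q _ i))
                    (trans (*-congˡ (reflexive (≡.sym (setColumn-at (column k w x) q z i))))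
                      (sym (trans (+-congˡ (zeroˡ _)) (+-identityʳ _))))))
                (trans (+-congˡ (zeroˡ _)) (+-identityʳ _))

        -- If z were zero, `det (B x)` would vanish for all x, although it is a nonzero constant
        -- times a product of linear factors.
        ζ≉0 : ¬ ζ ≈ 0#
        ζ≉0 e = *-≉0 y-q κ≉0 (product-cancel (λ l → toℕ l ℕ.<? suc k) μ (polynomial-const (y q * κ))
          (λ x → trans (*-comm _ _) (trans (sym (det-B x)) (det-B≈0 x))) 0#)
          where
          z≈0 : ∀ i → z i ≈ 0#
          z≈0 i = square≈0 (sum≈0 (λ i → Nonneg-square (z i)) e i)
          det-B≈0 : ∀ x → det (B x) ≈ 0#
          det-B≈0 x = trans (det-column-combination q (λ _ → 0#) {A = B x} (λ _ _ _ → refl) λ i →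
            trans (reflexive (setColumn-at (column k w x) q z i))
              (trans (z≈0 i) (sym (sum-zero λ l → zeroˡ _)))) (zeroˡ _)

        α : Fin n → K
        α l = select (l Fin.≟ q) 1# ζ

        β : Fin n → K
        β l = select (l Fin.≟ q) 0# (- ⟪ w l , z ⟫)

        base : Fin n → Fin n → K
        base l i = select (l Fin.≟ q) (z i) (w l i)

        -- A Gram-Schmidt step multiplied by ζ = ⟨z, z⟩: `w l` becomes ζ (w l) - ⟨w l, z⟩ z, while
        -- `w q` is replaced by z.
        w⁺ : Fin n → Fin n → K
        w⁺ l i = α l * base l i + β l * z i

        ≡q-or-≢ : ∀ l → l ≡ q ⊎ l ≢ q
        ≡q-or-≢ l with l Fin.≟ q
        ... | yes l≡q = inj₁ l≡q
        ... | no l≢q  = inj₂ l≢q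

        cases : ∀ l → toℕ l < suc k → l ≡ q ⊎ (l ≢ q × toℕ l < k)
        cases l l<1+k with l Fin.≟ q
        ... | yes l≡q = inj₁ l≡q
        ... | no l≢q  = inj₂ (l≢q , ℕ.≤∧≢⇒< (ℕ.s≤s⁻¹ l<1+k) (l≢q ∘ Fin.toℕ-injective))

        w⁺-q : ∀ i → w⁺ q i ≈ z i
        w⁺-q i = trans (+-cong (*-cong (select-yes (q Fin.≟ q) ≡.refl) (select-yes (q Fin.≟ q) ≡.refl))
          (*-congʳ (select-yes (q Fin.≟ q) ≡.refl))) (trans (+-cong (*-identityˡ _) (zeroˡ _)) (+-identityʳ _))

        w⁺-≢ : ∀ {l} → l ≢ q → ∀ i → w⁺ l i ≈ ζ * w l i + - ⟪ w l , z ⟫ * z i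
        w⁺-≢ {l} l≢q i = +-cong (*-cong (select-no (l Fin.≟ q) l≢q) (select-no (l Fin.≟ q) l≢q))
          (*-congʳ (select-no (l Fin.≟ q) l≢q))

        w⁺-< : ∀ {l} → l ≢ q → toℕ l < k → ∀ i → w⁺ l i ≈ ζ * w l i
        w⁺-< {l} l≢q l<k i = trans (w⁺-≢ l≢q i) (trans
          (+-congˡ (trans (*-congʳ (trans (-‿cong (⟨w,z⟩≈0 l l<k)) -0#≈0#)) (zeroˡ _))) (+-identityʳ _))

        ⟨z,w⁺⟩≈0 : ∀ l → l ≢ q → ⟪ z , w⁺ l ⟫ ≈ 0#
        ⟨z,w⁺⟩≈0 l l≢q = begin
          ⟪ z , w⁺ l ⟫                                             ≈⟨ inner-cong (λ _ → refl) (w⁺-≢ l≢q) ⟩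
          ⟪ z , (λ i → ζ * w l i + - ⟪ w l , z ⟫ * z i) ⟫          ≈⟨ inner-linear ζ _ z (w l) z ⟩
          ζ * ⟪ z , w l ⟫ + - ⟪ w l , z ⟫ * ζ                      ≈⟨ +-congʳ (*-congˡ (inner-comm z (w l))) ⟩
          ζ * ⟪ w l , z ⟫ + - ⟪ w l , z ⟫ * ζ
            ≈⟨ solve 2 (λ a b → a :* b :+ :- b :* a := con (+ 0)) refl ζ ⟪ w l , z ⟫ ⟩
          0#                                                       ∎

        orth⁺ : ∀ l l′ → toℕ l < suc k → l ≢ l′ → ⟪ w⁺ l , w⁺ l′ ⟫ ≈ 0#
        orth⁺ l l′ l<1+k l≢l′ with cases l l<1+k
        ... | inj₁ ≡.refl = trans (inner-cong w⁺-q (λ _ → refl)) (⟨z,w⁺⟩≈0 l′ (≢-sym l≢l′))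
        ... | inj₂ (l≢q , l<k) with ≡q-or-≢ l′
        ...   | inj₁ ≡.refl = trans (inner-comm _ _) (trans (inner-cong w⁺-q (λ _ → refl)) (⟨z,w⁺⟩≈0 l l≢q))
        ...   | inj₂ l′≢q = begin
          ⟪ w⁺ l , w⁺ l′ ⟫
            ≈⟨ inner-cong (w⁺-< l≢q l<k) (w⁺-≢ l′≢q) ⟩
          ⟪ (λ i → ζ * w l i) , (λ i → ζ * w l′ i + - ⟪ w l′ , z ⟫ * z i) ⟫
            ≈⟨ inner-linear ζ _ (λ i → ζ * w l i) (w l′) z ⟩
          ζ * ⟪ (λ i → ζ * w l i) , w l′ ⟫ + - ⟪ w l′ , z ⟫ * ⟪ (λ i → ζ * w l i) , z ⟫
            ≈⟨ +-cong (*-congˡ (zeroed (orth l l′ l<k l≢l′))) (*-congˡ (zeroed (⟨w,z⟩≈0 l l<k))) ⟩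
          ζ * 0# + - ⟪ w l′ , z ⟫ * 0#
            ≈⟨ trans (+-cong (zeroʳ _) (zeroʳ _)) (+-identityˡ _) ⟩
          0# ∎
          where
          zeroed : ∀ {v} → ⟪ w l , v ⟫ ≈ 0# → ⟪ (λ i → ζ * w l i) , v ⟫ ≈ 0#
          zeroed {v} e = trans (inner-comm _ v) (trans (inner-scale ζ v (w l))
            (trans (*-congˡ (trans (inner-comm v _) e)) (zeroʳ _)))

        -- Since (xI - M) z = (x - μ q) z, changing `w l` by a multiple of z is a column operation
        -- with column q of `B x`; in the columns beyond q the multiplier acquires the factor x - μ
        -- q.
        column⁺ : ∀ x i l → column (suc k) w⁺ x i l ≈
          α l * B x i l + (β l * select (toℕ l ℕ.<? k) 1# (x - μ q)) * B x i q
        column⁺ x i l with ≡q-or-≢ l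
        ... | inj₁ ≡.refl = begin
          column (suc k) w⁺ x i q
            ≈⟨ select-yes (k ℕ.<? suc k) (ℕ.n<1+n k) ⟩
          w⁺ q i
            ≈⟨ w⁺-q i ⟩
          z i
            ≡⟨ setColumn-at (column k w x) q z i ⟨
          B x i q
            ≈⟨ trans (+-cong (trans (*-congʳ (select-yes (q Fin.≟ q) ≡.refl)) (*-identityˡ _))
                 (trans (*-congʳ (trans (*-congʳ (select-yes (q Fin.≟ q) ≡.refl)) (zeroˡ _))) (zeroˡ _)))
                 (+-identityʳ _) ⟨
          α q * B x i q + (β q * select (k ℕ.<? k) 1# (x - μ q)) * B x i q ∎
        ... | inj₂ l≢q with toℕ l ℕ.<? k in eq
        ...   | yes l<k = begin
          column (suc k) w⁺ x i l
            ≈⟨ select-yes (toℕ l ℕ.<? suc k) (ℕ.m<n⇒m<1+n l<k) ⟩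
          w⁺ l i
            ≈⟨ +-cong (*-congˡ (select-no (l Fin.≟ q) l≢q)) (*-congʳ (sym (*-identityʳ _))) ⟩
          α l * w l i + β l * 1# * z i
            ≈⟨ +-cong (*-congˡ (trans (sym (select-yes (toℕ l ℕ.<? k) l<k)) (B-off l≢q)))
                 (*-congˡ (reflexive (≡.sym (setColumn-at (column k w x) q z i)))) ⟩
          α l * B x i l + β l * 1# * B x i q ∎
          where
          B-off : ∀ {l} → l ≢ q → column k w x i l ≈ B x i l
          B-off l≢q = reflexive (≡.sym (setColumn-off (column k w x) z i l≢q))
        ...   | no l≮k = begin
          column (suc k) w⁺ x i l
            ≈⟨ select-no (toℕ l ℕ.<? suc k) (λ l<1+k → l≮k (ℕ.≤∧≢⇒< (ℕ.s≤s⁻¹ l<1+k) (l≢q ∘ Fin.toℕ-injective))) ⟩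
          x * w⁺ l i - apply M (w⁺ l) i
            ≈⟨ +-cong (*-congˡ (w⁺-base i)) (-‿cong (trans (sum-cong λ j → *-congˡ (w⁺-base j))
                 (trans (apply-linear M (α l) (β l) (w l) z i) (+-congˡ (*-congˡ (z-eigen i)))))) ⟩
          x * (α l * w l i + β l * z i) - (α l * apply M (w l) i + β l * (μ q * z i))
            ≈⟨ solve 7 (λ x a b c d e m → x :* (a :* c :+ b :* d) :- (a :* e :+ b :* (m :* d)) :=
                 a :* (x :* c :- e) :+ b :* (x :- m) :* d) refl x (α l) (β l) (w l i) (z i) (apply M (w l) i) (μ q) ⟩
          α l * (x * w l i - apply M (w l) i) + β l * (x - μ q) * z i
            ≈⟨ +-cong (*-congˡ (trans (sym (select-no (toℕ l ℕ.<? k) l≮k)) (B-off l≢q)))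
                 (*-congˡ (reflexive (≡.sym (setColumn-at (column k w x) q z i)))) ⟩
          α l * B x i l + β l * (x - μ q) * B x i q ∎
          where
          B-off : ∀ {l} → l ≢ q → column k w x i l ≈ B x i l
          B-off l≢q = reflexive (≡.sym (setColumn-off (column k w x) z i l≢q))
          w⁺-base : ∀ j → w⁺ l j ≈ α l * w l j + β l * z j
          w⁺-base j = +-congʳ (*-congˡ (select-no (l Fin.≟ q) l≢q))

        flag⁺ : Flag (suc k)
        flag⁺ = record
          { w = w⁺
          ; κ = product α * (y q * κ)
          ; κ≉0 = *-≉0 (product-≉0 α≉0) (*-≉0 y-q κ≉0)
          ; eigen = eigen⁺
          ; orth = orth⁺
          ; norm≉0 = norm⁺
          ; det-κ = λ x → begin
              det (column (suc k) w⁺ x)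
                ≈⟨ det-eliminate q α (λ l → β l * select (toℕ l ℕ.<? k) 1# (x - μ q)) {B x}
                     (select-yes (q Fin.≟ q) ≡.refl)
                     (trans (*-congʳ (select-yes (q Fin.≟ q) ≡.refl)) (zeroˡ _)) (column⁺ x) ⟩
              product α * det (B x)
                ≈⟨ *-congˡ (det-B x) ⟩
              product α * (y q * κ * remaining μ (suc k) x)
                ≈⟨ *-assoc _ _ _ ⟨
              product α * (y q * κ) * remaining μ (suc k) x ∎
          }
          where
          α≉0 : ∀ l → ¬ α l ≈ 0#
          α≉0 l with l Fin.≟ q
          ... | yes _ = Pos⇒≉0 Pos-1
          ... | no  _ = ζ≉0
          eigen⁺ : ∀ l → toℕ l < suc k → ∀ i → apply M (w⁺ l) i ≈ μ l * w⁺ l i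
          eigen⁺ l l<1+k i with cases l l<1+k
          ... | inj₁ ≡.refl = begin
            apply M (w⁺ q) i   ≈⟨ sum-cong (λ j → *-congˡ (w⁺-q j)) ⟩
            apply M z i        ≈⟨ z-eigen i ⟩
            μ q * z i          ≈⟨ *-congˡ (w⁺-q i) ⟨
            μ q * w⁺ q i       ∎
          ... | inj₂ (l≢q , l<k) = begin
            apply M (w⁺ l) i              ≈⟨ sum-cong (λ j → *-congˡ (w⁺-< l≢q l<k j)) ⟩
            apply M (λ j → ζ * w l j) i   ≈⟨ inner-scale ζ (M i) (w l) ⟩
            ζ * apply M (w l) i           ≈⟨ *-congˡ (eigen l l<k i) ⟩
            ζ * (μ l * w l i)             ≈⟨ solve 3 (λ a b c → a :* (b :* c) := b :* (a :* c)) refl ζ (μ l) (w l i) ⟩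
            μ l * (ζ * w l i)             ≈⟨ *-congˡ (w⁺-< l≢q l<k i) ⟨
            μ l * w⁺ l i                  ∎
          norm⁺ : ∀ l → toℕ l < suc k → ¬ ⟪ w⁺ l , w⁺ l ⟫ ≈ 0#
          norm⁺ l l<1+k e with cases l l<1+k
          ... | inj₁ ≡.refl = ζ≉0 (trans (sym (inner-cong w⁺-q w⁺-q)) e)
          ... | inj₂ (l≢q , l<k) = *-≉0 (*-≉0 ζ≉0 ζ≉0) (norm≉0 l l<k) (begin
            ζ * ζ * ⟪ w l , w l ⟫
              ≈⟨ sum-*ˡ ⟩
            sum (λ i → ζ * ζ * (w l i * w l i))
              ≈⟨ sum-cong (λ i → solve 2 (λ a b → a :* a :* (b :* b) := (a :* b) :* (a :* b)) refl ζ (w l i)) ⟩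
            ⟪ (λ i → ζ * w l i) , (λ i → ζ * w l i) ⟫
              ≈⟨ inner-cong (w⁺-< l≢q l<k) (w⁺-< l≢q l<k) ⟨
            ⟪ w⁺ l , w⁺ l ⟫
              ≈⟨ e ⟩
            0# ∎)

    flags : ∀ k → k ℕ.≤ n → ¬ ¬ Flag k
    flags zero    _   = pure flag₀
    flags (suc k) k<n = flags k (ℕ.<⇒≤ k<n) >>= λ F →
      let q = fromℕ< k<n
          F′ = ≡.subst Flag (≡.sym (Fin.toℕ-fromℕ< k<n)) F
      in Step.next-vector q F′ >>= λ (F″ , N) →
        pure (≡.subst (Flag ∘ suc) (Fin.toℕ-fromℕ< k<n) (Step.Extend.flag⁺ q F″ N))

    record Eigenbasis : Set where
      field
        vec    : Fin n → Fin n → K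
        eigen  : ∀ l i → apply M (vec l) i ≈ μ l * vec l i
        orth   : ∀ l l′ → l ≢ l′ → ⟪ vec l , vec l′ ⟫ ≈ 0#
        norm≉0 : ∀ l → ¬ ⟪ vec l , vec l ⟫ ≈ 0#

    eigenbasis : ¬ ¬ Eigenbasis
    eigenbasis = flags n ℕ.≤-refl >>= λ F → let open Flag F in pure record
      { vec    = w
      ; eigen  = λ l → eigen l (Fin.toℕ<n l)
      ; orth   = λ l l′ → orth l l′ (Fin.toℕ<n l)
      ; norm≉0 = λ l → norm≉0 l (Fin.toℕ<n l)
      }

-- Counting eigenvalues by the dimension of a subspace.

module Counting (R : CommutativeRing 0ℓ 0ℓ) (C : PositiveCone R) where
  open CommutativeRing R hiding (zero) renaming (Carrier to K)
  open Classical
  open Ordered R C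
  open Sums R
  open Determinant R using (Matrix)
  open Kernel R C
  open InnerProduct R
  open Spectral R C
  open IntegerSolver R using (solve; con; _:=_; _:+_; _:*_; :-_; _:-_)
  open import Data.Empty using (⊥; ⊥-elim)
  open import Data.Fin.Base using (Fin)
  open import Data.Integer.Base using (+_)
  open import Data.Nat.Base as ℕ using (ℕ; suc)
  import Data.Nat.Properties as ℕ
  open import Data.Product.Base using (_,_)
  open import Relation.Binary.PropositionalEquality using (_≡_; _≢_; ≢-sym)
  open import Relation.Binary.Reasoning.Setoid setoid

  Pos-inner : ∀ {n} {u : Fin n → K} → ¬ ⟪ u , u ⟫ ≈ 0# → ¬ ¬ Pos ⟪ u , u ⟫
  Pos-inner {u = u} u≉0 = Nonneg-cases (Nonneg-sum λ i → Nonneg-square (u i)) >>= λ where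
    (inj₁ p) → pure p
    (inj₂ e) → ⊥-elim (u≉0 e)

  inner-orthogonal : ∀ {m n} (u : Fin m → Fin n → K) → (∀ i j → i ≢ j → ⟪ u i , u j ⟫ ≈ 0#) →
    ∀ s t → ⟪ (λ k → sum λ i → s i * u i k) , (λ k → sum λ i → t i * u i k) ⟫ ≈
      sum (λ i → s i * (t i * ⟪ u i , u i ⟫))
  inner-orthogonal u orth s t = begin
    ⟪ S , T ⟫                                      ≈⟨ inner-comm S T ⟩
    ⟪ T , S ⟫                                      ≈⟨ inner-sum T s u ⟩
    sum (λ i → s i * ⟪ T , u i ⟫)                  ≈⟨ sum-cong (λ i → *-congˡ (begin
      ⟪ T , u i ⟫                                    ≈⟨ inner-comm T (u i) ⟩
      ⟪ u i , T ⟫                                    ≈⟨ inner-sum (u i) t u ⟩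
      sum (λ j → t j * ⟪ u i , u j ⟫)                ≈⟨ sum-single i (λ j j≢i →
                                                          trans (*-congˡ (orth i j (≢-sym j≢i))) (zeroʳ _)) ⟩
      t i * ⟪ u i , u i ⟫                            ∎)) ⟩
    sum (λ i → s i * (t i * ⟪ u i , u i ⟫))        ∎
    where
    S = λ k → sum λ i → s i * u i k
    T = λ k → sum λ i → t i * u i k

  module _ {n : ℕ} (M : Matrix n) (M-sym : ∀ i j → M i j ≈ M j i) (μ : Fin n → K)
           (charPoly : ∀ x → Determinant.det R (λ i j → x * δ i j - M i j) ≈ product (λ l → x - μ l)) where

    eigenvalue-nonneg : (∀ x → Nonneg ⟪ x , apply M x ⟫) → ∀ l → Nonneg (μ l)
    eigenvalue-nonneg h l p = (eigenbasis M M-sym μ charPoly >>= contradict) λ ()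
      where
      open import Algebra.Properties.Ring ring using (-‿distribˡ-*)
      contradict : Eigenbasis M M-sym μ charPoly → ¬ ¬ ⊥
      contradict B = Pos-inner (norm≉0 l) >>= λ q → ⊥-elim (h (vec l) (Pos-resp (begin
        - μ l * ⟪ vec l , vec l ⟫                   ≈⟨ -‿distribˡ-* _ _ ⟨
        - (μ l * ⟪ vec l , vec l ⟫)                 ≈⟨ -‿cong (inner-scale (μ l) (vec l) (vec l)) ⟨
        - ⟪ vec l , (λ i → μ l * vec l i) ⟫         ≈⟨ -‿cong (inner-cong (λ _ → refl) (eigen l)) ⟨
        - ⟪ vec l , apply M (vec l) ⟫               ∎) (Pos-* p q)))
        where open Eigenbasis B

    -- The span of r + 1 eigenvectors meets every subspace of codimension r.
    few-large-eigenvalues : ∀ {r} (L : Fin r → Fin n → K) (b c : K) →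
      (∀ x → (∀ j → ⟪ L j , x ⟫ ≈ 0#) →
        Nonneg (b * (c * ⟪ x , x ⟫ - ⟪ x , apply M x ⟫) - ⟪ x , x ⟫)) →
      (g : Fin (suc r) → Fin n) → (∀ {i j} → g i ≡ g j → i ≡ j) →
      (∀ i → Pos (b * (μ (g i) - c) + 1#)) → ⊥
    few-large-eigenvalues {r} L b c bound g g-inj large =
      (eigenbasis M M-sym μ charPoly >>= λ B → contradict B) λ ()
      where
      contradict : Eigenbasis M M-sym μ charPoly → ¬ ¬ ⊥
      contradict B = wide⇒kernel (ℕ.n<1+n r) (λ j i → ⟪ L j , vec (g i) ⟫) >>= λ (t , (k , tk≉0) , ker) →
        Pos-square tk≉0 >>= λ t²>0 → Pos-inner (norm≉0 (g k)) >>= λ N>0 →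
        finite-choice (λ i → Pos-inner (norm≉0 (g i))) >>= λ N →
        Pos-sum (λ i → Nonneg-* (Nonneg-* (Nonneg-square (t i)) (Pos⇒Nonneg (N i))) (Pos⇒Nonneg (large i)))
          k (Pos-* (Pos-* t²>0 N>0) (large k)) >>= λ p →
        let open Vector t in ⊥-elim (bound z (Lz≈0 ker) (Pos-resp total p))
        where
        open Eigenbasis B
        module Vector (t : Fin (suc r) → K) where
          u : Fin (suc r) → Fin n → K
          u i = vec (g i)
          u-orth : ∀ i j → i ≢ j → ⟪ u i , u j ⟫ ≈ 0#
          u-orth i j i≢j = orth (g i) (g j) λ e → i≢j (g-inj e)
          z : Fin n → K
          z k = sum λ i → t i * u i k
          Lz≈0 : (∀ j → sum (λ i → ⟪ L j , u i ⟫ * t i) ≈ 0#) → ∀ j → ⟪ L j , z ⟫ ≈ 0#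
          Lz≈0 ker j = trans (inner-sum (L j) t u) (trans (sum-cong λ i → *-comm _ _) (ker j))
          Mz : ∀ k → apply M z k ≈ sum (λ i → t i * μ (g i) * u i k)
          Mz k = trans (apply-sum M t u k) (sum-cong λ i →
            trans (*-congˡ (eigen (g i) k)) (sym (*-assoc _ _ _)))
          N : Fin (suc r) → K
          N i = ⟪ u i , u i ⟫
          -- For positive b the chosen eigenvalues exceed c - 1/b, so z would have a Rayleigh
          -- quotient above c - 1/b, whereas `bound` says that it is at most c - 1/b. The identity
          -- states this after multiplication by b.
          total : sum (λ i → t i * t i * N i * (b * (μ (g i) - c) + 1#)) ≈
            - (b * (c * ⟪ z , z ⟫ - ⟪ z , apply M z ⟫) - ⟪ z , z ⟫)
          total = begin
            sum (λ i → t i * t i * N i * (b * (μ (g i) - c) + 1#))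
              ≈⟨ sum-cong (λ i → solve 5 (λ t n b m c →
                   t :* t :* n :* (b :* (m :- c) :+ con (+ 1)) :=
                   b :* (t :* (t :* m :* n)) :+ (con (+ 1) :- b :* c) :* (t :* (t :* n)))
                   refl (t i) (N i) b (μ (g i)) c) ⟩
            sum (λ i → b * (t i * (t i * μ (g i) * N i)) + (1# - b * c) * (t i * (t i * N i)))
              ≈⟨ sum-linear ⟩
            b * sum (λ i → t i * (t i * μ (g i) * N i)) + (1# - b * c) * sum (λ i → t i * (t i * N i))
              ≈⟨ +-cong (*-congˡ (trans (inner-cong (λ _ → refl) Mz)
                   (inner-orthogonal u u-orth t (λ i → t i * μ (g i)))))
                   (*-congˡ (inner-orthogonal u u-orth t t)) ⟨
            b * ⟪ z , apply M z ⟫ + (1# - b * c) * ⟪ z , z ⟫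
              ≈⟨ solve 4 (λ b c x y → b :* y :+ (con (+ 1) :- b :* c) :* x := :- (b :* (c :* x :- y) :- x))
                   refl b c ⟪ z , z ⟫ ⟪ z , apply M z ⟫ ⟩
            - (b * (c * ⟪ z , z ⟫ - ⟪ z , apply M z ⟫) - ⟪ z , z ⟫) ∎

-- The Cauchy reals as a ring with a positive cone.

module RealField where
  open import Defs
  open import Data.Empty using (⊥; ⊥-elim)
  open import Data.Nat.Base as ℕ using (ℕ; _⊔_)
  import Data.Nat.Properties as ℕ
  open import Data.Product.Base using (∃-syntax; _×_; _,_)
  open import Data.Rational.Base as ℚ using (ℚ; 0ℚ; 1ℚ; ½; ∣_∣)
  import Data.Rational.Properties as ℚ
  open import Data.Rational.Solver using (module +-*-Solver)
  open import Relation.Binary.PropositionalEquality using (_≡_; refl; sym; trans; cong; subst)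
  open import Algebra.Structures using (IsCommutativeRing)
  open import Relation.Binary.Structures using (IsEquivalence)
  open import Relation.Nullary.Decidable.Core using (yes; no)
  open +-*-Solver

  Eventually : (ℕ → Set) → Set
  Eventually P = ∃[ N ] (∀ n → N ℕ.≤ n → P n)

  both : ∀ {P Q R : ℕ → Set} → Eventually P → Eventually Q → (∀ n → P n → Q n → R n) → Eventually R
  both (M , p) (N , q) f = M ⊔ N , λ n h →
    f n (p n (ℕ.m⊔n≤o⇒m≤o M N h)) (q n (ℕ.m⊔n≤o⇒n≤o M N h))

  map : ∀ {P Q : ℕ → Set} → (∀ n → P n → Q n) → Eventually P → Eventually Q
  map f (N , p) = N , λ n h → f n (p n h)

  0<-diff : ∀ {p q} → p ℚ.< q → 0ℚ ℚ.< q ℚ.- p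
  0<-diff {p} {q} p<q = subst (ℚ._< q ℚ.- p) (ℚ.+-inverseʳ p) (ℚ.+-monoˡ-< (ℚ.- p) p<q)

  <-from-diff : ∀ {p q} r → 0ℚ ℚ.< r → r ≡ q ℚ.- p → p ℚ.< q
  <-from-diff {p} {q} r 0<r eq = subst₂′ (ℚ.+-identityˡ p) (solve 2 (λ p q → (q :- p) :+ p := q) refl p q)
    (ℚ.+-monoˡ-< p (subst (0ℚ ℚ.<_) eq 0<r))
    where
    subst₂′ : ∀ {a b c d : ℚ} → a ≡ b → c ≡ d → a ℚ.< c → b ℚ.< d
    subst₂′ refl refl h = h

  half>0 : ∀ {ε} → 0ℚ ℚ.< ε → 0ℚ ℚ.< ½ ℚ.* ε
  half>0 {ε} 0<ε = subst (ℚ._< ½ ℚ.* ε) (ℚ.*-zeroʳ ½) (ℚ.*-monoʳ-<-pos ½ 0<ε)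

  *>0 : ∀ {p q} → 0ℚ ℚ.< p → 0ℚ ℚ.< q → 0ℚ ℚ.< p ℚ.* q
  *>0 {p} {q} 0<p 0<q = subst (ℚ._< p ℚ.* q) (ℚ.*-zeroʳ p)
    (ℚ.*-monoʳ-<-pos p {{ℚ.positive 0<p}} 0<q)

  +>0 : ∀ {p q} → 0ℚ ℚ.< p → 0ℚ ℚ.< q → 0ℚ ℚ.< p ℚ.+ q
  +>0 = ℚ.+-mono-<

  p≤∣p∣ : ∀ p → p ℚ.≤ ∣ p ∣
  p≤∣p∣ p with ℚ.≤-total 0ℚ p
  ... | inj₁ 0≤p = ℚ.≤-reflexive (sym (ℚ.0≤p⇒∣p∣≡p 0≤p))
  ... | inj₂ p≤0 = ℚ.≤-trans p≤0 (ℚ.0≤∣p∣ p)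

  ∣∣<⇒< : ∀ {p ε} → ∣ p ∣ ℚ.< ε → p ℚ.< ε
  ∣∣<⇒< {p} h = ℚ.≤-<-trans (p≤∣p∣ p) h

  ∣∣<⇒-< : ∀ {p ε} → ∣ p ∣ ℚ.< ε → ℚ.- p ℚ.< ε
  ∣∣<⇒-< {p} {ε} h = ∣∣<⇒< (subst (ℚ._< ε) (sym (ℚ.∣-p∣≡∣p∣ p)) h)

  shrink : ∀ {B} → 0ℚ ℚ.< B → ∀ {ε} → 0ℚ ℚ.< ε → ∃[ δ ] (0ℚ ℚ.< δ × δ ℚ.* B ≡ ε)
  shrink {B} 0<B {ε} 0<ε = ε ℚ.* ℚ.1/ B , *>0 0<ε (ℚ.positive⁻¹ (ℚ.1/ B) {{ℚ.1/pos⇒pos B}}) ,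
    trans (ℚ.*-assoc ε (ℚ.1/ B) B) (trans (cong (ε ℚ.*_) (ℚ.*-inverseˡ B)) (ℚ.*-identityʳ ε))
    where
    instance
      B⁺ : ℚ.Positive B
      B⁺ = ℚ.positive 0<B
      B≢0 : ℚ.NonZero B
      B≢0 = ℚ.pos⇒nonZero B

  -- Equality of reals is nullity of the difference, so the congruence laws reduce to sums of null
  -- sequences and their products with bounded ones.
  Null : (ℕ → ℚ) → Set
  Null s = ∀ ε → 0ℚ ℚ.< ε → Eventually λ n → ∣ s n ∣ ℚ.< ε

  Null-+ : ∀ {s t} → Null s → Null t → Null (λ n → s n ℚ.+ t n)
  Null-+ {s} {t} hs ht ε 0<ε = both (hs _ (half>0 0<ε)) (ht _ (half>0 0<ε)) λ n p q → begin-strict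
    ∣ s n ℚ.+ t n ∣          ≤⟨ ℚ.∣p+q∣≤∣p∣+∣q∣ (s n) (t n) ⟩
    ∣ s n ∣ ℚ.+ ∣ t n ∣      <⟨ ℚ.+-mono-< p q ⟩
    ½ ℚ.* ε ℚ.+ ½ ℚ.* ε      ≡⟨ solve 1 (λ e → con ½ :* e :+ con ½ :* e := e) refl ε ⟩
    ε                        ∎
    where open ℚ.≤-Reasoning

  bounded : ∀ x → ∃[ B ] (0ℚ ℚ.< B × Eventually λ n → ∣ seq x n ∣ ℚ.< B)
  bounded x with isCauchy x 1ℚ (ℚ.positive⁻¹ 1ℚ)
  ... | N , h = 1ℚ ℚ.+ ∣ a ∣ , ℚ.+-mono-<-≤ (ℚ.positive⁻¹ 1ℚ) (ℚ.0≤∣p∣ a) , N , λ n N≤n → begin-strict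
    ∣ seq x n ∣                       ≡⟨ cong ∣_∣ (solve 2 (λ p q → p := (p :- q) :+ q) refl (seq x n) a) ⟩
    ∣ (seq x n ℚ.- a) ℚ.+ a ∣         ≤⟨ ℚ.∣p+q∣≤∣p∣+∣q∣ (seq x n ℚ.- a) a ⟩
    ∣ seq x n ℚ.- a ∣ ℚ.+ ∣ a ∣       <⟨ ℚ.+-monoˡ-< ∣ a ∣ (h n N N≤n ℕ.≤-refl) ⟩
    1ℚ ℚ.+ ∣ a ∣                      ∎
    where
    open ℚ.≤-Reasoning
    a = seq x N

  Null-* : ∀ {s} → Null s → ∀ x → Null (λ n → s n ℚ.* seq x n)
  Null-* {s} hs x ε 0<ε =
    let B , 0<B , x<B   = bounded x
        δ , 0<δ , δB≡ε  = shrink 0<B 0<ε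
    in both (hs δ 0<δ) x<B λ n → product-bound B δ 0<δ δB≡ε (s n) (seq x n)
    where
    product-bound : ∀ B δ → 0ℚ ℚ.< δ → δ ℚ.* B ≡ ε → ∀ p q → ∣ p ∣ ℚ.< δ → ∣ q ∣ ℚ.< B → ∣ p ℚ.* q ∣ ℚ.< ε
    product-bound B δ 0<δ δB≡ε p q p<δ q<B = begin-strict
      ∣ p ℚ.* q ∣        ≡⟨ ℚ.∣p*q∣≡∣p∣*∣q∣ p q ⟩
      ∣ p ∣ ℚ.* ∣ q ∣    ≤⟨ ℚ.*-monoʳ-≤-nonNeg ∣ q ∣ {{ℚ.nonNegative (ℚ.0≤∣p∣ q)}} (ℚ.<⇒≤ p<δ) ⟩
      δ ℚ.* ∣ q ∣        <⟨ ℚ.*-monoʳ-<-pos δ {{ℚ.positive 0<δ}} q<B ⟩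
      δ ℚ.* B            ≡⟨ δB≡ε ⟩
      ε                  ∎
      where open ℚ.≤-Reasoning

  Null-resp : ∀ {s t} → (∀ n → s n ≡ t n) → Null s → Null t
  Null-resp e h ε 0<ε = map (λ n → subst (λ q → ∣ q ∣ ℚ.< ε) (e n)) (h ε 0<ε)

  pointwise : ∀ {x y} → (∀ n → seq x n ≡ seq y n) → x ≈ y
  pointwise {x} {y} e ε 0<ε = 0 , λ n _ → subst (λ q → ∣ q ∣ ℚ.< ε)
    (sym (trans (cong (ℚ._- seq y n) (e n)) (ℚ.+-inverseʳ (seq y n)))) 0<ε

  ≈-isEquivalence : IsEquivalence _≈_
  ≈-isEquivalence = record
    { refl  = λ {x} → pointwise {x} {x} λ n → refl
    ; sym   = λ {x} {y} h ε 0<ε → map (λ n → subst (ℚ._< ε)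
        (trans (sym (ℚ.∣-p∣≡∣p∣ _)) (cong ∣_∣ (solve 2 (λ a b → :- (a :- b) := b :- a) refl (seq x n) (seq y n)))))
        (h ε 0<ε)
    ; trans = λ {x} {y} {z} h k → Null-resp
        (λ n → solve 3 (λ a b c → (a :- b) :+ (b :- c) := a :- c) refl (seq x n) (seq y n) (seq z n))
        (Null-+ {λ n → seq x n ℚ.- seq y n} {λ n → seq y n ℚ.- seq z n} h k)
    }

  -- Comparing two reals by unfolding also compares their proofs of convergence, so the operations of the
  -- ring are opaque copies.
  infix  4 _≋_
  infixl 6 _⊕_
  infixl 7 _⊗_
  infix  8 ⊖_
  opaque
    _≋_ : ℝ → ℝ → Set
    _≋_ = _≈_

    _⊕_ _⊗_ : ℝ → ℝ → ℝ
    _⊕_ = _+_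
    _⊗_ = _*_

    ⊖_ : ℝ → ℝ
    ⊖_ = -_

  opaque
    unfolding _≋_ _⊕_ _⊗_ ⊖_

    ≈⇒≋ : ∀ {x y} → x ≈ y → x ≋ y
    ≈⇒≋ h = h

    ⊕≡+ : ∀ x y → x ⊕ y ≡ x + y
    ⊕≡+ x y = refl

    ⊗≡* : ∀ x y → x ⊗ y ≡ x * y
    ⊗≡* x y = refl

    ⊖≡- : ∀ x → ⊖ x ≡ - x
    ⊖≡- x = refl

    isCommutativeRing : IsCommutativeRing _≋_ _⊕_ _⊗_ ⊖_ 0ℝ 1ℝ
    isCommutativeRing = record
      { isRing = record
        { +-isAbelianGroup = record
          { isGroup = record
            { isMonoid = record
              { isSemigroup = record
                { isMagma = record
                  { isEquivalence = ≈-isEquivalence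
                  ; ∙-cong = λ {x} {y} {u} {v} h k → Null-resp
                      (λ n → solve 4 (λ a b c d → (a :- b) :+ (c :- d) := (a :+ c) :- (b :+ d)) refl
                        (seq x n) (seq y n) (seq u n) (seq v n))
                      (Null-+ {λ n → seq x n ℚ.- seq y n} {λ n → seq u n ℚ.- seq v n} h k)
                  }
                ; assoc = λ x y z → pointwise {(x + y) + z} {x + (y + z)} λ n →
                    ℚ.+-assoc (seq x n) (seq y n) (seq z n)
                }
              ; identity = (λ x → pointwise {0ℝ + x} {x} λ n → ℚ.+-identityˡ (seq x n)) ,
                           (λ x → pointwise {x + 0ℝ} {x} λ n → ℚ.+-identityʳ (seq x n))
              }
            ; inverse = (λ x → pointwise {(- x) + x} {0ℝ} λ n → ℚ.+-inverseˡ (seq x n)) ,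
                        (λ x → pointwise {x + (- x)} {0ℝ} λ n → ℚ.+-inverseʳ (seq x n))
            ; ⁻¹-cong = λ {x} {y} h → Null-resp
                (λ n → solve 2 (λ a b → :- con 1ℚ :* (a :- b) := :- a :- :- b) refl (seq x n) (seq y n))
                (Null-resp (λ n → ℚ.*-comm (seq x n ℚ.- seq y n) (ℚ.- 1ℚ))
                  (Null-* {λ n → seq x n ℚ.- seq y n} h (fromℚ (ℚ.- 1ℚ))))
            }
          ; comm = λ x y → pointwise {x + y} {y + x} λ n → ℚ.+-comm (seq x n) (seq y n)
          }
        ; *-cong = λ {x} {y} {u} {v} h k → Null-resp
            (λ n → solve 4 (λ a b c d → (a :- b) :* c :+ (c :- d) :* b := a :* c :- b :* d) refl
              (seq x n) (seq y n) (seq u n) (seq v n))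
            (Null-+ {λ n → (seq x n ℚ.- seq y n) ℚ.* seq u n} {λ n → (seq u n ℚ.- seq v n) ℚ.* seq y n}
              (Null-* {λ n → seq x n ℚ.- seq y n} h u) (Null-* {λ n → seq u n ℚ.- seq v n} k y))
        ; *-assoc = λ x y z → pointwise {(x * y) * z} {x * (y * z)} λ n →
            ℚ.*-assoc (seq x n) (seq y n) (seq z n)
        ; *-identity = (λ x → pointwise {1ℝ * x} {x} λ n → ℚ.*-identityˡ (seq x n)) ,
                       (λ x → pointwise {x * 1ℝ} {x} λ n → ℚ.*-identityʳ (seq x n))
        ; distrib = (λ x y z → pointwise {x * (y + z)} {x * y + x * z} λ n →
                       ℚ.*-distribˡ-+ (seq x n) (seq y n) (seq z n)) ,
                    (λ x y z → pointwise {(y + z) * x} {y * x + z * x} λ n →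
                       ℚ.*-distribʳ-+ (seq x n) (seq y n) (seq z n))
        }
      ; *-comm = λ x y → pointwise {x * y} {y * x} λ n → ℚ.*-comm (seq x n) (seq y n)
      }

  realRing : CommutativeRing 0ℓ 0ℓ
  realRing = record { isCommutativeRing = isCommutativeRing }

  Positive : ℝ → Set
  Positive x = ∃[ ε ] (0ℚ ℚ.< ε × Eventually λ n → ε ℚ.< seq x n)

  Small : ℝ → ℚ → Set
  Small x ε = Eventually λ n → ∣ seq x n ∣ ℚ.< ε

  quarter : ℚ → ℚ
  quarter ε = ½ ℚ.* (½ ℚ.* ε)

  -- Take N such that all later terms stay within ε/4 of `seq x N`, and compare this one rational
  -- with ε/2 and -ε/2. The alternatives overlap, which is why the choice can be made.
  approximate-sign : ∀ x ε → 0ℚ ℚ.< ε → Positive x ⊎ Positive (- x) ⊎ Small x ε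
  approximate-sign x ε 0<ε with isCauchy x (quarter ε) (half>0 (half>0 0<ε))
  ... | N , h with ½ ℚ.* ε ℚ.<? seq x N | ½ ℚ.* ε ℚ.<? ℚ.- seq x N
  ...   | yes p | _ = inj₁ (quarter ε , half>0 (half>0 0<ε) , N , λ n N≤n →
    <-from-diff _ (+>0 (0<-diff p) (0<-diff (∣∣<⇒-< (h n N N≤n ℕ.≤-refl))))
      (solve 3 (λ e a b → (a :- con ½ :* e) :+ (con ½ :* (con ½ :* e) :- (:- (b :- a))) := b :- con ½ :* (con ½ :* e)) refl ε (seq x N) (seq x n)))
  ...   | no _ | yes p = inj₂ (inj₁ (quarter ε , half>0 (half>0 0<ε) , N , λ n N≤n →
    <-from-diff _ (+>0 (0<-diff p) (0<-diff (∣∣<⇒< (h n N N≤n ℕ.≤-refl))))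
      (solve 3 (λ e a b → (:- a :- con ½ :* e) :+ (con ½ :* (con ½ :* e) :- (b :- a)) := (:- b) :- con ½ :* (con ½ :* e)) refl ε (seq x N) (seq x n))))
  ...   | no ¬p | no ¬q = inj₂ (inj₂ (N , λ n N≤n → begin-strict
    ∣ seq x n ∣
      ≡⟨ cong ∣_∣ (solve 2 (λ p q → p := (p :- q) :+ q) refl (seq x n) (seq x N)) ⟩
    ∣ (seq x n ℚ.- seq x N) ℚ.+ seq x N ∣
      ≤⟨ ℚ.∣p+q∣≤∣p∣+∣q∣ (seq x n ℚ.- seq x N) (seq x N) ⟩
    ∣ seq x n ℚ.- seq x N ∣ ℚ.+ ∣ seq x N ∣
      <⟨ ℚ.+-mono-<-≤ (h n N N≤n ℕ.≤-refl) below ⟩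
    quarter ε ℚ.+ ½ ℚ.* ε
      <⟨ <-from-diff (quarter ε) (half>0 (half>0 0<ε))
           (solve 1 (λ e → con ½ :* (con ½ :* e) := e :- (con ½ :* (con ½ :* e) :+ con ½ :* e)) refl ε) ⟩
    ε ∎))
    where
    open ℚ.≤-Reasoning
    below : ∣ seq x N ∣ ℚ.≤ ½ ℚ.* ε
    below with ℚ.∣p∣≡p∨∣p∣≡-p (seq x N)
    ... | inj₁ e = ℚ.≤-trans (ℚ.≤-reflexive e) (ℚ.≮⇒≥ ¬p)
    ... | inj₂ e = ℚ.≤-trans (ℚ.≤-reflexive e) (ℚ.≮⇒≥ ¬q)

  absurd-eventually : ∀ {P : ℕ → Set} → Eventually P → (∀ n → ¬ P n) → ⊥
  absurd-eventually (N , p) h = h N (p N ℕ.≤-refl)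

  Positive-resp : ∀ {x y} → x ≈ y → Positive x → Positive y
  Positive-resp {x} {y} x≈y (ε , 0<ε , p) = ½ ℚ.* ε , half>0 0<ε , both p (x≈y _ (half>0 0<ε)) λ n p q →
    <-from-diff _ (+>0 (0<-diff p) (0<-diff (∣∣<⇒< q)))
      (solve 3 (λ e a b → (a :- e) :+ (con ½ :* e :- (a :- b)) := b :- con ½ :* e) refl ε (seq x n) (seq y n))

  Positive⇒≉0 : ∀ {x} → Positive x → ¬ x ≈ 0ℝ
  Positive⇒≉0 {x} (ε , 0<ε , p) x≈0 = absurd-eventually (both p (x≈0 ε 0<ε) λ _ p q → (p , q)) λ n (p , q) →
    ℚ.<-asym p (subst (ℚ._< ε) (ℚ.+-identityʳ (seq x n)) (∣∣<⇒< q))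

  -- With both signs refuted, `approximate-sign` can only answer that x is small, at every
  -- precision. Both the stability of equality and the weak trichotomy come from this.
  ≈0-stable : ∀ x → ¬ Positive x → ¬ Positive (- x) → x ≈ 0ℝ
  ≈0-stable x ¬p ¬q ε 0<ε with approximate-sign x ε 0<ε
  ... | inj₁ p        = ⊥-elim (¬p p)
  ... | inj₂ (inj₁ q) = ⊥-elim (¬q q)
  ... | inj₂ (inj₂ s) = map (λ n → subst (λ q → ∣ q ∣ ℚ.< ε) (sym (ℚ.+-identityʳ (seq x n)))) s

  open import Algebra.Properties.Ring (CommutativeRing.ring realRing) using (x≈y⇒x∙y⁻¹≈ε; x∙y⁻¹≈ε⇒x≈y; -0#≈0#)

  opaque
    unfolding _≋_ _⊕_ _⊗_ ⊖_

    Positive-⊕ : ∀ {x y} → Positive x → Positive y → Positive (x ⊕ y)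
    Positive-⊕ (ε , 0<ε , p) (δ , 0<δ , q) = ε ℚ.+ δ , +>0 0<ε 0<δ , both p q λ n → ℚ.+-mono-<

    Positive-⊗ : ∀ {x y} → Positive x → Positive y → Positive (x ⊗ y)
    Positive-⊗ {x} {y} (ε , 0<ε , p) (δ , 0<δ , q) = ε ℚ.* δ , *>0 0<ε 0<δ , both p q λ n p q →
      ℚ.<-trans (ℚ.*-monoʳ-<-pos ε {{ℚ.positive 0<ε}} q)
                (ℚ.*-monoˡ-<-pos (seq y n) {{ℚ.positive (ℚ.<-trans 0<δ q)}} p)

    Positive-≋ : ∀ {x y} → x ≋ y → Positive x → Positive y
    Positive-≋ {x} {y} = Positive-resp {x} {y}

    Positive⇒¬≋0 : ∀ {x} → Positive x → ¬ x ≋ 0ℝ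
    Positive⇒¬≋0 {x} = Positive⇒≉0 {x}

    ≋0-stable : ∀ x → ¬ Positive x → ¬ Positive (⊖ x) → x ≋ 0ℝ
    ≋0-stable = ≈0-stable

  realCone : PositiveCone realRing
  realCone = record
    { Pos        = Positive
    ; Pos-resp   = Positive-≋
    ; Pos-+      = λ {x} {y} → Positive-⊕ {x} {y}
    ; Pos-*      = λ {x} {y} → Positive-⊗ {x} {y}
    ; Pos-1      = ½ , ℚ.positive⁻¹ ½ , 0 , λ _ _ → <-from-diff ½ (ℚ.positive⁻¹ ½) refl
    ; Pos⇒≉0     = Positive⇒¬≋0
    ; trichotomy = λ x k → k (inj₂ (inj₁ (≋0-stable x (λ p → k (inj₁ p)) (λ q → k (inj₂ (inj₂ q))))))
    ; stable     = λ {x} {y} ¬¬e → x∙y⁻¹≈ε⇒x≈y x y (≋0-stable (x ⊕ ⊖ y)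
        (λ p → ¬¬e λ e → Positive⇒¬≋0 p (x≈y⇒x∙y⁻¹≈ε e))
        (λ p → ¬¬e λ e → Positive⇒¬≋0 p
          (CommutativeRing.trans realRing (CommutativeRing.-‿cong realRing (x≈y⇒x∙y⁻¹≈ε e)) -0#≈0#)))
    }

-- Selecting distinct indices with a property.

module Selection where
  open import Data.Fin.Base using (Fin; zero; suc)
  import Data.Fin.Properties as Fin
  open import Data.Nat.Base as ℕ using (ℕ; zero; suc; s≤s)
  import Data.Nat.Properties as ℕ
  open import Data.Product.Base using (Σ; _×_; _,_)
  open import Function.Base using (_∘_)
  open import Relation.Binary.PropositionalEquality using (_≡_; refl; cong; subst)

  Selection : ∀ {n} → ℕ → (Fin n → Set) → Set
  Selection {n} k P = Σ (Fin k → Fin n) λ f → (∀ {i j} → f i ≡ f j → i ≡ j) × (∀ i → P (f i))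

  shift : ∀ {n k} (P : Fin (suc n) → Set) → Selection k (P ∘ suc) → Selection k P
  shift P (f , f-inj , p) = suc ∘ f , f-inj ∘ Fin.suc-injective , p

  extend : ∀ {n k} (P : Fin (suc n) → Set) → P zero → Selection k (P ∘ suc) → Selection (suc k) P
  extend P p₀ (f , f-inj , p) = g , g-inj , g-P
    where
    g : Fin (suc _) → Fin (suc _)
    g zero    = zero
    g (suc i) = suc (f i)
    g-inj : ∀ {i j} → g i ≡ g j → i ≡ j
    g-inj {zero}  {zero}  _ = refl
    g-inj {zero}  {suc j} ()
    g-inj {suc i} {zero}  ()
    g-inj {suc i} {suc j} e = cong suc (f-inj (Fin.suc-injective e))
    g-P : ∀ i → P (g i)
    g-P zero    = p₀
    g-P (suc i) = p i

  -- Takes the place of sorting the eigenvalues, which an undecidable order does not permit: every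
  -- index is assigned to whichever alternative was found for it.
  pigeonhole : ∀ {n} {A B : Fin n → Set} → (∀ i → A i ⊎ B i) →
    ∀ k s → k ℕ.+ s ℕ.≤ suc n → Selection k A ⊎ Selection s B
  pigeonhole h zero s _ = inj₁ ((λ ()) , (λ {i} → λ {}) , λ ())
  pigeonhole h (suc k) zero _ = inj₂ ((λ ()) , (λ {i} → λ {}) , λ ())
  pigeonhole {zero} h (suc k) (suc s) (s≤s le) with subst (ℕ._≤ 0) (ℕ.+-suc k s) le
  ... | ()
  pigeonhole {suc n} {A} {B} h (suc k) (suc s) (s≤s le) with h zero
  ... | inj₁ a with pigeonhole {A = A ∘ suc} {B = B ∘ suc} (h ∘ suc) k (suc s) le
  ...   | inj₁ f = inj₁ (extend A a f)
  ...   | inj₂ g = inj₂ (shift B g)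
  pigeonhole {suc n} {A} {B} h (suc k) (suc s) (s≤s le) | inj₂ b
    with pigeonhole {A = A ∘ suc} {B = B ∘ suc} (h ∘ suc) (suc k) s (subst (ℕ._≤ suc n) (ℕ.+-suc k s) le)
  ...   | inj₁ f = inj₁ (shift A f)
  ...   | inj₂ g = inj₂ (extend B b g)

-- Transfer of the counting argument to real spectra.

module RealSpectrum where
  open import Defs
  open RealField
  open CommutativeRing realRing using (semiring; *-identityʳ; zeroʳ; +-cong; *-cong; -‿cong)
    renaming (refl to ≋-refl; sym to ≋-sym; trans to ≋-trans; reflexive to ≋-reflexive)
  open import Algebra.Definitions.RawSemiring (Semiring.rawSemiring semiring) using () renaming (_^_ to _^#_)
  open import Algebra.Properties.Semiring.Mult semiring using () renaming (_×_ to _×#_)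
  open Ordered realRing realCone using (Nonneg)
  open InnerProduct realRing
  open Sums realRing using () renaming (sum to ∑; product to ∏)
  open Determinant realRing using () renaming (det to Det)
  open Counting realRing realCone using (eigenvalue-nonneg; few-large-eigenvalues)
  open Spectral realRing realCone using (δ)
  open RawOperations realRing
  open Selection
  import Data.Fin.Properties as Fin
  open import Data.Empty using (⊥-elim)
  open import Data.Fin.Base using (Fin; zero; suc; toℕ; punchIn)
  open import Data.Integer.Base as ℤ using (ℤ; +_)
  import Data.Integer.Tactic.RingSolver as ℤSolver
  open import Data.Nat.Base as ℕ using (ℕ; zero; suc)
  import Data.Nat.Properties as ℕ
  open import Data.Product.Base using (Σ; _×_; _,_)
  open import Data.Rational.Base as ℚ using (ℚ; 0ℚ; 1ℚ)
  import Data.Rational.Properties as ℚ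
  open import Data.Rational.Solver using (module +-*-Solver)
  import Data.Rational.Unnormalised.Base as ℚᵘ
  import Data.Rational.Unnormalised.Properties as ℚᵘ
  open import Data.Vec.Functional using (Vector; foldr)
  open import Function.Bundles using (mk↣)
  open import Relation.Binary.PropositionalEquality as ≡ using (_≡_; refl; sym; trans; cong; cong₂; subst)
  open import Relation.Nullary.Decidable.Core using (yes; no)

  -- Proved for unnormalised fractions, where reduction by a greatest common divisor does not get in
  -- the way.
  fromℕ-suc : ∀ k → (+ suc k) ℚ./ 1 ≡ 1ℚ ℚ.+ (+ k) ℚ./ 1
  fromℕ-suc k = ℚ.toℚᵘ-injective (begin
    ℚ.toℚᵘ ((+ suc k) ℚ./ 1)                           ≈⟨ ℚ.toℚᵘ-fromℚᵘ (ℚᵘ.mkℚᵘ (+ suc k) 0) ⟩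
    ℚᵘ.mkℚᵘ (+ suc k) 0                                ≈⟨ ℚᵘ.*≡* (numerators (+ k)) ⟩
    ℚᵘ.1ℚᵘ ℚᵘ.+ ℚᵘ.mkℚᵘ (+ k) 0                        ≈⟨ ℚᵘ.+-cong (ℚᵘ.≃-refl {ℚᵘ.1ℚᵘ}) (ℚ.toℚᵘ-fromℚᵘ (ℚᵘ.mkℚᵘ (+ k) 0)) ⟨
    ℚᵘ.1ℚᵘ ℚᵘ.+ ℚ.toℚᵘ ((+ k) ℚ./ 1)                   ≈⟨ ℚ.toℚᵘ-homo-+ 1ℚ ((+ k) ℚ./ 1) ⟨
    ℚ.toℚᵘ (1ℚ ℚ.+ (+ k) ℚ./ 1)                        ∎)
    where
    open import Relation.Binary.Reasoning.Setoid ℚᵘ.≃-setoid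
    numerators : ∀ i → (+ 1 ℤ.+ i) ℤ.* + 1 ≡ (+ 1 ℤ.* + 1 ℤ.+ i ℤ.* + 1) ℤ.* + 1
    numerators = ℤSolver.solve-∀

  opaque
    unfolding _≋_ _⊕_ _⊗_ ⊖_

    seq-× : ∀ k n → seq (k ×# 1ℝ) n ≡ (+ k) ℚ./ 1
    seq-× zero    n = refl
    seq-× (suc k) n = trans (cong (1ℚ ℚ.+_) (seq-× k n)) (sym (fromℕ-suc k))

    fromℕ≋× : ∀ k → fromℕ k ≋ k ×# 1ℝ
    fromℕ≋× k = pointwise {fromℕ k} {k ×# 1ℝ} λ n → sym (seq-× k n)

    ¬Positive⇒0≤ : ∀ x → ¬ Positive (⊖ x) → 0ℝ ≤ x
    ¬Positive⇒0≤ x ¬p ε 0<ε = decide (approximate-sign x ε 0<ε)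
      where
      open +-*-Solver
      decide : Positive x ⊎ Positive (- x) ⊎ Small x ε → Eventually λ n → 0ℚ ℚ.< seq x n ℚ.+ ε
      decide (inj₁ (δ , 0<δ , p)) = map (λ n q → +>0 (ℚ.<-trans 0<δ q) 0<ε) p
      decide (inj₂ (inj₁ p))      = ⊥-elim (¬p p)
      decide (inj₂ (inj₂ s))      = map (λ n q → <-from-diff _ (0<-diff (∣∣<⇒-< q))
        (solve 2 (λ x e → e :- (:- x) := (x :+ e) :- con 0ℚ) refl (seq x n) ε)) s

  Positive⇒< : ∀ x y → Positive (y - x) → x < y
  Positive⇒< x y (ε , 0<ε , p) = ε , 0<ε , map (λ n q → <-from-diff _ (0<-diff q)
    (solve 3 (λ e x y → (y :- x) :- e := y :- (x :+ e)) refl ε (seq x n) (seq y n))) p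
    where open +-*-Solver

  product-gap : ∀ {B C δ x} → 0ℚ ℚ.< B → δ ℚ.* B ≡ 1ℚ → C ℚ.- x ℚ.< ℚ.½ ℚ.* δ →
    B ℚ.* (ℚ.½ ℚ.* δ) ℚ.< B ℚ.* (x ℚ.- C) ℚ.+ 1ℚ
  product-gap {B} {C} {δ} {x} 0<B δB≡1 h = <-from-diff _ (*>0 0<B (0<-diff h)) (trans
    (solve 4 (λ B C d x → B :* (con ℚ.½ :* d :- (C :- x)) :=
      (B :* (x :- C) :+ d :* B) :- B :* (con ℚ.½ :* d)) refl B C δ x)
    (cong (λ e → (B ℚ.* (x ℚ.- C) ℚ.+ e) ℚ.- B ℚ.* (ℚ.½ ℚ.* δ)) δB≡1))
    where open +-*-Solver

  opaque
    unfolding _≋_ _⊕_ _⊗_ ⊖_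

    -- The alternatives x < c and x > c - 1/(b + 1) overlap in an interval of length δ = 1/(b + 1),
    -- so that knowing c - x up to δ/2 decides between them.
    below-or-near : ∀ b c x → x < fromℕ c ⊎ Positive (suc b ×# 1ℝ ⊗ (x ⊕ ⊖ (c ×# 1ℝ)) ⊕ 1ℝ)
    below-or-near b c x = decide (shrink 0<B (ℚ.positive⁻¹ 1ℚ))
      where
      B C : ℚ
      B = (+ suc b) ℚ./ 1
      C = (+ c) ℚ./ 1
      0<B : 0ℚ ℚ.< B
      0<B = ℚ.positive⁻¹ B {{ℚ.normalize-pos (suc b) 1}}
      decide : Σ ℚ (λ δ → 0ℚ ℚ.< δ × δ ℚ.* B ≡ 1ℚ) → x < fromℕ c ⊎ Positive (suc b ×# 1ℝ ⊗ (x ⊕ ⊖ (c ×# 1ℝ)) ⊕ 1ℝ)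
      decide (δ , 0<δ , δB≡1) = conclude (approximate-sign (fromℕ c - x) (ℚ.½ ℚ.* δ) (half>0 0<δ))
        where
        near : Positive (- (fromℕ c - x)) ⊎ Small (fromℕ c - x) (ℚ.½ ℚ.* δ) →
          Eventually λ n → C ℚ.- seq x n ℚ.< ℚ.½ ℚ.* δ
        near (inj₁ (ε , 0<ε , p)) = map (λ n q → ℚ.<-trans (negative-below (ℚ.<-trans 0<ε q)) (half>0 0<δ)) p
          where
          negative-below : ∀ {a} → 0ℚ ℚ.< ℚ.- a → a ℚ.< 0ℚ
          negative-below {a} h = <-from-diff _ h (sym (ℚ.+-identityˡ (ℚ.- a)))
        near (inj₂ s) = map (λ n → ∣∣<⇒<) s
        above : ∀ n → C ℚ.- seq x n ℚ.< ℚ.½ ℚ.* δ →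
          B ℚ.* (ℚ.½ ℚ.* δ) ℚ.< seq (suc b ×# 1ℝ ⊗ (x ⊕ ⊖ (c ×# 1ℝ)) ⊕ 1ℝ) n
        above n h = subst (B ℚ.* (ℚ.½ ℚ.* δ) ℚ.<_)
          (≡.cong₂ (λ B C → B ℚ.* (seq x n ℚ.- C) ℚ.+ 1ℚ) (sym (seq-× (suc b) n)) (sym (seq-× c n)))
          (product-gap {B} {C} {δ} {seq x n} 0<B δB≡1 h)
        conclude : Positive (fromℕ c - x) ⊎ Positive (- (fromℕ c - x)) ⊎ Small (fromℕ c - x) (ℚ.½ ℚ.* δ) →
          x < fromℕ c ⊎ Positive (suc b ×# 1ℝ ⊗ (x ⊕ ⊖ (c ×# 1ℝ)) ⊕ 1ℝ)
        conclude (inj₁ p) = inj₁ (Positive⇒< x (fromℕ c) p)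
        conclude (inj₂ r) = inj₂ (B ℚ.* (ℚ.½ ℚ.* δ) , *>0 0<B (half>0 0<δ) , map above (near r))

  -- Stated for a variable g, so that convergence proofs stay out of the comparison; `transport`
  -- then carries it over to concrete sums.
  foldr≡sum : ∀ {n} (g : Fin n → ℝ) → foldr _+_ 0ℝ g ≡ sum g
  foldr≡sum g = refl

  foldr≡product : ∀ {n} (g : Fin n → ℝ) → foldr _*_ 1ℝ g ≡ product g
  foldr≡product g = refl

  transport : ∀ {A : Set} (P : A → Set) (x y : A) → x ≡ y → P x → P y
  transport P x y refl p = p

  sum-real : ∀ {n} (f g : Fin n → ℝ) → (∀ i → f i ≋ g i) → ∑ f ≋ sum g
  sum-real f g h = transport (∑ f ≋_) (foldr _+_ 0ℝ g) (sum g) (foldr≡sum g)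
    (sum-foldr _+_ ⊕≡+ {f = f} {g = g} h)

  product₃-real : ∀ a b c x y z → a ≋ x → b ≋ y → c ≋ z → a ⊗ b ⊗ c ≋ x * y * z
  product₃-real a b c x y z p q r = transport (a ⊗ b ⊗ c ≋_) (x * y ⊗ z) (x * y * z) (⊗≡* (x * y) z)
    (transport (λ w → a ⊗ b ⊗ c ≋ w ⊗ z) (x ⊗ y) (x * y) (⊗≡* x y)
      (*-cong {a ⊗ b} {x ⊗ y} {c} {z} (*-cong {a} {x} {b} {y} p q) r))

  sign-real : ∀ k → (⊖ 1ℝ) ^# k ≋ (- 1ℝ) ^ k
  sign-real k = transport ((⊖ 1ℝ) ^# k ≋_) (power _*_ 1ℝ (- 1ℝ) k) ((- 1ℝ) ^ k)
    (power≡× (RawRing.*-rawMonoid ℝ-rawRing) (- 1ℝ) k) (power-real k)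
    where
    power-real : ∀ k → (⊖ 1ℝ) ^# k ≋ power _*_ 1ℝ (- 1ℝ) k
    power-real k = power-cong _*_ ⊗≡* (⊖ 1ℝ) (- 1ℝ) (⊖≡- 1ℝ) k

  det-real : ∀ {n} (A B : Matrix ℝ n) → (∀ i j → A i j ≋ B i j) → Det A ≋ det B
  det-real {zero}  A B h = ≋-refl {1ℝ}
  det-real {suc n} A B h = sum-real
    (λ j → (⊖ 1ℝ) ^# toℕ j ⊗ A zero j ⊗ Det (λ i k → A (suc i) (punchIn j k)))
    (λ j → (- 1ℝ) ^ toℕ j * B zero j * det (λ i k → B (suc i) (punchIn j k)))
    (λ j → product₃-real ((⊖ 1ℝ) ^# toℕ j) (A zero j) (Det (λ i k → A (suc i) (punchIn j k)))
      ((- 1ℝ) ^ toℕ j) (B zero j) (det (λ i k → B (suc i) (punchIn j k)))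
      (sign-real (toℕ j)) (h zero j)
      (det-real (λ i k → A (suc i) (punchIn j k)) (λ i k → B (suc i) (punchIn j k)) (λ i k → h (suc i) (punchIn j k))))

  product-real : ∀ {n} (f g : Fin n → ℝ) → (∀ i → f i ≋ g i) → ∏ f ≋ product g
  product-real f g h = transport (∏ f ≋_) (foldr _*_ 1ℝ g) (product g) (foldr≡product g)
    (product-foldr _*_ ⊗≡* {f = f} {g = g} h)

  castMatrix : ∀ {n} → Matrix ℕ n → Matrix ℝ n
  castMatrix Q i j = Q i j ×# 1ℝ

  module _ {n : ℕ} (Q : Matrix ℕ n) (Q-sym : ∀ i j → Q i j ≡ Q j i)
    (M : Matrix ℝ n) (M≡Q : ∀ i j → M i j ≡ fromℕ (Q i j))
    (μ : Vector ℝ n) (spectrum : IsSpectrum M μ) where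

    private
      difference-real : ∀ a b x y → a ≋ x → b ≋ y → a ⊕ ⊖ b ≋ x - y
      difference-real a b x y p q = transport (a ⊕ ⊖ b ≋_) (x ⊕ - y) (x - y) (⊕≡+ x (- y))
        (transport (λ w → a ⊕ ⊖ b ≋ x ⊕ w) (⊖ y) (- y) (⊖≡- y)
          (+-cong {a} {x} {⊖ b} {⊖ y} p (-‿cong {b} {y} q)))

      charPoly′ : ∀ x → Det (λ i j → x ⊗ δ i j ⊕ ⊖ castMatrix Q i j) ≋ ∏ (λ l → x ⊕ ⊖ μ l)
      charPoly′ x = ≋-trans {Det (λ i j → x ⊗ δ i j ⊕ ⊖ castMatrix Q i j)} {charPoly M x} {∏ (λ l → x ⊕ ⊖ μ l)}
        (det-real (λ i j → x ⊗ δ i j ⊕ ⊖ castMatrix Q i j) (λ i j → scalar x i j - M i j) λ i j →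
          difference-real (x ⊗ δ i j) (castMatrix Q i j) (scalar x i j) (M i j) (diagonal i j) (entry i j))
        (≋-trans {charPoly M x} {product (λ l → x - μ l)} {∏ (λ l → x ⊕ ⊖ μ l)}
          (≈⇒≋ {charPoly M x} {product (λ l → x - μ l)} (spectrum x))
          (≋-sym {∏ (λ l → x ⊕ ⊖ μ l)} {product (λ l → x - μ l)} (product-real (λ l → x ⊕ ⊖ μ l) (λ l → x - μ l) λ l →
            difference-real x (μ l) x (μ l) (≋-refl {x}) (≋-refl {μ l}))))
        where
        entry : ∀ i j → castMatrix Q i j ≋ M i j
        entry i j = transport (castMatrix Q i j ≋_) (fromℕ (Q i j)) (M i j) (sym (M≡Q i j))
          (≋-sym {fromℕ (Q i j)} {castMatrix Q i j} (fromℕ≋× (Q i j)))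
        diagonal : ∀ i j → x ⊗ δ i j ≋ scalar x i j
        diagonal i j with i Fin.≟ j
        ... | yes _ = *-identityʳ x
        ... | no  _ = zeroʳ x

      cast-sym : ∀ i j → castMatrix Q i j ≋ castMatrix Q j i
      cast-sym i j = ≋-reflexive {castMatrix Q i j} {castMatrix Q j i} (cong (_×# 1ℝ) (Q-sym i j))

    -- By the pigeonhole principle either k eigenvalues lie below c or r + 1 lie above c - 1/(b +
    -- 1). The span of r + 1 eigenvectors would meet the common kernel of the r functionals `L`,
    -- where the form is too small for the second case.
    many-small-eigenvalues : (∀ x → Nonneg ⟪ x , apply (castMatrix Q) x ⟫) →
      ∀ {r} (L : Fin r → Fin n → ℝ) b c →
      (∀ x → (∀ j → ⟪ L j , x ⟫ ≋ 0ℝ) →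
        Nonneg (suc b ×# 1ℝ ⊗ (c ×# 1ℝ ⊗ ⟪ x , x ⟫ ⊕ ⊖ ⟪ x , apply (castMatrix Q) x ⟫) ⊕ ⊖ ⟪ x , x ⟫)) →
      ∀ k → k ℕ.+ r ℕ.≤ n → AtLeast k of μ lieIn [ 0ℝ , fromℕ c ⟩
    many-small-eigenvalues nonneg {r} L b c bound k k+r≤n = conclude
      (pigeonhole (λ i → below-or-near b c (μ i)) k (suc r)
        (ℕ.≤-trans (ℕ.≤-reflexive (ℕ.+-suc k r)) (ℕ.s≤s k+r≤n)))
      where
      conclude : Selection k (λ i → μ i < fromℕ c) ⊎
        Selection (suc r) (λ i → Positive (suc b ×# 1ℝ ⊗ (μ i ⊕ ⊖ (c ×# 1ℝ)) ⊕ 1ℝ)) →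
        AtLeast k of μ lieIn [ 0ℝ , fromℕ c ⟩
      conclude (inj₁ (f , f-inj , small)) = mk↣ f-inj , λ j → ¬Positive⇒0≤ (μ (f j))
        (eigenvalue-nonneg (castMatrix Q) cast-sym μ charPoly′ nonneg (f j)) , small j
      conclude (inj₂ (g , g-inj , large)) = ⊥-elim (few-large-eigenvalues (castMatrix Q) cast-sym μ charPoly′ L
        (suc b ×# 1ℝ) (c ×# 1ℝ) bound g g-inj large)

-- Layerings of the vertices.

-- A layering assigns to every vertex a layer ≥ 1, so that layer 0 is empty and every layer has a predecessor.
module Layering where
  open import Data.Bool.Base using (Bool; true; false; if_then_else_)
  open import Data.Empty using (⊥-elim)
  open import Data.Fin.Base using (Fin)
  open import Data.List.Base using (List)
  open import Data.List.Membership.DecPropositional using (_∈?_)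
  open import Data.Nat.Base as ℕ using (ℕ; zero; suc; _+_; _≡ᵇ_; _≤_; _<_)
  import Data.Nat.Properties as ℕ
  open import Data.List.Membership.Propositional using (_∈_; _∉_)
  open import Data.Product.Base using (_×_)
  open import Function.Base using (_∘_)
  open import Relation.Binary.PropositionalEquality using (_≡_; _≢_; refl; cong)
  open import Relation.Nullary.Decidable using (does; _⊎-dec_)
  open import Algebra.Definitions.RawMonoid ℕ.+-0-rawMonoid using (sum)

  ⟦_⟧ : Bool → ℕ
  ⟦ b ⟧ = if b then 1 else 0

  -- The entry of adjacency matrix plus identity for the graph in which layers are cliques and
  -- consecutive layers are completely joined. At most one of the three indicators is 1.
  near : ℕ → ℕ → ℕ
  near i j = ⟦ i ≡ᵇ j ⟧ + ⟦ suc i ≡ᵇ j ⟧ + ⟦ i ≡ᵇ suc j ⟧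

  count : ∀ {n} → (Fin n → Bool) → ℕ
  count p = sum λ b → ⟦ p b ⟧

  size : ∀ {n} → (Fin n → ℕ) → ℕ → ℕ
  size lay ℓ = count λ b → ℓ ≡ᵇ lay b

  -- For layer sizes a, this is one more than the degree of a vertex of layer i + 1 in that graph.
  -- Numbering by the predecessor i avoids subtraction.
  around : (ℕ → ℕ) → ℕ → ℕ
  around a i = a (suc i) + a (suc (suc i)) + a i

  -- Marks the layers on which the sum of a test vector may be nonzero. Layers above T are empty, so
  -- their sums vanish like those in `Z`.
  free : ℕ → List ℕ → ℕ → ℕ
  free T Z ℓ = if does (_∈?_ ℕ._≟_ ℓ Z ⊎-dec (T ℕ.<? ℓ)) then 0 else 1

  -- Z is a list of layers on which test vectors sum to zero.
  Suitable : ℕ → ℕ → (ℕ → ℕ) → List ℕ → Set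
  Suitable T c a Z = ∀ i → i < T →
    (suc i ∈ Z × around a i ≤ suc c) ⊎
    (suc i ∉ Z × a (suc i) ≡ 1 × around a i + free T Z (suc (suc i)) ≤ c)

  ≡ᵇ-true : ∀ {i j} → i ≡ j → (i ≡ᵇ j) ≡ true
  ≡ᵇ-true {zero}  refl = refl
  ≡ᵇ-true {suc i} refl = ≡ᵇ-true {i} refl

  ≡ᵇ-false : ∀ {i j} → i ≢ j → (i ≡ᵇ j) ≡ false
  ≡ᵇ-false {zero}  {zero}  h = ⊥-elim (h refl)
  ≡ᵇ-false {zero}  {suc j} h = refl
  ≡ᵇ-false {suc i} {zero}  h = refl
  ≡ᵇ-false {suc i} {suc j} h = ≡ᵇ-false {i} (h ∘ cong suc)

  ≡ᵇ-sym : ∀ i j → (i ≡ᵇ j) ≡ (j ≡ᵇ i)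
  ≡ᵇ-sym zero    zero    = refl
  ≡ᵇ-sym zero    (suc j) = refl
  ≡ᵇ-sym (suc i) zero    = refl
  ≡ᵇ-sym (suc i) (suc j) = ≡ᵇ-sym i j

-- Quadratic forms of weights, and the discrete Poincaré inequality.

module QuadraticForm (R : CommutativeRing 0ℓ 0ℓ) (C : PositiveCone R) where
  open CommutativeRing R hiding (zero) renaming (Carrier to K)
  open Ordered R C
  open Layering using (⟦_⟧)
  open Sums R
  open InnerProduct R
  open IntegerSolver R using (solve; con; _:=_; _:+_; _:*_; :-_; _:-_)
  open import Algebra.Properties.Semiring.Mult semiring
    using (×-homo-+) renaming (_×_ to _×#_)
  open import Algebra.Properties.Ring ring using (-‿+-comm)
  open import Data.Bool.Base using (true; false; if_then_else_)
  open import Data.Empty using (⊥-elim)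
  open import Data.Fin.Base using (Fin; zero; suc)
  import Data.Fin.Properties as Fin
  open import Data.Integer.Base using (+_)
  open import Data.Nat.Base as ℕ using (ℕ; zero; suc; _≤_; _<_)
  import Data.Nat.Properties as ℕ
  open import Data.Product.Base using (_×_; _,_)
  open import Function.Base using (_∘_)
  open import Relation.Binary.PropositionalEquality as ≡ using (_≡_; _≢_)
  open import Relation.Binary.Reasoning.Setoid setoid
  open import Relation.Nullary.Decidable.Core using (yes; no; does)
  import Algebra.Definitions.RawMonoid ℕ.+-0-rawMonoid as ℕΣ

  ι : ℕ → K
  ι k = k ×# 1#

  ι-+ : ∀ m n → ι (m ℕ.+ n) ≈ ι m + ι n
  ι-+ = ×-homo-+ 1#

  ι-mono : ∀ {m n} → m ≤ n → Nonneg (ι n - ι m)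
  ι-mono {m} {n} m≤n = Nonneg-resp (begin
    ι (n ℕ.∸ m)                  ≈⟨ solve 2 (λ a b → a := (b :+ a) :- b) refl (ι (n ℕ.∸ m)) (ι m) ⟩
    (ι m + ι (n ℕ.∸ m)) - ι m    ≈⟨ +-congʳ (ι-+ m (n ℕ.∸ m)) ⟨
    ι (m ℕ.+ (n ℕ.∸ m)) - ι m    ≡⟨ ≡.cong (λ k → ι k - ι m) (ℕ.m+[n∸m]≡n m≤n) ⟩
    ι n - ι m                    ∎) (Nonneg-× (n ℕ.∸ m))

  ι-sum : ∀ {n} (f : Fin n → ℕ) → ι (ℕΣ.sum f) ≈ sum (λ i → ι (f i))
  ι-sum {zero}  f = sym sum-[]
  ι-sum {suc n} f = trans (ι-+ (f zero) _) (trans (+-congˡ (ι-sum (f ∘ suc))) (sym sum-∷))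

  Nonneg-half : ∀ {x} → Nonneg (x + x) → Nonneg x
  Nonneg-half {x} h p = h (Pos-resp (-‿+-comm x x) (Pos-+ p p))

  -- For an adjacency matrix W this is the form of the signless Laplacian. A diagonal weight enters
  -- twice, with x a x a from both terms.
  form : ∀ {n} → (Fin n → Fin n → K) → (Fin n → K) → K
  form W x = sum λ a → sum λ b → W a b * (x a * x a + x a * x b)

  form-- : ∀ {n} (V W : Fin n → Fin n → K) x → form (λ a b → V a b - W a b) x ≈ form V x - form W x
  form-- V W x = trans (sum-cong λ a → trans (sum-cong λ b →
    solve 3 (λ v w y → (v :- w) :* y := v :* y :- w :* y) refl (V a b) (W a b) (x a * x a + x a * x b))
    sum--) sum--

  -- Twice the form is ΣΣ Wₐᵦ (xₐ + xᵦ)².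
  form-Nonneg : ∀ {n} {W : Fin n → Fin n → K} → (∀ a b → W a b ≈ W b a) → (∀ a b → Nonneg (W a b)) →
    ∀ x → Nonneg (form W x)
  form-Nonneg {n} {W} W-sym W≥0 x = Nonneg-half (Nonneg-resp (sym twice)
    (Nonneg-sum λ a → Nonneg-sum λ b → Nonneg-* (W≥0 a b) (Nonneg-square (x a + x b))))
    where
    twice : form W x + form W x ≈ sum (λ a → sum λ b → W a b * ((x a + x b) * (x a + x b)))
    twice = begin
      form W x + form W x
        ≈⟨ +-congˡ sum-comm ⟩
      form W x + sum (λ b → sum λ a → W a b * (x a * x a + x a * x b))
        ≈⟨ sum-+ ⟨
      sum (λ a → sum (λ b → W a b * (x a * x a + x a * x b)) + sum (λ b → W b a * (x b * x b + x b * x a)))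
        ≈⟨ sum-cong (λ a → sum-+) ⟨
      sum (λ a → sum λ b → W a b * (x a * x a + x a * x b) + W b a * (x b * x b + x b * x a))
        ≈⟨ sum-cong (λ a → sum-cong λ b → trans (+-congˡ (*-congʳ (W-sym b a)))
             (solve 3 (λ w x y → w :* (x :* x :+ x :* y) :+ w :* (y :* y :+ y :* x) :=
                w :* ((x :+ y) :* (x :+ y))) refl (W a b) (x a) (x b))) ⟩
      sum (λ a → sum λ b → W a b * ((x a + x b) * (x a + x b))) ∎

  form-degree : ∀ {n} (W : Fin n → Fin n → K) x →
    form W x ≈ sum (λ a → x a * x a * sum (W a)) + sum (λ a → x a * sum (λ b → W a b * x b))
  form-degree W x = begin
    sum (λ a → sum λ b → W a b * (x a * x a + x a * x b))
      ≈⟨ sum-cong (λ a → sum-cong λ b → solve 3 (λ w x y → w :* (x :* x :+ x :* y) :=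
           x :* x :* w :+ x :* (w :* y)) refl (W a b) (x a) (x b)) ⟩
    sum (λ a → sum λ b → x a * x a * W a b + x a * (W a b * x b))
      ≈⟨ sum-cong (λ a → trans sum-+ (sym (+-cong sum-*ˡ sum-*ˡ))) ⟩
    sum (λ a → x a * x a * sum (W a) + x a * sum (λ b → W a b * x b))
      ≈⟨ sum-+ ⟩
    sum (λ a → x a * x a * sum (W a)) + sum (λ a → x a * sum (λ b → W a b * x b)) ∎

  identity : ∀ {n} → Fin n → Fin n → ℕ
  identity a b = ⟦ does (a Fin.≟ b) ⟧

  sum-identity : ∀ {n} (f : Fin n → K) a → sum (λ b → ι (identity a b) * f b) ≈ f a
  sum-identity f a = trans (sum-single a off) (trans (*-congʳ at) (*-identityˡ (f a)))
    where
    off : ∀ b → b ≢ a → ι (identity a b) * f b ≈ 0#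
    off b b≢a with a Fin.≟ b
    ... | yes a≡b = ⊥-elim (b≢a (≡.sym a≡b))
    ... | no  _   = zeroˡ (f b)
    at : ι (identity a a) ≈ 1#
    at with a Fin.≟ a
    ... | yes _  = +-identityʳ 1#
    ... | no a≢a = ⊥-elim (a≢a ≡.refl)

  signless : ∀ {n} → (Fin n → Fin n → ℕ) → Fin n → Fin n → ℕ
  signless A a b = (if does (a Fin.≟ b) then ℕΣ.sum (A a) else 0) ℕ.+ A a b

  module _ {n : ℕ} (A : Fin n → Fin n → ℕ) where
    Â : Fin n → Fin n → K
    Â a b = ι (A a b)

    signless-form : ∀ x → ⟪ x , apply (λ a b → ι (signless A a b)) x ⟫ ≈ form Â x
    signless-form x = begin
      sum (λ a → x a * sum λ b → ι (signless A a b) * x b)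
        ≈⟨ sum-cong (λ a → *-congˡ (row a)) ⟩
      sum (λ a → x a * (sum (Â a) * x a + sum (λ b → Â a b * x b)))
        ≈⟨ sum-cong (λ a → solve 3 (λ x d s → x :* (d :* x :+ s) := x :* x :* d :+ x :* s) refl
             (x a) (sum (Â a)) (sum (λ b → Â a b * x b))) ⟩
      sum (λ a → x a * x a * sum (Â a) + x a * sum (λ b → Â a b * x b))
        ≈⟨ sum-+ ⟩
      sum (λ a → x a * x a * sum (Â a)) + sum (λ a → x a * sum (λ b → Â a b * x b))
        ≈⟨ form-degree Â x ⟨
      form Â x ∎
      where
      diagonal : ∀ a b → ι (if does (a Fin.≟ b) then ℕΣ.sum (A a) else 0) ≈ ι (identity a b) * sum (Â a)
      diagonal a b with does (a Fin.≟ b)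
      ... | true  = trans (ι-sum (A a)) (sym (trans (*-congʳ (+-identityʳ 1#)) (*-identityˡ _)))
      ... | false = sym (zeroˡ _)
      row : ∀ a → sum (λ b → ι (signless A a b) * x b) ≈ sum (Â a) * x a + sum (λ b → Â a b * x b)
      row a = begin
        sum (λ b → ι (signless A a b) * x b)
          ≈⟨ sum-cong (λ b → trans (*-congʳ (trans (ι-+ (if does (a Fin.≟ b) then ℕΣ.sum (A a) else 0) (A a b)) (+-congʳ (diagonal a b))))
               (solve 4 (λ i d w x → (i :* d :+ w) :* x := i :* (d :* x) :+ w :* x) refl
                 (ι (identity a b)) (sum (Â a)) (Â a b) (x b))) ⟩
        sum (λ b → ι (identity a b) * (sum (Â a) * x b) + Â a b * x b)
          ≈⟨ sum-+ ⟩
        sum (λ b → ι (identity a b) * (sum (Â a) * x b)) + sum (λ b → Â a b * x b)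
          ≈⟨ +-congʳ (sum-identity (λ b → sum (Â a) * x b) a) ⟩
        sum (Â a) * x a + sum (λ b → Â a b * x b) ∎

    signless-Nonneg : (∀ a b → A a b ≡ A b a) → ∀ x → Nonneg ⟪ x , apply (λ a b → ι (signless A a b)) x ⟫
    signless-Nonneg A-sym x = Nonneg-resp (sym (signless-form x))
      (form-Nonneg (λ a b → reflexive (≡.cong ι (A-sym a b))) (λ a b → Nonneg-× (A a b)) x)

    -- The weights M - A - I are nonnegative, hence so is their form. The identity contributes 2
    -- |x|² to it, which is the source of the 2 in c + 2.
    signless-bound : (∀ a b → A a b ≡ A b a) → (M : Fin n → Fin n → ℕ) → (∀ a b → M a b ≡ M b a) →
      (∀ a b → A a b ℕ.+ identity a b ≤ M a b) → ∀ x →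
      Nonneg (form (λ a b → ι (M a b)) x - (1# + 1#) * ⟪ x , x ⟫ - ⟪ x , apply (λ a b → ι (signless A a b)) x ⟫)
    signless-bound A-sym M M-sym A≤M x = Nonneg-resp (begin
      form (λ a b → ι (M a b) - (ι (identity a b) + Â a b)) x
        ≈⟨ form-- _ _ x ⟩
      form M̂ x - form (λ a b → ι (identity a b) + Â a b) x
        ≈⟨ +-congˡ (-‿cong (trans (sum-cong λ a → trans (sum-cong λ b → distribʳ _ _ _) sum-+) sum-+)) ⟩
      form M̂ x - (form (λ a b → ι (identity a b)) x + form Â x)
        ≈⟨ +-congˡ (-‿cong (+-cong identity-form (sym (signless-form x)))) ⟩
      form M̂ x - ((1# + 1#) * ⟪ x , x ⟫ + Qx)
        ≈⟨ solve 3 (λ f i q → f :- (i :+ q) := f :- i :- q) refl (form M̂ x) ((1# + 1#) * ⟪ x , x ⟫) Qx ⟩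
      form M̂ x - (1# + 1#) * ⟪ x , x ⟫ - Qx ∎)
      (form-Nonneg D-sym D≥0 x)
      where
      Qx = ⟪ x , apply (λ a b → ι (signless A a b)) x ⟫
      M̂ : Fin n → Fin n → K
      M̂ a b = ι (M a b)
      identity-sym : ∀ a b → identity {n} a b ≡ identity b a
      identity-sym a b with a Fin.≟ b | b Fin.≟ a
      ... | yes _   | yes _   = ≡.refl
      ... | no _    | no _    = ≡.refl
      ... | yes a≡b | no b≢a  = ⊥-elim (b≢a (≡.sym a≡b))
      ... | no a≢b  | yes b≡a = ⊥-elim (a≢b (≡.sym b≡a))
      D-sym : ∀ a b → ι (M a b) - (ι (identity a b) + Â a b) ≈ ι (M b a) - (ι (identity b a) + Â b a)
      D-sym a b = +-cong (reflexive (≡.cong ι (M-sym a b))) (-‿cong (+-cong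
        (reflexive (≡.cong ι (identity-sym a b))) (reflexive (≡.cong ι (A-sym a b)))))
      D≥0 : ∀ a b → Nonneg (ι (M a b) - (ι (identity a b) + Â a b))
      D≥0 a b = Nonneg-resp (+-congˡ (-‿cong (trans (ι-+ (A a b) (identity a b)) (+-comm _ _))))
        (ι-mono (A≤M a b))
      identity-form : form (λ a b → ι (identity a b)) x ≈ (1# + 1#) * ⟪ x , x ⟫
      identity-form = trans (sum-cong λ a → trans (sum-identity (λ b → x a * x a + x a * x b) a)
        (solve 1 (λ y → y :+ y := (con (+ 1) :+ con (+ 1)) :* y) refl (x a * x a))) (sym sum-*ˡ)

  range-sum : ℕ → (ℕ → K) → K
  range-sum zero    f = 0#
  range-sum (suc t) f = range-sum t f + f t

  range-sum-cong : ∀ {f g} t → (∀ i → i < t → f i ≈ g i) → range-sum t f ≈ range-sum t g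
  range-sum-cong zero    h = refl
  range-sum-cong (suc t) h =
    +-cong (range-sum-cong t λ i i<t → h i (ℕ.m<n⇒m<1+n i<t)) (h t (ℕ.n<1+n t))

  range-sum-Nonneg : ∀ {f} t → (∀ i → i < t → Nonneg (f i)) → Nonneg (range-sum t f)
  range-sum-Nonneg zero    h = Nonneg-0
  range-sum-Nonneg (suc t) h =
    Nonneg-+ (range-sum-Nonneg t λ i i<t → h i (ℕ.m<n⇒m<1+n i<t)) (h t (ℕ.n<1+n t))

  range-sum-linear : ∀ {f g} α β t →
    range-sum t (λ i → α * f i + β * g i) ≈ α * range-sum t f + β * range-sum t g
  range-sum-linear α β zero = sym (trans (+-cong (zeroʳ α) (zeroʳ β)) (+-identityˡ 0#))
  range-sum-linear {f} {g} α β (suc t) = trans (+-congʳ (range-sum-linear α β t))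
    (solve 6 (λ α β p q x y → (α :* p :+ β :* q) :+ (α :* x :+ β :* y) := α :* (p :+ x) :+ β :* (q :+ y))
      refl α β (range-sum t f) (range-sum t g) (f t) (g t))

  sum-range : ∀ {n} (f : Fin n → ℕ → K) t →
    sum (λ a → range-sum t (f a)) ≈ range-sum t (λ i → sum (λ a → f a i))
  sum-range f zero    = sum-zero λ _ → refl
  sum-range f (suc t) = trans sum-+ (+-congʳ (sum-range f t))

  -- g marks the layers on which the layer sum s is not required to vanish.
  module Layers (T c : ℕ) (A g : ℕ → ℕ) where

    -- Abstracts from vectors to sequences: s and q are the layer sums of x and of its squares, and
    -- q = s² is what remains of a free layer being a single vertex.
    Admissible : (s q : ℕ → K) → Set
    Admissible s q = ∀ i → i < T →
      (g (suc i) ≡ 0 × s (suc i) ≈ 0# × A i ≤ suc c) ⊎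
      (g (suc i) ≡ 1 × q (suc i) ≈ s (suc i) * s (suc i) × A i ℕ.+ g (suc (suc i)) ≤ c)

    -- `growth t` bounds s² and q on layer t by the energy `E` of the layers up to t. Its recurrence
    -- comes from s² ≤ 2 (s - s₋)² + 2 s₋², and `total` adds up the bounds for q.
    growth total : ℕ → ℕ
    growth zero    = 0
    growth (suc t) = 2 ℕ.+ (growth t ℕ.+ growth t)
    total zero    = 0
    total (suc t) = total t ℕ.+ growth (suc t)

    module Poincaré (s q : ℕ → K) (q≥0 : ∀ i → Nonneg (q i)) (admissible : Admissible s q)
      (s₀ : s 0 ≈ 0#) (s-end : s (suc T) ≈ 0#) (g-end : g (suc T) ≡ 0) where

      -- X is E + Y, up to a telescoping sum.
      X E Y : ℕ → K
      X i = (ι c + (1# + 1#) - ι (A i)) * q (suc i) - s (suc i) * (s (suc i) + s (suc (suc i)) + s i)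
      E i = (1# - ι (g (suc i))) * q (suc i) + ι (g (suc i)) * ((s (suc i) - s i) * (s (suc i) - s i))
      Y i = (ι c + 1# + ι (g (suc i)) - ι (A i)) * q (suc i) -
            (1# + ι (g (suc i)) + ι (g (suc (suc i)))) * (s (suc i) * s (suc i))

      -- Shifts cross terms and squares from one layer to the next, so that `E i` needs only the
      -- difference with the preceding layer. It vanishes at both ends, where s is zero and nothing
      -- is free.
      boundary : ℕ → K
      boundary i = ι (g (suc i)) * (s i * s i) - s i * s (suc i)

      gs : ∀ i → i < T → ι (g (suc i)) * s (suc i) ≈ s (suc i)
      gs i i<T with admissible i i<T
      ... | inj₁ (_ , s≈0 , _) = trans (*-congˡ s≈0) (trans (zeroʳ _) (sym s≈0))
      ... | inj₂ (g≡1 , _)     =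
        trans (*-congʳ (trans (reflexive (≡.cong ι g≡1)) (+-identityʳ 1#))) (*-identityˡ _)

      X-step : ∀ i → i < T → X i ≈ (E i + Y i) + (boundary (suc i) - boundary i)
      X-step i i<T = begin
        X i
          -- The identity holds up to a multiple of g s′ - s′, which vanishes by `gs`: where g is 0,
          -- the layer sum is 0 as well.
          ≈⟨ solve 8 (λ c a q s s′ s″ g g′ →
               (c :+ (con (+ 1) :+ con (+ 1)) :- a) :* q :- s′ :* (s′ :+ s″ :+ s) :=
               (((con (+ 1) :- g) :* q :+ g :* ((s′ :- s) :* (s′ :- s))) :+
                ((c :+ con (+ 1) :+ g :- a) :* q :- (con (+ 1) :+ g :+ g′) :* (s′ :* s′))) :+
               ((g′ :* (s′ :* s′) :- s′ :* s″) :- (g :* (s :* s) :- s :* s′)) :+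
               con (+ 2) :* s :* (g :* s′ :- s′))
               refl (ι c) (ι (A i)) (q (suc i)) (s i) (s (suc i)) (s (suc (suc i)))
               (ι (g (suc i))) (ι (g (suc (suc i)))) ⟩
        (E i + Y i) + (boundary (suc i) - boundary i) + (1# + 1#) * s i * (ι (g (suc i)) * s (suc i) - s (suc i))
          ≈⟨ +-congˡ (trans (*-congˡ (trans (+-congʳ (gs i i<T)) (-‿inverseʳ _))) (zeroʳ _)) ⟩
        (E i + Y i) + (boundary (suc i) - boundary i) + 0#
          ≈⟨ +-identityʳ _ ⟩
        (E i + Y i) + (boundary (suc i) - boundary i) ∎

      X-sum : ∀ t → t ≤ T → range-sum t X ≈ range-sum t E + range-sum t Y + boundary t
      X-sum zero _ = sym (trans (+-cong (+-identityˡ 0#) (begin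
        ι (g 1) * (s 0 * s 0) - s 0 * s 1   ≈⟨ +-cong (*-congˡ (*-cong s₀ s₀)) (-‿cong (*-congʳ s₀)) ⟩
        ι (g 1) * (0# * 0#) - 0# * s 1      ≈⟨ solve 2 (λ a b → a :* (con (+ 0) :* con (+ 0)) :- con (+ 0) :* b := con (+ 0)) refl (ι (g 1)) (s 1) ⟩
        0#                                  ∎)) (+-identityˡ 0#))
      X-sum (suc t) t<T = trans (+-cong (X-sum t (ℕ.<⇒≤ t<T)) (X-step t t<T))
        (solve 6 (λ a b v x y w → (a :+ b :+ v) :+ ((x :+ y) :+ (w :- v)) := (a :+ x) :+ (b :+ y) :+ w) refl
          (range-sum t E) (range-sum t Y) (boundary t) (E t) (Y t) (boundary (suc t)))

      boundary-end : boundary T ≈ 0#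
      boundary-end = trans (+-cong (*-congʳ (reflexive (≡.cong ι g-end))) (-‿cong (*-congˡ s-end)))
        (solve 2 (λ a b → con (+ 0) :* a :- b :* con (+ 0) := con (+ 0)) refl (s T * s T) (s T))

      -- What is left after removing `E`: (c + 1 - A) q on a layer with vanishing sum, and (c - A -
      -- g′) s² on a free one, where g′ belongs to the next layer. These are the two inequalities of
      -- `Admissible`.
      Y≥0 : ∀ i → i < T → Nonneg (Y i)
      Y≥0 i i<T with admissible i i<T
      ... | inj₁ (g≡0 , s≈0 , A≤1+c) = Nonneg-resp (begin
        (ι (suc c) - ι (A i)) * q (suc i)
          ≈⟨ solve 4 (λ c a q g → (con (+ 1) :+ c :- a) :* q :=
               (c :+ con (+ 1) :+ con (+ 0) :- a) :* q :- (con (+ 1) :+ con (+ 0) :+ g) :* (con (+ 0) :* con (+ 0)))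
               refl (ι c) (ι (A i)) (q (suc i)) (ι (g (suc (suc i)))) ⟩
        (ι c + 1# + 0# - ι (A i)) * q (suc i) - (1# + 0# + ι (g (suc (suc i)))) * (0# * 0#)
          ≈⟨ +-cong (*-congʳ (+-congʳ (+-congˡ ιg))) (-‿cong (*-cong (+-congʳ (+-congˡ ιg)) (*-cong (sym s≈0) (sym s≈0)))) ⟩
        Y i ∎) (Nonneg-* (ι-mono A≤1+c) (q≥0 (suc i)))
        where
        ιg : 0# ≈ ι (g (suc i))
        ιg = reflexive (≡.cong ι (≡.sym g≡0))
      ... | inj₂ (g≡1 , q≈s² , A+g≤c) = Nonneg-resp (begin
        (ι c - ι (A i ℕ.+ g (suc (suc i)))) * (s (suc i) * s (suc i))
          ≈⟨ *-congʳ (+-congˡ (-‿cong (ι-+ (A i) (g (suc (suc i)))))) ⟩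
        (ι c - (ι (A i) + ι (g (suc (suc i))))) * (s (suc i) * s (suc i))
          ≈⟨ solve 4 (λ c a q g → (c :- (a :+ g)) :* q :=
               (c :+ con (+ 1) :+ con (+ 1) :- a) :* q :- (con (+ 1) :+ con (+ 1) :+ g) :* q)
               refl (ι c) (ι (A i)) (s (suc i) * s (suc i)) (ι (g (suc (suc i)))) ⟩
        (ι c + 1# + 1# - ι (A i)) * (s (suc i) * s (suc i)) - (1# + 1# + ι (g (suc (suc i)))) * (s (suc i) * s (suc i))
          ≈⟨ +-cong (*-cong (+-congʳ (+-congˡ ιg)) (sym q≈s²)) (-‿cong (*-congʳ (+-congʳ (+-congˡ ιg)))) ⟩
        Y i ∎) (Nonneg-* (ι-mono A+g≤c) (Nonneg-square (s (suc i))))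
        where
        ιg : 1# ≈ ι (g (suc i))
        ιg = trans (sym (+-identityʳ 1#)) (reflexive (≡.cong ι (≡.sym g≡1)))

      E-bad : ∀ i → g (suc i) ≡ 0 → E i ≈ q (suc i)
      E-bad i g≡0 = trans (+-cong (*-congʳ (+-congˡ (-‿cong (reflexive (≡.cong ι g≡0)))))
        (*-congʳ (reflexive (≡.cong ι g≡0)))) (solve 2 (λ q d →
          (con (+ 1) :- con (+ 0)) :* q :+ con (+ 0) :* d := q) refl (q (suc i)) _)

      E-good : ∀ i → g (suc i) ≡ 1 → E i ≈ (s (suc i) - s i) * (s (suc i) - s i)
      E-good i g≡1 = trans (+-cong (*-congʳ (+-congˡ (-‿cong ιg))) (*-congʳ ιg))
        (solve 2 (λ q d → (con (+ 1) :- con (+ 1)) :* q :+ con (+ 1) :* d := d) refl (q (suc i)) _)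
        where
        ιg : ι (g (suc i)) ≈ 1#
        ιg = trans (reflexive (≡.cong ι g≡1)) (+-identityʳ 1#)

      E≥0 : ∀ i → i < T → Nonneg (E i)
      E≥0 i i<T with admissible i i<T
      ... | inj₁ (g≡0 , _) = Nonneg-resp (sym (E-bad i g≡0)) (q≥0 (suc i))
      ... | inj₂ (g≡1 , _) = Nonneg-resp (sym (E-good i g≡1)) (Nonneg-square _)

      P : ℕ → K
      P t = range-sum t E

      P≥0 : ∀ t → t ≤ T → Nonneg (P t)
      P≥0 t t≤T = range-sum-Nonneg t λ i i<t → E≥0 i (ℕ.<-≤-trans i<t t≤T)

      -- s² ≤ 2 (s - s₋)² + 2 s₋²
      s²-bound : ∀ t → t ≤ T → Nonneg (ι (growth t) * P t - s t * s t)
      q-bound  : ∀ t → t < T → Nonneg (ι (growth (suc t)) * P (suc t) - q (suc t))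

      s²-bound zero _ = Nonneg-resp (sym (trans (+-congˡ (-‿cong (*-cong s₀ s₀)))
        (solve 0 (con (+ 0) :* con (+ 0) :- con (+ 0) :* con (+ 0) := con (+ 0)) refl))) Nonneg-0
      s²-bound (suc t) t<T with admissible t t<T
      ... | inj₁ (_ , s≈0 , _) = Nonneg-resp (sym (trans (+-congˡ (-‿cong (*-cong s≈0 s≈0)))
        (solve 1 (λ p → p :- con (+ 0) :* con (+ 0) := p) refl _)))
        (Nonneg-* (Nonneg-× (growth (suc t))) (P≥0 (suc t) t<T))
      ... | inj₂ (_ , q≈s² , _) = Nonneg-resp (+-congˡ (-‿cong q≈s²)) (q-bound t t<T)

      q-bound t t<T with admissible t t<T
      ... | inj₁ (g≡0 , s≈0 , _) = Nonneg-resp (begin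
        (1# * P t + ι (growth t ℕ.+ growth t) * P (suc t)) + (P (suc t) + (E t - q (suc t)))
          ≈⟨ solve 4 (λ p e γ q → (con (+ 1) :* p :+ γ :* (p :+ e)) :+ ((p :+ e) :+ (e :- q)) :=
               (con (+ 1) :+ (con (+ 1) :+ γ)) :* (p :+ e) :- q) refl
               (P t) (E t) (ι (growth t ℕ.+ growth t)) (q (suc t)) ⟩
        ι (growth (suc t)) * P (suc t) - q (suc t) ∎)
        (Nonneg-+ (Nonneg-+ (Nonneg-* (Pos⇒Nonneg Pos-1) (P≥0 t (ℕ.<⇒≤ t<T)))
          (Nonneg-* (Nonneg-× (growth t ℕ.+ growth t)) (P≥0 (suc t) t<T)))
          (Nonneg-+ (P≥0 (suc t) t<T) (Nonneg-resp (sym (trans (+-congʳ (E-bad t g≡0)) (-‿inverseʳ _))) Nonneg-0)))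
      ... | inj₂ (g≡1 , q≈s² , _) = Nonneg-resp (begin
        -- The square is the slack 2 (s′ - s₋)² + 2 s₋² - s′² = (s′ - 2 s₋)² of the estimate.
        ((s′ - s₋ - s₋) * (s′ - s₋ - s₋) + (1# + 1#) * (γ * P t - s₋ * s₋)) + ((1# + 1#) * P t + (γ + γ) * E t)
          ≈⟨ solve 5 (λ s r γ p e → ((s :- r :- r) :* (s :- r :- r) :+ con (+ 2) :* (γ :* p :- r :* r)) :+
                 (con (+ 2) :* p :+ (γ :+ γ) :* e) :=
               (con (+ 1) :+ (con (+ 1) :+ (γ :+ γ))) :* (p :+ e) :- s :* s :+
                 con (+ 2) :* ((s :- r) :* (s :- r) :- e)) refl s′ s₋ γ (P t) (E t) ⟩
        (1# + (1# + (γ + γ))) * P (suc t) - s′ * s′ + (1# + 1#) * ((s′ - s₋) * (s′ - s₋) - E t)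
          ≈⟨ +-cong (+-cong (*-congʳ (+-congˡ (+-congˡ (sym (ι-+ (growth t) (growth t)))))) (-‿cong (sym q≈s²)))
               (trans (*-congˡ (trans (+-congˡ (-‿cong (E-good t g≡1))) (-‿inverseʳ _))) (zeroʳ _)) ⟩
        ι (growth (suc t)) * P (suc t) - q (suc t) + 0#
          ≈⟨ +-identityʳ _ ⟩
        ι (growth (suc t)) * P (suc t) - q (suc t) ∎)
        (Nonneg-+ (Nonneg-+ (Nonneg-square _) (Nonneg-* 2≥0 (s²-bound t (ℕ.<⇒≤ t<T))))
          (Nonneg-+ (Nonneg-* 2≥0 (P≥0 t (ℕ.<⇒≤ t<T)))
            (Nonneg-* (Nonneg-+ (Nonneg-× (growth t)) (Nonneg-× (growth t))) (E≥0 t t<T))))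
        where
        s′ = s (suc t)
        s₋ = s t
        γ = ι (growth t)
        2≥0 : Nonneg (1# + 1#)
        2≥0 = Nonneg-+ (Pos⇒Nonneg Pos-1) (Pos⇒Nonneg Pos-1)

      q-total : ∀ t → t ≤ T → Nonneg (ι (total t) * P t - range-sum t (q ∘ suc))
      q-total zero _ = Nonneg-resp (sym (solve 0 (con (+ 0) :* con (+ 0) :- con (+ 0) := con (+ 0)) refl)) Nonneg-0
      q-total (suc t) t<T = Nonneg-resp (begin
        (ι (total t) * P t - range-sum t (q ∘ suc)) + (ι (growth (suc t)) * P (suc t) - q (suc t)) + ι (total t) * E t
          ≈⟨ solve 6 (λ a p r b e q → (a :* p :- r) :+ (b :* (p :+ e) :- q) :+ a :* e :=
               (a :+ b) :* (p :+ e) :- (r :+ q)) refl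
               (ι (total t)) (P t) (range-sum t (q ∘ suc)) (ι (growth (suc t))) (E t) (q (suc t)) ⟩
        (ι (total t) + ι (growth (suc t))) * P (suc t) - range-sum (suc t) (q ∘ suc)
          ≈⟨ +-congʳ (*-congʳ (ι-+ (total t) (growth (suc t)))) ⟨
        ι (total (suc t)) * P (suc t) - range-sum (suc t) (q ∘ suc) ∎)
        (Nonneg-+ (Nonneg-+ (q-total t (ℕ.<⇒≤ t<T)) (q-bound t t<T)) (Nonneg-* (Nonneg-× (total t)) (E≥0 t t<T)))

      -- The sum of q is at most `total T` times the energy P, and the sum of X is P plus the
      -- nonnegative sum of Y. One further copy of P makes the multiplier a successor, as the
      -- comparison with c - 1/(b + 1) requires.
      X-bound : Nonneg (ι (suc (total T)) * range-sum T X - range-sum T (q ∘ suc))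
      X-bound = Nonneg-resp (begin
        (ι (total T) * P T - range-sum T (q ∘ suc)) + (P T + ι (suc (total T)) * range-sum T Y)
          ≈⟨ solve 4 (λ k p r y → (k :* p :- r) :+ (p :+ (con (+ 1) :+ k) :* y) :=
               (con (+ 1) :+ k) :* (p :+ y) :- r) refl
               (ι (total T)) (P T) (range-sum T (q ∘ suc)) (range-sum T Y) ⟩
        ι (suc (total T)) * (P T + range-sum T Y) - range-sum T (q ∘ suc)
          ≈⟨ +-congʳ (*-congˡ (sym (trans (X-sum T ℕ.≤-refl) (trans (+-congˡ boundary-end) (+-identityʳ _))))) ⟩
        ι (suc (total T)) * range-sum T X - range-sum T (q ∘ suc) ∎)
        (Nonneg-+ (q-total T ℕ.≤-refl) (Nonneg-+ (P≥0 T ℕ.≤-refl)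
          (Nonneg-* (Nonneg-× (suc (total T))) (range-sum-Nonneg T Y≥0))))

-- The form of a layered graph in terms of layer sums.

module LayeredForm (R : CommutativeRing 0ℓ 0ℓ) (C : PositiveCone R) where
  open CommutativeRing R hiding (zero) renaming (Carrier to K)
  open Ordered R C
  open Layering
  open Sums R
  open InnerProduct R
  open QuadraticForm R C
  open IntegerSolver R using (solve; con; _:=_; _:+_; _:*_; :-_; _:-_)
  open import Data.Bool.Base using (Bool; true; false; if_then_else_)
  open import Data.Empty using (⊥-elim)
  open import Data.Fin.Base using (Fin; zero; suc)
  open import Data.Integer.Base using (+_)
  open import Data.List.Base using (length; lookup)
  import Data.List.Membership.Propositional as ∈
  open import Data.List.Membership.DecPropositional using (_∈?_)
  open import Data.List.Relation.Unary.Any using (index)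
  open import Data.List.Relation.Unary.Any.Properties using (lookup-index)
  open import Data.Nat.Base as ℕ using (ℕ; zero; suc; _≡ᵇ_; _≤_; _<_; s≤s)
  import Data.Nat.Properties as ℕ
  open import Data.Product.Base using (_,_)
  open import Function.Base using (_∘_)
  open import Relation.Binary.PropositionalEquality as ≡ using (_≡_; _≢_)
  open import Relation.Binary.Reasoning.Setoid setoid
  open import Relation.Nullary.Decidable using (yes; no; dec-true; dec-false; _⊎-dec_)

  count-0 : ∀ {n} (p : Fin n → Bool) (y : Fin n → K) → count p ≡ 0 → sum (λ b → ι ⟦ p b ⟧ * y b) ≈ 0#
  count-0 {zero}  p y e = sum-[]
  count-0 {suc n} p y e with p zero in eq
  ... | false = trans sum-∷ (trans (+-cong
    (trans (*-congʳ (reflexive (≡.cong (λ b → ι ⟦ b ⟧) eq))) (zeroˡ _)) (count-0 (p ∘ suc) (y ∘ suc) e)) (+-identityˡ _))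

  count-1 : ∀ {n} (p : Fin n → Bool) (x : Fin n → K) → count p ≡ 1 → sum (λ b → ι ⟦ p b ⟧ * (x b * x b)) ≈
    sum (λ b → ι ⟦ p b ⟧ * x b) * sum (λ b → ι ⟦ p b ⟧ * x b)
  count-1 {suc n} p x e with p zero in eq
  ... | true = trans (head (λ b → x b * x b)) (sym (*-cong (head x) (head x)))
    where
    head : ∀ (y : Fin (suc n) → K) → sum (λ b → ι ⟦ p b ⟧ * y b) ≈ y zero
    head y = trans sum-∷ (trans (+-cong
      (trans (*-congʳ (trans (reflexive (≡.cong (λ b → ι ⟦ b ⟧) eq)) (+-identityʳ 1#))) (*-identityˡ _))
      (count-0 (p ∘ suc) (y ∘ suc) (ℕ.suc-injective e))) (+-identityʳ _))
  ... | false = trans (tail (λ b → x b * x b)) (trans (count-1 (p ∘ suc) (x ∘ suc) e) (sym (*-cong (tail x) (tail x))))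
    where
    tail : ∀ (y : Fin (suc n) → K) → sum (λ b → ι ⟦ p b ⟧ * y b) ≈ sum (λ b → ι ⟦ p (suc b) ⟧ * y (suc b))
    tail y = trans sum-∷ (trans (+-congʳ
      (trans (*-congʳ (reflexive (≡.cong (λ b → ι ⟦ b ⟧) eq))) (zeroˡ _))) (+-identityˡ _))

  indicator-≢ : ∀ {i j} y → i ≢ j → ι ⟦ i ≡ᵇ j ⟧ * y ≈ 0#
  indicator-≢ {i} {j} y i≢j = trans (*-congʳ (reflexive (≡.cong (λ b → ι ⟦ b ⟧) (≡ᵇ-false i≢j)))) (zeroˡ y)

  indicator-≡ : ∀ i y → ι ⟦ i ≡ᵇ i ⟧ * y ≈ y
  indicator-≡ i y = trans (*-congʳ (trans (reflexive (≡.cong (λ b → ι ⟦ b ⟧) (≡ᵇ-true {i} ≡.refl))) (+-identityʳ 1#)))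
    (*-identityˡ y)

  range-sum-indicator : ∀ t (h : ℕ → K) ℓ → 1 ≤ ℓ → ℓ ≤ t → range-sum t (λ i → ι ⟦ suc i ≡ᵇ ℓ ⟧ * h (suc i)) ≈ h ℓ
  range-sum-indicator zero    h ℓ 1≤ℓ ℓ≤0 = ⊥-elim (ℕ.<-irrefl ≡.refl (ℕ.≤-trans 1≤ℓ ℓ≤0))
  range-sum-indicator (suc t) h ℓ 1≤ℓ ℓ≤t with ℓ ℕ.≟ suc t
  ... | yes ≡.refl = trans (+-cong (trans (range-sum-cong t λ i i<t →
      indicator-≢ _ (ℕ.<⇒≢ (s≤s i<t))) (zeros t)) (indicator-≡ (suc t) _)) (+-identityˡ _)
    where
    zeros : ∀ t → range-sum t (λ _ → 0#) ≈ 0#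
    zeros zero    = refl
    zeros (suc t) = trans (+-identityʳ _) (zeros t)
  ... | no ℓ≢t = trans (+-cong (range-sum-indicator t h ℓ 1≤ℓ (ℕ.s≤s⁻¹ (ℕ.≤∧≢⇒< ℓ≤t ℓ≢t)))
      (indicator-≢ _ (ℓ≢t ∘ ≡.sym))) (+-identityʳ _)

  module _ {n : ℕ} (lay : Fin n → ℕ) (T : ℕ) (lay≥1 : ∀ a → 1 ≤ lay a) (lay≤T : ∀ a → lay a ≤ T) where

    layerSum : (Fin n → K) → ℕ → K
    layerSum y ℓ = sum λ b → ι ⟦ ℓ ≡ᵇ lay b ⟧ * y b

    square : (Fin n → K) → Fin n → K
    square x a = x a * x a

    by-layers : ∀ y (f : ℕ → K) → sum (λ a → y a * f (lay a)) ≈ range-sum T (λ i → layerSum y (suc i) * f (suc i))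
    by-layers y f = begin
      sum (λ a → y a * f (lay a))
        ≈⟨ sum-cong (λ a → range-sum-indicator T (λ ℓ → y a * f ℓ) (lay a) (lay≥1 a) (lay≤T a)) ⟨
      sum (λ a → range-sum T (λ i → ι ⟦ suc i ≡ᵇ lay a ⟧ * (y a * f (suc i))))
        ≈⟨ sum-range (λ a i → ι ⟦ suc i ≡ᵇ lay a ⟧ * (y a * f (suc i))) T ⟩
      range-sum T (λ i → sum (λ a → ι ⟦ suc i ≡ᵇ lay a ⟧ * (y a * f (suc i))))
        ≈⟨ range-sum-cong T (λ i _ → trans (sum-cong λ a → sym (*-assoc _ _ _)) (sym sum-*ʳ)) ⟩
      range-sum T (λ i → layerSum y (suc i) * f (suc i)) ∎

    near-sum : ∀ (y : Fin n → K) i → sum (λ b → ι (near (suc i) (lay b)) * y b) ≈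
      layerSum y (suc i) + layerSum y (suc (suc i)) + layerSum y i
    near-sum y i = begin
      sum (λ b → ι (near (suc i) (lay b)) * y b)
        ≈⟨ sum-cong (λ b → trans (*-congʳ (trans (ι-+ (⟦ suc i ≡ᵇ lay b ⟧ ℕ.+ ⟦ suc (suc i) ≡ᵇ lay b ⟧) ⟦ i ≡ᵇ lay b ⟧)
             (+-congʳ (ι-+ ⟦ suc i ≡ᵇ lay b ⟧ ⟦ suc (suc i) ≡ᵇ lay b ⟧))))
             (trans (distribʳ _ _ _) (+-congʳ (distribʳ _ _ _)))) ⟩
      sum (λ b → ι ⟦ suc i ≡ᵇ lay b ⟧ * y b + ι ⟦ suc (suc i) ≡ᵇ lay b ⟧ * y b + ι ⟦ i ≡ᵇ lay b ⟧ * y b)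
        ≈⟨ trans sum-+ (+-congʳ sum-+) ⟩
      layerSum y (suc i) + layerSum y (suc (suc i)) + layerSum y i ∎

    layerSum-1 : ∀ ℓ → layerSum (λ _ → 1#) ℓ ≈ ι (size lay ℓ)
    layerSum-1 ℓ = trans (sum-cong λ b → *-identityʳ _) (sym (ι-sum λ b → ⟦ ℓ ≡ᵇ lay b ⟧))

    degree-sum : ∀ i → sum (λ b → ι (near (suc i) (lay b))) ≈ ι (around (size lay) i)
    degree-sum i = begin
      sum (λ b → ι (near (suc i) (lay b)))
        ≈⟨ sum-cong (λ b → sym (*-identityʳ _)) ⟩
      sum (λ b → ι (near (suc i) (lay b)) * 1#)
        ≈⟨ near-sum (λ _ → 1#) i ⟩
      layerSum (λ _ → 1#) (suc i) + layerSum (λ _ → 1#) (suc (suc i)) + layerSum (λ _ → 1#) i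
        ≈⟨ +-cong (+-cong (layerSum-1 (suc i)) (layerSum-1 (suc (suc i)))) (layerSum-1 i) ⟩
      ι (size lay (suc i)) + ι (size lay (suc (suc i))) + ι (size lay i)
        ≈⟨ trans (ι-+ (size lay (suc i) ℕ.+ size lay (suc (suc i))) (size lay i)) (+-congʳ (ι-+ (size lay (suc i)) (size lay (suc (suc i))))) ⟨
      ι (around (size lay) i) ∎

    near-form : ∀ x → form (λ a b → ι (near (lay a) (lay b))) x ≈ range-sum T (λ i →
      layerSum (square x) (suc i) * ι (around (size lay) i) +
      layerSum x (suc i) * (layerSum x (suc i) + layerSum x (suc (suc i)) + layerSum x i))
    near-form x = begin
      form (λ a b → ι (near (lay a) (lay b))) x
        ≈⟨ form-degree _ x ⟩
      sum (λ a → x a * x a * sum (λ b → ι (near (lay a) (lay b)))) + sum (λ a → x a * sum (λ b → ι (near (lay a) (lay b)) * x b))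
        ≈⟨ +-cong (by-layers (square x) (λ ℓ → sum (λ b → ι (near ℓ (lay b)))))
                  (by-layers x (λ ℓ → sum (λ b → ι (near ℓ (lay b)) * x b))) ⟩
      range-sum T (λ i → layerSum (square x) (suc i) * sum (λ b → ι (near (suc i) (lay b)))) +
      range-sum T (λ i → layerSum x (suc i) * sum (λ b → ι (near (suc i) (lay b)) * x b))
        ≈⟨ +-cong (range-sum-cong T λ i _ → *-congˡ (degree-sum i)) (range-sum-cong T λ i _ → *-congˡ (near-sum x i)) ⟩
      range-sum T (λ i → layerSum (square x) (suc i) * ι (around (size lay) i)) + range-sum T (λ i →
        layerSum x (suc i) * (layerSum x (suc i) + layerSum x (suc (suc i)) + layerSum x i))
        ≈⟨ +-cong (*-identityˡ _) (*-identityˡ _) ⟨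
      _
        ≈⟨ range-sum-linear 1# 1# T ⟨
      range-sum T _
        ≈⟨ range-sum-cong T (λ i _ → +-cong (*-identityˡ _) (*-identityˡ _)) ⟩
      range-sum T (λ i → layerSum (square x) (suc i) * ι (around (size lay) i) +
        layerSum x (suc i) * (layerSum x (suc i) + layerSum x (suc (suc i)) + layerSum x i)) ∎

    norm-layers : ∀ x → ⟪ x , x ⟫ ≈ range-sum T (layerSum (square x) ∘ suc)
    norm-layers x = trans (sum-cong λ a → sym (*-identityʳ _)) (trans (by-layers (square x) (λ _ → 1#))
      (range-sum-cong T λ i _ → *-identityʳ _))

    module _ (A : Fin n → Fin n → ℕ) (A-sym : ∀ a b → A a b ≡ A b a)
      (A-near : ∀ a b → A a b ℕ.+ identity a b ≤ near (lay a) (lay b)) where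

      near-sym : ∀ i j → near i j ≡ near j i
      near-sym i j = ≡.trans (ℕ.+-assoc ⟦ i ≡ᵇ j ⟧ ⟦ suc i ≡ᵇ j ⟧ ⟦ i ≡ᵇ suc j ⟧) (≡.trans (≡.cong₂ ℕ._+_ (≡.cong ⟦_⟧ (≡ᵇ-sym i j))
        (≡.trans (ℕ.+-comm ⟦ suc i ≡ᵇ j ⟧ ⟦ i ≡ᵇ suc j ⟧) (≡.cong₂ (λ p q → ⟦ p ⟧ ℕ.+ ⟦ q ⟧) (≡ᵇ-sym i (suc j)) (≡ᵇ-sym (suc i) j))))
        (≡.sym (ℕ.+-assoc ⟦ j ≡ᵇ i ⟧ ⟦ suc j ≡ᵇ i ⟧ ⟦ j ≡ᵇ suc i ⟧)))

      module _ (c : ℕ) where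
        -- This is `X i` of the Poincaré inequality, with the layer sums of x as s and those of its
        -- squares as q.
        excess : (Fin n → K) → ℕ → K
        excess x i = (ι c + (1# + 1#) - ι (around (size lay) i)) * layerSum (square x) (suc i) -
          layerSum x (suc i) * (layerSum x (suc i) + layerSum x (suc (suc i)) + layerSum x i)

        excess-sum : ∀ x → range-sum T (excess x) ≈
          (ι c + (1# + 1#)) * ⟪ x , x ⟫ - form (λ a b → ι (near (lay a) (lay b))) x
        excess-sum x = begin
          range-sum T (excess x)
            ≈⟨ range-sum-cong T (λ i _ → solve 4 (λ c a q r → (c :- a) :* q :- r :=
                 c :* q :+ :- con (+ 1) :* (q :* a :+ r)) refl _ _ _ _) ⟩
          range-sum T (λ i → (ι c + (1# + 1#)) * layerSum (square x) (suc i) + - 1# * (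
            layerSum (square x) (suc i) * ι (around (size lay) i) +
            layerSum x (suc i) * (layerSum x (suc i) + layerSum x (suc (suc i)) + layerSum x i)))
            ≈⟨ range-sum-linear _ _ T ⟩
          _ ≈⟨ +-cong (*-congˡ (sym (norm-layers x))) (trans (*-congˡ (sym (near-form x))) (-1*x≈-x _)) ⟩
          (ι c + (1# + 1#)) * ⟪ x , x ⟫ - form (λ a b → ι (near (lay a) (lay b))) x ∎
          where open import Algebra.Properties.Ring ring using (-1*x≈-x)

        -- Adds `suc b` times `signless-bound`: replacing the complete layered graph by the given
        -- subgraph only enlarges the form of cI - Q.
        bound-from-excess : ∀ x b → Nonneg (ι (suc b) * range-sum T (excess x) - ⟪ x , x ⟫) →
          Nonneg (ι (suc b) * (ι c * ⟪ x , x ⟫ - ⟪ x , apply (λ a b → ι (signless A a b)) x ⟫) - ⟪ x , x ⟫)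
        bound-from-excess x b h = Nonneg-resp (begin
          (ι (suc b) * range-sum T (excess x) - N) + ι (suc b) * (F - (1# + 1#) * N - Qx)
            ≈⟨ +-congʳ (+-congʳ (*-congˡ (excess-sum x))) ⟩
          (ι (suc b) * ((ι c + (1# + 1#)) * N - F) - N) + ι (suc b) * (F - (1# + 1#) * N - Qx)
            ≈⟨ solve 5 (λ k c n f q → (k :* ((c :+ con (+ 2)) :* n :- f) :- n) :+ k :* (f :- con (+ 2) :* n :- q) :=
                 k :* (c :* n :- q) :- n) refl (ι (suc b)) (ι c) N F Qx ⟩
          ι (suc b) * (ι c * N - Qx) - N ∎)
          (Nonneg-+ h (Nonneg-* (Nonneg-× (suc b)) (signless-bound A A-sym _ (λ a b → near-sym (lay a) (lay b)) A-near x)))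
          where
          N = ⟪ x , x ⟫
          F = form (λ a b → ι (near (lay a) (lay b))) x
          Qx = ⟪ x , apply (λ a b → ι (signless A a b)) x ⟫

        layered-bound : ∀ Z → Suitable T c (size lay) Z → ∀ x →
          (∀ (j : Fin (length Z)) → ⟪ (λ b → ι ⟦ lookup Z j ≡ᵇ lay b ⟧) , x ⟫ ≈ 0#) →
          Nonneg (ι (suc (Layers.total T c (around (size lay)) (free T Z) T)) *
            (ι c * ⟪ x , x ⟫ - ⟪ x , apply (λ a b → ι (signless A a b)) x ⟫) - ⟪ x , x ⟫)
        layered-bound Z suitable x zero-on-Z = bound-from-excess x (Layers.total T c (around (size lay)) (free T Z) T)
          (Nonneg-resp (+-congˡ (-‿cong (sym (norm-layers x)))) X-bound)
          where
          open Layers T c (around (size lay)) (free T Z)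
          on-Z : ∀ {ℓ} → ℓ ∈.∈ Z → layerSum x ℓ ≈ 0#
          on-Z {ℓ} ℓ∈Z = trans (sum-cong λ b → *-congʳ (reflexive
            (≡.cong (λ k → ι ⟦ k ≡ᵇ lay b ⟧) (lookup-index ℓ∈Z)))) (zero-on-Z (index ℓ∈Z))
          free-0 : ∀ {ℓ} → ℓ ∈.∈ Z ⊎ T < ℓ → free T Z ℓ ≡ 0
          free-0 {ℓ} h = ≡.cong (λ b → if b then 0 else 1) (dec-true (_∈?_ ℕ._≟_ ℓ Z ⊎-dec (T ℕ.<? ℓ)) h)
          free-1 : ∀ {ℓ} → ℓ ∈.∉ Z → ℓ ≤ T → free T Z ℓ ≡ 1
          free-1 {ℓ} ℓ∉Z ℓ≤T = ≡.cong (λ b → if b then 0 else 1) (dec-false (_∈?_ ℕ._≟_ ℓ Z ⊎-dec (T ℕ.<? ℓ)) λ where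
            (inj₁ ℓ∈Z) → ℓ∉Z ℓ∈Z
            (inj₂ T<ℓ) → ℕ.<⇒≱ T<ℓ ℓ≤T)
          admissible : Admissible (layerSum x) (layerSum (square x))
          admissible i i<T with suitable i i<T
          ... | inj₁ (i∈Z , A≤) = inj₁ (free-0 (inj₁ i∈Z) , on-Z i∈Z , A≤)
          ... | inj₂ (i∉Z , a≡1 , A≤) = inj₂ (free-1 i∉Z i<T , count-1 _ x a≡1 , A≤)
          outside : ∀ ℓ → (∀ b → ℓ ≢ lay b) → layerSum x ℓ ≈ 0#
          outside ℓ h = sum-zero λ b → indicator-≢ (x b) (h b)
          open Poincaré (layerSum x) (layerSum (square x))
            (λ ℓ → Nonneg-sum λ b → Nonneg-* (Nonneg-× ⟦ ℓ ≡ᵇ lay b ⟧) (Nonneg-square (x b))) admissible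
            (outside 0 λ b e → ℕ.<⇒≢ (lay≥1 b) e)
            (outside (suc T) λ b e → ℕ.<⇒≢ (s≤s (lay≤T b)) (≡.sym e))
            (free-0 (inj₂ (ℕ.n<1+n T)))

-- Choosing the layers on which test vectors sum to zero.

module LayerChoice where
  open Layering
  open import Data.Bool.Base using (true; false; if_then_else_)
  open import Data.Empty using (⊥-elim)
  open import Data.List.Base using (List; []; _∷_; _++_; length)
  open import Data.List.Properties using (length-++)
  open import Data.List.Membership.DecPropositional using (_∈?_)
  open import Data.List.Membership.Propositional using (_∈_; _∉_)
  open import Data.List.Membership.Propositional.Properties using (∈-++⁺ˡ; ∈-++⁺ʳ)
  open import Data.List.Relation.Unary.Any using (here; there)
  open import Data.Nat.Base using (ℕ; zero; suc; pred; _+_; _≤_; _<_; s≤s; z≤n; s≤s⁻¹)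
  open import Data.Nat.Properties
  open import Data.Nat.Solver using (module +-*-Solver)
  open import Data.Product.Base using (∃-syntax; _×_; _,_)
  open import Function.Base using (_∘_)
  open import Relation.Binary.Definitions using (tri<; tri≈; tri>)
  open import Relation.Binary.PropositionalEquality using (_≡_; refl; sym; trans; cong; cong₂)
  open import Relation.Nullary.Decidable using (yes; no; does; dec-true; _⊎-dec_)
  open +-*-Solver using (solve; _:=_; _:+_; con)

  Σ< : ℕ → (ℕ → ℕ) → ℕ
  Σ< zero    f = 0
  Σ< (suc N) f = Σ< N f + f N

  Σ<-mono : ∀ {M N} f → M ≤ N → Σ< M f ≤ Σ< N f
  Σ<-mono {zero}  f h = z≤n
  Σ<-mono {suc M} {suc N} f h with M ≟ N
  ... | yes refl = ≤-refl
  ... | no M≢N   = ≤-trans (Σ<-mono f (≤∧≢⇒< (s≤s⁻¹ h) M≢N)) (m≤m+n _ (f N))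

  two-terms : ∀ f {i j N} → i < j → j < N → f i + f j ≤ Σ< N f
  two-terms f {i} {j} i<j j<N = ≤-trans
    (+-monoˡ-≤ (f j) (≤-trans (m≤n+m (f i) (Σ< i f)) (Σ<-mono f i<j))) (Σ<-mono f j<N)

  three-terms : ∀ f {i j k N} → i < j → j < k → k < N → f i + f j + f k ≤ Σ< N f
  three-terms f {k = k} i<j j<k k<N = ≤-trans (+-monoˡ-≤ (f k) (two-terms f i<j j<k)) (Σ<-mono f k<N)

  -- a are the sizes of T layers, whose surplus over one vertex each sums to m.
  module Sizes (T m : ℕ) (a : ℕ → ℕ) (a₀ : a 0 ≡ 0) (a-end : ∀ ℓ → T < ℓ → a ℓ ≡ 0) (a≥1 : ∀ i → i < T → 1 ≤ a (suc i))
    (total : Σ< (suc (suc T)) (pred ∘ a) ≡ m) where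

    b : ℕ → ℕ
    b = pred ∘ a

    b₀ : b 0 ≡ 0
    b₀ = cong pred a₀

    a≤ : ∀ ℓ → a ℓ ≤ suc (b ℓ)
    a≤ ℓ with a ℓ
    ... | zero  = z≤n
    ... | suc _ = ≤-refl

    a≡ : ∀ {i} → i < T → a (suc i) ≡ suc (b (suc i))
    a≡ {i} i<T with a (suc i) | a≥1 i i<T
    ... | suc _ | _ = refl

    around≤ : ∀ {i} → i < T → around a i ≤ 3 + m
    around≤ {i} i<T = begin
      a (suc i) + a (2 + i) + a i
        ≤⟨ +-mono-≤ (+-mono-≤ (a≤ (suc i)) (a≤ (2 + i))) (a≤ i) ⟩
      suc (b (suc i)) + suc (b (2 + i)) + suc (b i)
        ≡⟨ solve 3 (λ x y z → (con 1 :+ x) :+ (con 1 :+ y) :+ (con 1 :+ z) := con 3 :+ (z :+ x :+ y)) refl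
             (b (suc i)) (b (2 + i)) (b i) ⟩
      3 + (b i + b (suc i) + b (2 + i))
        ≤⟨ +-monoʳ-≤ 3 (three-terms b (n<1+n i) (n<1+n (suc i)) (s≤s (s≤s i<T))) ⟩
      3 + Σ< (suc (suc T)) b
        ≡⟨ cong (3 +_) total ⟩
      3 + m ∎
      where open ≤-Reasoning

    free-∈ : ∀ {Z ℓ} → ℓ ∈ Z → free T Z ℓ ≡ 0
    free-∈ {Z} {ℓ} h = cong (λ d → if d then 0 else 1) (dec-true (_∈?_ _≟_ ℓ Z ⊎-dec (T <? ℓ)) (inj₁ h))

    free≤1 : ∀ Z ℓ → free T Z ℓ ≤ 1
    free≤1 Z ℓ with does (_∈?_ _≟_ ℓ Z ⊎-dec (T <? ℓ))
    ... | true  = z≤n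
    ... | false = ≤-refl

    -- A single-vertex layer costs at most 2, one for its vertex and one if it is free. A thick
    -- layer lies in `Z`, so only its size counts.
    above-free : ∀ Z c → (∀ ℓ → 1 ≤ b ℓ → ℓ ∈ Z) → ∀ ℓ → (1 ≤ b ℓ → suc (b ℓ) ≤ c) → 2 ≤ c → a ℓ + free T Z ℓ ≤ c
    above-free Z c B⊆Z ℓ h 2≤c with b ℓ in eq
    ... | zero  = ≤-trans (+-mono-≤ (≤-trans (a≤ ℓ) (≤-reflexive (cong suc eq))) (free≤1 Z ℓ)) 2≤c
    ... | suc k = begin
      a ℓ + free T Z ℓ   ≡⟨ cong (a ℓ +_) (free-∈ (B⊆Z ℓ (≤-trans (s≤s z≤n) (≤-reflexive (sym eq))))) ⟩
      a ℓ + 0            ≡⟨ +-identityʳ _ ⟩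
      a ℓ                ≤⟨ a≤ ℓ ⟩
      suc (b ℓ)          ≡⟨ cong suc eq ⟩
      suc (suc k)        ≤⟨ h (s≤s z≤n) ⟩
      c                  ∎
      where open ≤-Reasoning

    -- Layers of `Z` satisfy their condition because three consecutive sizes add up to at most m +
    -- 3, which is at most c + 1. A layer outside `Z` has one vertex, which explains `pred c` as the
    -- allowance for its two neighbours.
    suitable : ∀ c Z → suc m ≤ pred c → (∀ ℓ → 1 ≤ b ℓ → ℓ ∈ Z) →
      (∀ i → i < T → suc i ∉ Z → a i + (a (2 + i) + free T Z (2 + i)) ≤ pred c) → Suitable T c a Z
    suitable (suc c) Z m≤c B⊆Z h i i<T with _∈?_ _≟_ (suc i) Z
    ... | yes i∈Z = inj₁ (i∈Z , ≤-trans (around≤ i<T) (s≤s (s≤s m≤c)))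
    ... | no i∉Z  = inj₂ (i∉Z , a≡1 , (begin
      a (suc i) + a (2 + i) + a i + free T Z (2 + i)
        ≡⟨ solve 4 (λ x y z w → x :+ y :+ z :+ w := x :+ (z :+ (y :+ w))) refl (a (suc i)) (a (2 + i)) (a i) (free T Z (2 + i)) ⟩
      a (suc i) + (a i + (a (2 + i) + free T Z (2 + i)))
        ≡⟨ cong (_+ (a i + (a (2 + i) + free T Z (2 + i)))) a≡1 ⟩
      suc (a i + (a (2 + i) + free T Z (2 + i)))
        ≤⟨ s≤s (h i i<T i∉Z) ⟩
      suc c ∎))
      where
      open ≤-Reasoning
      a≡1 : a (suc i) ≡ 1
      a≡1 with b (suc i) in eq
      ... | zero  = trans (a≡ i<T) (cong suc eq)
      ... | suc _ = ⊥-elim (i∉Z (B⊆Z (suc i) (≤-trans (s≤s z≤n) (≤-reflexive (sym eq)))))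

    collect : (ℕ → List ℕ) → ℕ → List ℕ
    collect f zero    = []
    collect f (suc N) = f N ++ collect f N

    ∈-collect : ∀ f {N k ℓ} → k < N → ℓ ∈ f k → ℓ ∈ collect f N
    ∈-collect f {suc N} {k} k<N h with k ≟ N
    ... | yes refl = ∈-++⁺ˡ h
    ... | no k≢N   = ∈-++⁺ʳ (f N) (∈-collect f (≤∧≢⇒< (s≤s⁻¹ k<N) k≢N) h)

    length-collect : ∀ f g → (∀ k → length (f k) ≤ g k) → ∀ N → length (collect f N) ≤ Σ< N g
    length-collect f g h zero    = z≤n
    length-collect f g h (suc N) = begin
      length (f N ++ collect f N)            ≡⟨ length-++ (f N) ⟩
      length (f N) + length (collect f N)    ≤⟨ +-mono-≤ (h N) (length-collect f g h N) ⟩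
      g N + Σ< N g                           ≡⟨ +-comm (g N) _ ⟩
      Σ< N g + g N                           ∎
      where open ≤-Reasoning

    thick⇒≤T : ∀ {ℓ} → 1 ≤ b ℓ → ℓ ≤ T
    thick⇒≤T {ℓ} 1≤b = ≮⇒≥ λ T<ℓ → n≮0 (≤-trans 1≤b (≤-reflexive (cong pred (a-end ℓ T<ℓ))))

    thick⇒<N : ∀ {ℓ} → 1 ≤ b ℓ → ℓ < 2 + T
    thick⇒<N 1≤b = s≤s (≤-trans (thick⇒≤T 1≤b) (n≤1+n T))

    only-thick : ℕ → List ℕ
    only-thick ℓ with b ℓ
    ... | zero  = []
    ... | suc _ = ℓ ∷ []

    ∈-only-thick : ∀ ℓ → 1 ≤ b ℓ → ℓ ∈ only-thick ℓ
    ∈-only-thick ℓ 1≤b with b ℓ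
    ... | suc _ = here refl

    length-only-thick : ∀ ℓ → length (only-thick ℓ) ≤ b ℓ
    length-only-thick ℓ with b ℓ
    ... | zero  = z≤n
    ... | suc _ = s≤s z≤n

    thick : List ℕ
    thick = collect only-thick (2 + T)

    ∈-thick : ∀ ℓ → 1 ≤ b ℓ → ℓ ∈ thick
    ∈-thick ℓ 1≤b = ∈-collect only-thick (thick⇒<N 1≤b) (∈-only-thick ℓ 1≤b)

    Choice : ℕ → ℕ → Set
    Choice c r = ∃[ Z ] (Suitable T c a Z × length Z ≤ r)

    -- With all layers of size at most 2, the neighbours of a layer outside `Z` cost at most 2 each,
    -- and 4 ≤ m + 1. The thick layers number at most m.
    choice-thin : 3 ≤ m → ∀ {c} → 2 + m ≤ c → (∀ ℓ → b ℓ ≤ 1) → Choice c (suc m)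
    choice-thin 3≤m {suc c} (s≤s m≤c) b≤1 = thick , suitable (suc c) thick m≤c ∈-thick (λ i i<T i∉Z → ≤-trans
        (+-mono-≤ (≤-trans (a≤ i) (s≤s (b≤1 i)))
          (above-free thick 2 ∈-thick (2 + i) (λ _ → s≤s (b≤1 (2 + i))) ≤-refl))
        (≤-trans (s≤s 3≤m) m≤c)) ,
      ≤-trans (length-collect only-thick b length-only-thick (2 + T)) (≤-trans (≤-reflexive total) (n≤1+n m))

    -- Layer j spends a surplus of at least 2 on one entry of `Z`, so there is room for both its
    -- neighbours within m + 1 entries. A layer outside `Z` is then not next to layer j, and its own
    -- neighbours share a surplus of at most m - 2.
    choice-fat : 3 ≤ m → ∀ {c} → 2 + m ≤ c → ∀ j → 2 ≤ b j → Choice c (suc m)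
    choice-fat 3≤m {suc c} (s≤s m≤c) j 2≤b = Z , suitable (suc c) Z m≤c (λ ℓ → there ∘ there ∘ ∈-thick ℓ) bound ,
      s≤s (≤-trans short (≤-reflexive total))
      where
      Z : List ℕ
      Z = pred j ∷ suc j ∷ thick
      1≤b : 1 ≤ b j
      1≤b = ≤-trans (n≤1+n 1) 2≤b
      Σ<-strict : ∀ {N} → j < N → Σ< N (length ∘ only-thick) < Σ< N b
      Σ<-strict {suc N} j<N with j ≟ N
      ... | yes refl = ≤-trans (≤-reflexive (sym (+-suc _ _)))
        (+-mono-≤ (Σ<-weak N) (strict-at 2≤b))
        where
        Σ<-weak : ∀ N → Σ< N (length ∘ only-thick) ≤ Σ< N b
        Σ<-weak zero    = z≤n
        Σ<-weak (suc N) = +-mono-≤ (Σ<-weak N) (length-only-thick N)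
        strict-at : 2 ≤ b j → suc (length (only-thick j)) ≤ b j
        strict-at p with b j | p
        ... | suc (suc _) | _ = s≤s (s≤s z≤n)
        ... | suc zero | s≤s ()
      ... | no j≢N = +-mono-<-≤ (Σ<-strict (≤∧≢⇒< (s≤s⁻¹ j<N) j≢N)) (length-only-thick N)
      short : suc (length thick) ≤ Σ< (2 + T) b
      short = ≤-trans (s≤s (length-collect only-thick (length ∘ only-thick) (λ _ → ≤-refl) (2 + T)))
        (Σ<-strict (thick⇒<N 1≤b))
      far : ∀ i → i < T → suc i ∉ Z → 2 + (b i + b (2 + i)) ≤ m
      far i i<T i∉Z = ≤-trans (+-monoˡ-≤ (b i + b (2 + i)) 2≤b) (≤-trans sum≤ (≤-reflexive total))
        where
        sum≤ : b j + (b i + b (2 + i)) ≤ Σ< (2 + T) b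
        sum≤ with <-cmp j i | <-cmp j (2 + i)
        ... | tri< j<i _ _ | _ = ≤-trans (≤-reflexive (sym (+-assoc (b j) (b i) (b (2 + i)))))
          (three-terms b j<i (m≤n⇒m≤1+n (n<1+n i)) (s≤s (s≤s i<T)))
        ... | tri≈ _ refl _ | _ = ⊥-elim (i∉Z (there (here refl)))
        ... | tri> _ _ _ | tri≈ _ refl _ = ⊥-elim (i∉Z (here refl))
        ... | tri> _ _ _ | tri> _ _ i<j = ≤-trans (≤-reflexive (+-comm (b j) _))
          (three-terms b (m≤n⇒m≤1+n (n<1+n i)) i<j (thick⇒<N 1≤b))
        ... | tri> _ _ i<j | tri< j<i _ _ with ≤-antisym (s≤s⁻¹ j<i) i<j
        ...   | refl = ⊥-elim (i∉Z (there (there (∈-thick j 1≤b))))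
      bound : ∀ i → i < T → suc i ∉ Z → a i + (a (2 + i) + free T Z (2 + i)) ≤ c
      bound i i<T i∉Z with b (2 + i) in eq
      ... | zero = begin
        a i + (a (2 + i) + free T Z (2 + i))
          ≤⟨ +-mono-≤ (a≤ i) (above-free Z 2 (λ ℓ → there ∘ there ∘ ∈-thick ℓ) (2 + i)
               (λ _ → s≤s (≤-trans (≤-reflexive eq) z≤n)) ≤-refl) ⟩
        suc (b i) + 2
          ≡⟨ solve 1 (λ x → con 1 :+ x :+ con 2 := con 1 :+ (con 2 :+ (x :+ con 0))) refl (b i) ⟩
        suc (2 + (b i + 0))
          ≡⟨ cong (λ k → suc (2 + (b i + k))) (sym eq) ⟩
        suc (2 + (b i + b (2 + i)))
          ≤⟨ s≤s (far i i<T i∉Z) ⟩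
        suc m
          ≤⟨ m≤c ⟩
        c ∎
        where open ≤-Reasoning
      ... | suc k = begin
        a i + (a (2 + i) + free T Z (2 + i))
          ≤⟨ +-mono-≤ (a≤ i) (above-free Z (suc (b (2 + i))) (λ ℓ → there ∘ there ∘ ∈-thick ℓ) (2 + i)
               (λ _ → ≤-refl) (s≤s (≤-trans (s≤s z≤n) (≤-reflexive (sym eq))))) ⟩
        suc (b i) + suc (b (2 + i))
          ≡⟨ cong suc (+-suc (b i) (b (2 + i))) ⟩
        2 + (b i + b (2 + i))
          ≤⟨ far i i<T i∉Z ⟩
        m
          ≤⟨ n≤1+n m ⟩
        suc m
          ≤⟨ m≤c ⟩
        c ∎
        where open ≤-Reasoning

    fat? : (∃[ j ] 2 ≤ b j) ⊎ (∀ ℓ → b ℓ ≤ 1)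
    fat? with search (2 + T)
      where
      search : ∀ N → (∃[ j ] 2 ≤ b j) ⊎ (∀ ℓ → ℓ < N → b ℓ ≤ 1)
      search zero = inj₂ λ _ ()
      search (suc N) with search N
      ... | inj₁ h = inj₁ h
      ... | inj₂ h with 2 ≤? b N
      ...   | yes p = inj₁ (N , p)
      ...   | no ¬p = inj₂ λ ℓ ℓ<N → below ℓ ℓ<N (ℓ ≟ N)
        where
        open import Relation.Nullary.Decidable using (Dec)
        below : ∀ ℓ → ℓ < suc N → Dec (ℓ ≡ N) → b ℓ ≤ 1
        below ℓ ℓ<N (yes refl) = s≤s⁻¹ (≰⇒> ¬p)
        below ℓ ℓ<N (no ℓ≢N)   = h ℓ (≤∧≢⇒< (s≤s⁻¹ ℓ<N) ℓ≢N)
    ... | inj₁ h = inj₁ h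
    ... | inj₂ h = inj₂ λ ℓ → ≮⇒≥ λ 1<b → <⇒≱ 1<b (h ℓ (thick⇒<N (<⇒≤ 1<b)))

    choice-large : 3 ≤ m → ∀ {c} → 2 + m ≤ c → Choice c (suc m)
    choice-large 3≤m m≤c with fat?
    ... | inj₁ (j , 2≤b) = choice-fat 3≤m m≤c j 2≤b
    ... | inj₂ b≤1       = choice-thin 3≤m m≤c b≤1

    -- The asymmetry comes from the one-sided term: seen from below, a two-vertex layer in `Z` costs
    -- no more than a free single vertex. So the layer below is added only for a surplus of 2 or
    -- more, whereas the layer above is added always. In each case the length is at most twice the
    -- surplus.
    surround : ℕ → List ℕ
    surround ℓ with b ℓ
    ... | zero        = []
    ... | suc zero    = ℓ ∷ suc ℓ ∷ []
    ... | suc (suc _) = pred ℓ ∷ ℓ ∷ suc ℓ ∷ []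

    -- Outside `Z` the layer below has at most one vertex and the layer above costs at most 2, which
    -- fits into c - 1 ≥ 3.
    choice-small : m ≤ 2 → ∀ {c} → 4 ≤ c → Choice c (m + m)
    choice-small m≤2 {suc c} (s≤s 3≤c) = Z , suitable (suc c) Z (≤-trans (s≤s m≤2) 3≤c) ∈Z bound ,
      ≤-trans (length-collect surround (λ ℓ → b ℓ + b ℓ) length-surround (2 + T))
        (≤-reflexive (trans (double (2 + T)) (cong₂ _+_ total total)))
      where
      Z : List ℕ
      Z = collect surround (2 + T)
      length-surround : ∀ ℓ → length (surround ℓ) ≤ b ℓ + b ℓ
      length-surround ℓ with b ℓ
      ... | zero        = z≤n
      ... | suc zero    = ≤-refl
      ... | suc (suc k) = s≤s (s≤s (≤-trans (s≤s z≤n) (m≤n+m (suc (suc k)) k)))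
      double : ∀ N → Σ< N (λ ℓ → b ℓ + b ℓ) ≡ Σ< N b + Σ< N b
      double zero    = refl
      double (suc N) = trans (cong (_+ (b N + b N)) (double N))
        (solve 2 (λ x y → (x :+ x) :+ (y :+ y) := (x :+ y) :+ (x :+ y)) refl (Σ< N b) (b N))
      ∈-surround : ∀ ℓ → 1 ≤ b ℓ → ℓ ∈ surround ℓ
      ∈-surround ℓ 1≤b with b ℓ
      ... | suc zero    = here refl
      ... | suc (suc _) = there (here refl)
      ∈Z : ∀ ℓ → 1 ≤ b ℓ → ℓ ∈ Z
      ∈Z ℓ 1≤b = ∈-collect surround (thick⇒<N 1≤b) (∈-surround ℓ 1≤b)
      below : ∀ i → suc i ∉ Z → b i ≡ 0
      below i i∉Z = n≤0⇒n≡0 (≮⇒≥ λ 1≤b → i∉Z (∈-collect surround (thick⇒<N 1≤b) (next 1≤b)))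
        where
        next : 1 ≤ b i → suc i ∈ surround i
        next 1≤b with b i
        ... | suc zero    = there (here refl)
        ... | suc (suc _) = there (there (here refl))
      above : ∀ i → suc i ∉ Z → b (2 + i) ≤ 1
      above i i∉Z = ≮⇒≥ λ 2≤b → i∉Z (∈-collect surround (thick⇒<N (<⇒≤ 2≤b)) (previous 2≤b))
        where
        previous : 2 ≤ b (2 + i) → suc i ∈ surround (2 + i)
        previous 2≤b with b (2 + i)
        ... | suc (suc _) = here refl
        ... | suc zero with 2≤b
        ...   | s≤s ()
      bound : ∀ i → i < T → suc i ∉ Z → a i + (a (2 + i) + free T Z (2 + i)) ≤ c
      bound i i<T i∉Z = ≤-trans (+-mono-≤ (≤-trans (a≤ i) (≤-reflexive (cong suc (below i i∉Z))))
        (above-free Z 2 ∈Z (2 + i) (λ _ → s≤s (above i i∉Z)) ≤-refl)) 3≤c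

    b≤m : ∀ {ℓ} → ℓ < 2 + T → b ℓ ≤ m
    b≤m {ℓ} ℓ<N = ≤-trans (m≤n+m (b ℓ) (Σ< ℓ b)) (≤-trans (Σ<-mono b ℓ<N) (≤-reflexive total))

    a-neighbours : ∀ {Z k i} → i < T → free T Z (2 + i) ≡ 0 → a i ≤ k → ∀ {l} → a (2 + i) ≤ l →
      a i + (a (2 + i) + free T Z (2 + i)) ≤ k + l
    a-neighbours {i = i} i<T f≡0 p q = +-mono-≤ p
      (≤-trans (≤-reflexive (trans (cong (a (2 + i) +_) f≡0) (+-identityʳ _))) q)

    thin : m ≡ 0 → ∀ ℓ → b ℓ ≡ 0
    thin m≡0 ℓ = n≤0⇒n≡0 (≮⇒≥ λ 1≤b → <⇒≱ 1≤b (≤-trans (b≤m (thick⇒<N 1≤b)) (≤-reflexive m≡0)))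

    thin⇒a≤1 : m ≡ 0 → ∀ ℓ → a ℓ ≤ 1
    thin⇒a≤1 m≡0 ℓ = ≤-trans (a≤ ℓ) (≤-reflexive (cong suc (thin m≡0 ℓ)))

    -- All layers are single vertices, so the sizes are those of a path on four vertices. Only its
    -- two ends stay free: each has a single neighbour, and this neighbour is not free.
    choice-P₄ : m ≡ 0 → T ≡ 4 → Choice 2 2
    choice-P₄ m≡0 refl = Z , suitable 2 Z (s≤s (≤-reflexive m≡0)) (λ ℓ 1≤b → ⊥-elim (n≮0 (≤-trans 1≤b (≤-reflexive (thin m≡0 ℓ))))) bound , ≤-refl
      where
      Z : List ℕ
      Z = 2 ∷ 3 ∷ []
      bound : ∀ i → i < T → suc i ∉ Z → a i + (a (2 + i) + free T Z (2 + i)) ≤ 1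
      bound 0 i<T _ = a-neighbours {Z} i<T refl (≤-reflexive a₀) (thin⇒a≤1 m≡0 2)
      bound 1 i<T h = ⊥-elim (h (here refl))
      bound 2 i<T h = ⊥-elim (h (there (here refl)))
      bound 3 i<T _ = a-neighbours {Z} i<T refl (thin⇒a≤1 m≡0 3) (≤-reflexive (a-end 5 ≤-refl))
      bound (suc (suc (suc (suc i)))) (s≤s (s≤s (s≤s (s≤s ())))) _

    -- For a path on five vertices the free layers 1, 3, 5 are pairwise nonadjacent, so the
    -- neighbours of each cost at most 1 + 1.
    choice-P₅ : m ≡ 0 → T ≡ 5 → Choice 3 2
    choice-P₅ m≡0 refl = Z , suitable 3 Z (s≤s (≤-trans (≤-reflexive m≡0) z≤n)) (λ ℓ 1≤b → ⊥-elim (n≮0 (≤-trans 1≤b (≤-reflexive (thin m≡0 ℓ))))) bound , ≤-refl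
      where
      Z : List ℕ
      Z = 2 ∷ 4 ∷ []
      bound : ∀ i → i < T → suc i ∉ Z → a i + (a (2 + i) + free T Z (2 + i)) ≤ 2
      bound 0 i<T _ = a-neighbours {Z} i<T refl (thin⇒a≤1 m≡0 0) (thin⇒a≤1 m≡0 2)
      bound 1 i<T h = ⊥-elim (h (here refl))
      bound 2 i<T _ = a-neighbours {Z} i<T refl (thin⇒a≤1 m≡0 2) (thin⇒a≤1 m≡0 4)
      bound 3 i<T h = ⊥-elim (h (there (here refl)))
      bound 4 i<T _ = a-neighbours {Z} i<T refl (thin⇒a≤1 m≡0 4) (thin⇒a≤1 m≡0 6)
      bound (suc (suc (suc (suc (suc i))))) (s≤s (s≤s (s≤s (s≤s (s≤s ()))))) _

    -- Five vertices in four layers: one of the two end layers is a single vertex, and it alone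
    -- stays free. Its only neighbouring layer has at most two vertices.
    choice-five : m ≡ 1 → T ≡ 4 → Choice 3 3
    choice-five refl refl with b 4 ≟ 0
    ... | yes eq = Z , suitable 3 Z ≤-refl B⊆Z bound , ≤-refl
      where
      Z : List ℕ
      Z = 1 ∷ 2 ∷ 3 ∷ []
      B⊆Z : ∀ ℓ → 1 ≤ b ℓ → ℓ ∈ Z
      B⊆Z 0 1≤b = ⊥-elim (n≮0 (≤-trans 1≤b (≤-reflexive b₀)))
      B⊆Z 1 1≤b = here refl
      B⊆Z 2 1≤b = there (here refl)
      B⊆Z 3 1≤b = there (there (here refl))
      B⊆Z 4 1≤b = ⊥-elim (n≮0 (≤-trans 1≤b (≤-reflexive eq)))
      B⊆Z (suc (suc (suc (suc (suc ℓ))))) 1≤b with thick⇒≤T 1≤b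
      ... | s≤s (s≤s (s≤s (s≤s ())))
      bound : ∀ i → i < T → suc i ∉ Z → a i + (a (2 + i) + free T Z (2 + i)) ≤ 2
      bound 0 i<T h = ⊥-elim (h (here refl))
      bound 1 i<T h = ⊥-elim (h (there (here refl)))
      bound 2 i<T h = ⊥-elim (h (there (there (here refl))))
      bound 3 i<T _ = a-neighbours {Z} i<T refl (≤-trans (a≤ 3) (s≤s (b≤m (s≤s (s≤s (s≤s (s≤s z≤n)))))))
        (≤-reflexive (a-end 5 ≤-refl))
      bound (suc (suc (suc (suc i)))) (s≤s (s≤s (s≤s (s≤s ())))) _
    ... | no b₄≢0 = Z , suitable 3 Z ≤-refl B⊆Z bound , ≤-refl
      where
      Z : List ℕ
      Z = 2 ∷ 3 ∷ 4 ∷ []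
      B⊆Z : ∀ ℓ → 1 ≤ b ℓ → ℓ ∈ Z
      B⊆Z 0 1≤b = ⊥-elim (n≮0 (≤-trans 1≤b (≤-reflexive b₀)))
      B⊆Z 1 1≤b = ⊥-elim (<⇒≱ (+-mono-≤ 1≤b (n≢0⇒n>0 b₄≢0))
        (≤-trans (two-terms b (s≤s (s≤s z≤n)) (s≤s (s≤s (s≤s (s≤s (s≤s z≤n)))))) (≤-reflexive total)))
      B⊆Z 2 1≤b = here refl
      B⊆Z 3 1≤b = there (here refl)
      B⊆Z 4 1≤b = there (there (here refl))
      B⊆Z (suc (suc (suc (suc (suc ℓ))))) 1≤b with thick⇒≤T 1≤b
      ... | s≤s (s≤s (s≤s (s≤s ())))
      bound : ∀ i → i < T → suc i ∉ Z → a i + (a (2 + i) + free T Z (2 + i)) ≤ 2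
      bound 0 i<T _ = a-neighbours {Z} i<T refl (≤-reflexive a₀) (≤-trans (a≤ 2) (s≤s (b≤m (s≤s (s≤s (s≤s z≤n))))))
      bound 1 i<T h = ⊥-elim (h (here refl))
      bound 2 i<T h = ⊥-elim (h (there (here refl)))
      bound 3 i<T h = ⊥-elim (h (there (there (here refl))))
      bound (suc (suc (suc (suc i)))) (s≤s (s≤s (s≤s (s≤s ())))) _

-- Layers by distance from an end of a diametral path.

module DistanceLayers where
  open import Defs using (Graph; adj; adj-sym; Walk; here; step; Connected; Distance; Diameter)
  open Layering
  open LayerChoice using (Σ<)
  open import Data.Bool.Base using (Bool; true; false)
  import Data.Bool.Properties as Bool
  open import Data.Fin.Base using (Fin; zero; suc)
  import Data.Fin.Properties as Fin
  open import Data.Nat.Base using (ℕ; zero; suc; pred; _+_; _≡ᵇ_; _≤_; _<_; s≤s; z≤n; s≤s⁻¹)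
  open import Data.Nat.Properties
  open import Data.Product.Base using (∃-syntax; _×_; _,_; proj₁; proj₂)
  open import Function.Base using (_∘_)
  open import Relation.Binary.Definitions using (tri<; tri≈; tri>)
  open import Relation.Binary.PropositionalEquality using (_≡_; _≢_; refl; sym; trans; cong; cong₂; subst)
  open import Relation.Nullary.Decidable using (Dec; yes; no; map′; _×-dec_)

  -- Makes the distance computable: it is found by searching below the length of a given walk.
  walk? : ∀ {n} (G : Graph n) k u v → Dec (Walk G k u v)
  walk? G zero u v = map′ (λ { refl → here }) (λ { here → refl }) (u Fin.≟ v)
  walk? G (suc k) u v = map′ (λ (w , e , p) → step e p) (λ { (step {v = w} e p) → w , e , p })
    (Fin.any? λ w → (adj G u w Bool.≟ true) ×-dec walk? G k w v)

  least : {P : ℕ → Set} → (∀ k → Dec (P k)) → ∀ k → P k → ∃[ l ] (P l × (∀ j → P j → l ≤ j))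
  least {P} P? k p with below k
    where
    below : ∀ k → (∃[ l ] (P l × (∀ j → P j → l ≤ j))) ⊎ (∀ j → j < k → ¬ P j)
    below zero = inj₂ λ _ ()
    below (suc k) with below k
    ... | inj₁ h = inj₁ h
    ... | inj₂ h with P? k
    ...   | yes p = inj₁ (k , p , λ j q → ≮⇒≥ λ j<k → h j j<k q)
    ...   | no ¬p = inj₂ λ j j<k q → case-≟ j j<k q (j ≟ k)
      where
      case-≟ : ∀ j → j < suc k → P j → ¬ Dec (j ≡ k)
      case-≟ j j<k q (yes refl) = ¬p q
      case-≟ j j<k q (no j≢k)   = h j (≤∧≢⇒< (s≤s⁻¹ j<k) j≢k) q
  ... | inj₁ h = h
  ... | inj₂ h = k , p , λ j q → ≮⇒≥ λ j<k → h j j<k q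

  snoc : ∀ {n} {G : Graph n} {k u v w} → Walk G k u v → adj G v w ≡ true → Walk G (suc k) u w
  snoc here       e = step e here
  snoc (step f p) e = step f (snoc p e)

  near≥1 : ∀ i j → i ≤ suc j → j ≤ suc i → 1 ≤ near i j
  near≥1 i j i≤ j≤ with <-cmp i j
  ... | tri< i<j _ _ = ≤-trans (≤-reflexive (cong ⟦_⟧ (sym (≡ᵇ-true (≤-antisym i<j j≤)))))
    (≤-trans (m≤n+m _ ⟦ i ≡ᵇ j ⟧) (m≤m+n _ ⟦ i ≡ᵇ suc j ⟧))
  ... | tri≈ _ i≡j _ = ≤-trans (≤-reflexive (cong ⟦_⟧ (sym (≡ᵇ-true i≡j))))
    (≤-trans (m≤m+n _ ⟦ suc i ≡ᵇ j ⟧) (m≤m+n _ ⟦ i ≡ᵇ suc j ⟧))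
  ... | tri> _ _ j<i = ≤-trans (≤-reflexive (cong ⟦_⟧ (sym (≡ᵇ-true (≤-antisym i≤ j<i)))))
    (m≤n+m _ (⟦ i ≡ᵇ j ⟧ + ⟦ suc i ≡ᵇ j ⟧))

  count-none : ∀ {n} (p : Fin n → Bool) → (∀ b → p b ≡ false) → count p ≡ 0
  count-none {zero}  p h = refl
  count-none {suc n} p h = cong₂ _+_ (cong ⟦_⟧ (h zero)) (count-none (p ∘ suc) (h ∘ suc))

  count-some : ∀ {n} (p : Fin n → Bool) b → p b ≡ true → 1 ≤ count p
  count-some p zero    h = ≤-trans (≤-reflexive (cong ⟦_⟧ (sym h))) (m≤m+n _ _)
  count-some p (suc b) h = ≤-trans (count-some (p ∘ suc) b h) (m≤n+m _ ⟦ p zero ⟧)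

  size-none : ∀ {n} (lay : Fin n → ℕ) ℓ → (∀ b → ℓ ≢ lay b) → size lay ℓ ≡ 0
  size-none lay ℓ h = count-none (λ b → ℓ ≡ᵇ lay b) λ b → ≡ᵇ-false (h b)

  size-some : ∀ {n} (lay : Fin n → ℕ) b → 1 ≤ size lay (lay b)
  size-some lay b = count-some (λ a → lay b ≡ᵇ lay a) b (≡ᵇ-true {lay b} refl)

  Σ<-+ : ∀ N f g → Σ< N (λ ℓ → f ℓ + g ℓ) ≡ Σ< N f + Σ< N g
  Σ<-+ zero    f g = refl
  Σ<-+ (suc N) f g = trans (cong (_+ (f N + g N)) (Σ<-+ N f g))
    (solve 4 (λ x y z w → (x :+ y) :+ (z :+ w) := (x :+ z) :+ (y :+ w)) refl (Σ< N f) (Σ< N g) (f N) (g N))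
    where
    open import Data.Nat.Solver using (module +-*-Solver)
    open +-*-Solver

  Σ<-zero : ∀ N f → (∀ ℓ → ℓ < N → f ℓ ≡ 0) → Σ< N f ≡ 0
  Σ<-zero zero    f h = refl
  Σ<-zero (suc N) f h = cong₂ _+_ (Σ<-zero N f λ ℓ ℓ<N → h ℓ (m<n⇒m<1+n ℓ<N)) (h N ≤-refl)

  Σ<-indicator : ∀ N k → k < N → Σ< N (λ ℓ → ⟦ ℓ ≡ᵇ k ⟧) ≡ 1
  Σ<-indicator (suc N) k k<N with k ≟ N
  ... | yes refl = cong₂ _+_ (Σ<-zero k _ λ ℓ ℓ<k → cong ⟦_⟧ (≡ᵇ-false (<⇒≢ ℓ<k))) (cong ⟦_⟧ (≡ᵇ-true {k} refl))
  ... | no k≢N   = trans (cong₂ _+_ (Σ<-indicator N k (≤∧≢⇒< (s≤s⁻¹ k<N) k≢N))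
    (cong ⟦_⟧ (≡ᵇ-false (k≢N ∘ sym)))) (+-identityʳ 1)

  Σ<-size : ∀ {n} (lay : Fin n → ℕ) N → (∀ b → lay b < N) → Σ< N (size lay) ≡ n
  Σ<-size {zero}  lay N h = Σ<-zero N _ λ _ _ → refl
  Σ<-size {suc n} lay N h = trans (Σ<-+ N (λ ℓ → ⟦ ℓ ≡ᵇ lay zero ⟧) (size (lay ∘ suc)))
    (cong₂ _+_ (Σ<-indicator N (lay zero) (h zero)) (Σ<-size (lay ∘ suc) N (h ∘ suc)))

  Σ<-pred : ∀ (a : ℕ → ℕ) T → a 0 ≡ 0 → (∀ i → i < T → 1 ≤ a (suc i)) →
    T + Σ< (suc T) (pred ∘ a) ≡ Σ< (suc T) a
  Σ<-pred a zero    a₀ h = trans (cong pred a₀) (sym a₀)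
  Σ<-pred a (suc T) a₀ h = trans (regroup T (Σ< (suc T) (pred ∘ a)) (pred (a (suc T))))
    (cong₂ _+_ (Σ<-pred a T a₀ λ i i<T → h i (m<n⇒m<1+n i<T)) (suc-pred′ (h T ≤-refl)))
    where
    suc-pred′ : ∀ {k} → 1 ≤ k → suc (pred k) ≡ k
    suc-pred′ (s≤s _) = refl
    regroup : ∀ x y z → suc x + (y + z) ≡ (x + y) + suc z
    regroup x y z = trans (cong suc (sym (+-assoc x y z))) (sym (+-suc (x + y) z))

  record LayersOf {n} (G : Graph n) (T : ℕ) : Set where
    field
      lay      : Fin n → ℕ
      lay≥1    : ∀ a → 1 ≤ lay a
      lay≤T    : ∀ a → lay a ≤ T
      lay-near : ∀ a b → adj G a b ≡ true → 1 ≤ near (lay a) (lay b)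
      onto     : ∀ i → i < T → 1 ≤ size lay (suc i)

    -- The range includes the empty layers 0 and T + 1, which contribute 0, so that the neighbours
    -- of layers 1 and T also occur as summands.
    surplus : ℕ
    surplus = Σ< (suc (suc T)) (pred ∘ size lay)

    empty₀ : size lay 0 ≡ 0
    empty₀ = size-none lay 0 λ b → <⇒≢ (lay≥1 b)

    empty-above : ∀ ℓ → T < ℓ → size lay ℓ ≡ 0
    empty-above ℓ T<ℓ = size-none lay ℓ λ b e → <⇒≱ T<ℓ (≤-trans (≤-reflexive e) (lay≤T b))

    T+surplus≡n : T + surplus ≡ n
    T+surplus≡n = trans (sym (+-assoc T (Σ< (suc T) (pred ∘ size lay)) _))
      (trans (cong₂ _+_ (trans (Σ<-pred (size lay) T empty₀ onto) (Σ<-size lay (suc T) (s≤s ∘ lay≤T)))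
        (cong pred (empty-above (suc T) ≤-refl))) (+-identityʳ n))

  distance-layers : ∀ {n} (G : Graph n) → Connected G → ∀ d → Diameter G d → LayersOf G (suc d)
  distance-layers {n} G connected d ((u , v , uv) , d-max) = record
    { lay      = suc ∘ dist
    ; lay≥1    = λ _ → s≤s z≤n
    ; lay≤T    = λ a → s≤s (d-max u a (dist a) (distance a))
    ; lay-near = λ a b e → near≥1 _ _ (s≤s (dist-step (trans (adj-sym G b a) e))) (s≤s (dist-step e))
    ; onto     = λ i i≤d → let w , e = hit (proj₁ uv) i (≤-trans (≤-reflexive dist-u) z≤n)
                                         (≤-trans (s≤s⁻¹ i≤d) (≤-reflexive (sym dist-v)))
                           in subst (λ j → 1 ≤ size (suc ∘ dist) (suc j)) e (size-some (suc ∘ dist) w)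
    }
    where
    shortest : ∀ a → ∃[ k ] Distance G u a k
    shortest a = let k , p = connected u a in least (λ l → walk? G l u a) k p
    dist : Fin n → ℕ
    dist a = proj₁ (shortest a)
    distance : ∀ a → Distance G u a (dist a)
    distance a = proj₂ (shortest a)
    dist-step : ∀ {a b} → adj G a b ≡ true → dist b ≤ suc (dist a)
    dist-step {a} {b} e = proj₂ (distance b) _ (snoc (proj₁ (distance a)) e)
    dist-u : dist u ≡ 0
    dist-u = n≤0⇒n≡0 (proj₂ (distance u) 0 here)
    dist-v : dist v ≡ d
    dist-v = ≤-antisym (proj₂ (distance v) d (proj₁ uv)) (proj₂ uv _ (proj₁ (distance v)))
    -- A discrete intermediate value theorem: along each edge of the walk the distance from u grows
    -- by at most 1. Applied to a walk from u to v, it shows that no layer is empty.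
    hit : ∀ {k a b} → Walk G k a b → ∀ ℓ → dist a ≤ ℓ → ℓ ≤ dist b → ∃[ w ] (dist w ≡ ℓ)
    hit {a = a} here ℓ p q = a , ≤-antisym p q
    hit {a = a} (step e walk) ℓ p q with dist a ≟ ℓ
    ... | yes eq = a , eq
    ... | no a≢ℓ = hit walk ℓ (≤-trans (dist-step e) (≤∧≢⇒< p a≢ℓ)) q

-- Graphs of diameter two.

-- A graph of diameter 2 lies in a complete graph minus the edge uv, which has the layers {u}, the other
-- vertices, {v}.  The test vector is c at u and v, and -1 elsewhere.
module DiameterTwo (R : CommutativeRing 0ℓ 0ℓ) (C : PositiveCone R) where
  open CommutativeRing R hiding (zero) renaming (Carrier to K)
  open Ordered R C
  open Layering
  open DistanceLayers using (near≥1)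
  open Sums R
  open InnerProduct R
  open QuadraticForm R C
  open LayeredForm R C
  open IntegerSolver R using (solve; con; _:=_; _:+_; _:*_; :-_; _:-_)
  open import Algebra.Properties.Ring ring using (x∙y⁻¹≈ε⇒x≈y)
  open import Data.Empty using (⊥-elim)
  open import Data.Fin.Base using (Fin; zero; suc; punchIn; punchOut)
  import Data.Fin.Properties as Fin
  open import Data.Integer.Base using (+_)
  open import Data.Nat.Base as ℕ using (ℕ; zero; suc; _≡ᵇ_; _≤_; s≤s; z≤n)
  import Data.Nat.Properties as ℕ
  open import Data.Product.Base using (_×_; _,_)
  open import Function.Base using (_∘_)
  open import Relation.Binary.PropositionalEquality as ≡ using (_≡_; _≢_; ≢-sym)
  open import Relation.Binary.Reasoning.Setoid setoid
  open import Relation.Nullary.Decidable using (yes; no)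

  module _ {c : ℕ} (1≤c : 1 ≤ c) (u v : Fin (suc (suc c))) (u≢v : u ≢ v)
    (A : Fin (suc (suc c)) → Fin (suc (suc c)) → ℕ) (A-sym : ∀ a b → A a b ≡ A b a) (A≤1 : ∀ a b → A a b ≤ 1)
    (A-irrefl : ∀ a → A a a ≡ 0) (Auv : A u v ≡ 0) where

    n : ℕ
    n = suc (suc c)

    lay : Fin n → ℕ
    lay a with a Fin.≟ u | a Fin.≟ v
    ... | yes _ | _     = 1
    ... | no _  | yes _ = 3
    ... | no _  | no _  = 2

    lay-u : lay u ≡ 1
    lay-u with u Fin.≟ u
    ... | yes _  = ≡.refl
    ... | no u≢u = ⊥-elim (u≢u ≡.refl)

    lay-v : lay v ≡ 3
    lay-v with v Fin.≟ u | v Fin.≟ v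
    ... | yes e | _     = ⊥-elim (u≢v (≡.sym e))
    ... | no _  | yes _ = ≡.refl
    ... | no _  | no h  = ⊥-elim (h ≡.refl)

    lay-1 : ∀ a → a ≢ u → 1 ≢ lay a
    lay-1 a a≢u with a Fin.≟ u | a Fin.≟ v
    ... | yes e | _     = ⊥-elim (a≢u e)
    ... | no _  | yes _ = λ ()
    ... | no _  | no _  = λ ()

    lay-3 : ∀ a → a ≢ v → 3 ≢ lay a
    lay-3 a a≢v with a Fin.≟ u | a Fin.≟ v
    ... | yes _ | _     = λ ()
    ... | no _  | yes e = ⊥-elim (a≢v e)
    ... | no _  | no _  = λ ()

    lay-2 : ∀ a → 2 ≡ lay a → a ≢ u × a ≢ v
    lay-2 a e with a Fin.≟ u | a Fin.≟ v
    ... | no a≢u | no a≢v = a≢u , a≢v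

    lay≥1 : ∀ a → 1 ≤ lay a
    lay≥1 a with a Fin.≟ u | a Fin.≟ v
    ... | yes _ | _     = s≤s z≤n
    ... | no _  | yes _ = s≤s z≤n
    ... | no _  | no _  = s≤s z≤n

    lay≤3 : ∀ a → lay a ≤ 3
    lay≤3 a with a Fin.≟ u | a Fin.≟ v
    ... | yes _ | _     = s≤s z≤n
    ... | no _  | yes _ = s≤s (s≤s (s≤s z≤n))
    ... | no _  | no _  = s≤s (s≤s z≤n)

    A-near : ∀ a b → A a b ℕ.+ identity a b ≤ near (lay a) (lay b)
    A-near a b with a Fin.≟ b
    ... | yes ≡.refl = ℕ.≤-trans (ℕ.≤-reflexive (≡.cong (ℕ._+ 1) (A-irrefl a)))
      (near≥1 (lay a) (lay a) (ℕ.n≤1+n _) (ℕ.n≤1+n _))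
    ... | no a≢b with a Fin.≟ u | a Fin.≟ v | b Fin.≟ u | b Fin.≟ v
    ...   | yes ≡.refl | _          | yes ≡.refl | _          = ⊥-elim (a≢b ≡.refl)
    ...   | yes ≡.refl | _          | no _       | yes ≡.refl = ℕ.≤-reflexive (≡.trans (ℕ.+-identityʳ _) Auv)
    ...   | yes _      | _          | no _       | no _       = ℕ.≤-trans (ℕ.≤-reflexive (ℕ.+-identityʳ _)) (A≤1 a b)
    ...   | no _       | yes ≡.refl | yes ≡.refl | _          = ℕ.≤-reflexive (≡.trans (ℕ.+-identityʳ _) (≡.trans (A-sym v u) Auv))
    ...   | no _       | yes ≡.refl | no _       | yes ≡.refl = ⊥-elim (a≢b ≡.refl)
    ...   | no _       | yes _      | no _       | no _       = ℕ.≤-trans (ℕ.≤-reflexive (ℕ.+-identityʳ _)) (A≤1 a b)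
    ...   | no _       | no _       | yes _      | _          = ℕ.≤-trans (ℕ.≤-reflexive (ℕ.+-identityʳ _)) (A≤1 a b)
    ...   | no _       | no _       | no _       | yes _      = ℕ.≤-trans (ℕ.≤-reflexive (ℕ.+-identityʳ _)) (A≤1 a b)
    ...   | no _       | no _       | no _       | no _       = ℕ.≤-trans (ℕ.≤-reflexive (ℕ.+-identityʳ _)) (A≤1 a b)

    -- The functionals encode x v = x u and c x a = - x u for every other vertex a. There are n - 1
    -- of them, and they leave exactly the line of the test vector.
    weight-self weight-u : Fin n → K
    weight-self a with a Fin.≟ v
    ... | yes _ = 1#
    ... | no  _ = ι c
    weight-u a with a Fin.≟ v
    ... | yes _ = - 1#
    ... | no  _ = 1#

    functional : Fin (suc c) → Fin n → K
    functional j b = weight-self (punchIn u j) * ι (identity (punchIn u j) b) + weight-u (punchIn u j) * ι (identity u b)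

    S : (Fin n → K) → ℕ → K
    S = layerSum lay 3 lay≥1 lay≤3

    module _ (x : Fin n → K) (zero-x : ∀ j → ⟪ functional j , x ⟫ ≈ 0#) where
      ξ : K
      ξ = x u

      constraint : ∀ a → a ≢ u → weight-self a * x a + weight-u a * ξ ≈ 0#
      constraint a a≢u = ≡.subst (λ a → weight-self a * x a + weight-u a * ξ ≈ 0#)
        (Fin.punchIn-punchOut (≢-sym a≢u)) (trans (sym (expand (punchIn u j))) (zero-x j))
        where
        j = punchOut (≢-sym a≢u)
        expand : ∀ a → sum (λ b → (weight-self a * ι (identity a b) + weight-u a * ι (identity u b)) * x b) ≈
          weight-self a * x a + weight-u a * ξ
        expand a = begin
          sum (λ b → (weight-self a * ι (identity a b) + weight-u a * ι (identity u b)) * x b)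
            ≈⟨ sum-cong (λ b → solve 5 (λ p i q j x → (p :* i :+ q :* j) :* x := p :* (i :* x) :+ q :* (j :* x)) refl
                 (weight-self a) (ι (identity a b)) (weight-u a) (ι (identity u b)) (x b)) ⟩
          sum (λ b → weight-self a * (ι (identity a b) * x b) + weight-u a * (ι (identity u b) * x b))
            ≈⟨ sum-linear ⟩
          weight-self a * sum (λ b → ι (identity a b) * x b) + weight-u a * sum (λ b → ι (identity u b) * x b)
            ≈⟨ +-cong (*-congˡ (sum-identity x a)) (*-congˡ (sum-identity x u)) ⟩
          weight-self a * x a + weight-u a * ξ ∎

      xv : x v ≈ ξ
      xv with v Fin.≟ v | constraint v (≢-sym u≢v)
      ... | yes _  | e = x∙y⁻¹≈ε⇒x≈y _ _ (trans (solve 2 (λ x y → x :- y := con (+ 1) :* x :+ :- con (+ 1) :* y) refl (x v) ξ) e)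
      ... | no v≢v | _ = ⊥-elim (v≢v ≡.refl)

      middle : ∀ a → a ≢ u → a ≢ v → ι c * x a ≈ - ξ
      middle a a≢u a≢v with a Fin.≟ v | constraint a a≢u
      ... | yes e | _ = ⊥-elim (a≢v e)
      ... | no _  | e = x∙y⁻¹≈ε⇒x≈y _ _ (trans
        (solve 2 (λ x y → x :- :- y := x :+ con (+ 1) :* y) refl (ι c * x a) ξ) e)

      S-1 : ∀ y → S y 1 ≈ y u
      S-1 y = trans (sum-single u λ b b≢u → indicator-≢ (y b) (lay-1 b b≢u))
        (trans (*-congʳ (reflexive (≡.cong (λ ℓ → ι ⟦ 1 ≡ᵇ ℓ ⟧) lay-u))) (indicator-≡ 1 (y u)))

      S-3 : ∀ y → S y 3 ≈ y v
      S-3 y = trans (sum-single v λ b b≢v → indicator-≢ (y b) (lay-3 b b≢v))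
        (trans (*-congʳ (reflexive (≡.cong (λ ℓ → ι ⟦ 3 ≡ᵇ ℓ ⟧) lay-v))) (indicator-≡ 3 (y v)))

      S-0 : ∀ y → S y 0 ≈ 0#
      S-0 y = sum-zero λ b → indicator-≢ (y b) λ e → ℕ.<⇒≢ (lay≥1 b) e

      S-4 : ∀ y → S y 4 ≈ 0#
      S-4 y = sum-zero λ b → indicator-≢ (y b) λ e → ℕ.<⇒≢ (s≤s (lay≤3 b)) (≡.sym e)

      -- Of the n = c + 2 vertices, layers 1 and 3 take one each; the total over the three layers
      -- gives the rest.
      S-1#-2 : S (λ _ → 1#) 2 ≈ ι c
      S-1#-2 = x∙y⁻¹≈ε⇒x≈y _ _ (begin
        S (λ _ → 1#) 2 - ι c
          ≈⟨ solve 2 (λ s k → s :- k := (con (+ 0) :+ con (+ 1) :* con (+ 1) :+ s :* con (+ 1) :+ con (+ 1) :* con (+ 1)) :-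
               (con (+ 1) :+ (con (+ 1) :+ k))) refl (S (λ _ → 1#) 2) (ι c) ⟩
        (0# + 1# * 1# + S (λ _ → 1#) 2 * 1# + 1# * 1#) - ι n
          ≈⟨ +-congʳ (+-cong (+-congʳ (+-congˡ (*-congʳ (S-1 (λ _ → 1#))))) (*-congʳ (S-3 (λ _ → 1#)))) ⟨
        range-sum 3 (λ i → S (λ _ → 1#) (suc i) * 1#) - ι n
          ≈⟨ +-congʳ (by-layers lay 3 lay≥1 lay≤3 (λ _ → 1#) (λ _ → 1#)) ⟨
        sum {n} (λ _ → 1# * 1#) - ι n
          ≈⟨ +-congʳ (trans (sum-cong {n} (λ _ → *-identityʳ 1#)) (ones n)) ⟩
        ι n - ι n
          ≈⟨ -‿inverseʳ _ ⟩
        0# ∎)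
        where
        ones : ∀ m → sum {m} (λ _ → 1#) ≈ ι m
        ones zero    = sum-[]
        ones (suc m) = trans sum-∷ (+-congˡ (ones m))

      in-middle : ∀ y z → (∀ a → a ≢ u → a ≢ v → y a ≈ z a) → S y 2 ≈ S z 2
      in-middle y z h = sum-cong pointwise
        where
        pointwise : ∀ b → ι ⟦ 2 ≡ᵇ lay b ⟧ * y b ≈ ι ⟦ 2 ≡ᵇ lay b ⟧ * z b
        pointwise b with 2 ℕ.≟ lay b
        ... | yes e = let b≢u , b≢v = lay-2 b e in *-congˡ (h b b≢u b≢v)
        ... | no ne = trans (indicator-≢ (y b) ne) (sym (indicator-≢ (z b) ne))

      S-scale : ∀ k y ℓ → S (λ b → k * y b) ℓ ≈ k * S y ℓ
      S-scale k y ℓ = trans (sum-cong λ b → solve 3 (λ i k y → i :* (k :* y) := k :* (i :* y)) refl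
        (ι ⟦ ℓ ≡ᵇ lay b ⟧) k (y b)) (sym sum-*ˡ)

      -- Each of the c middle entries is -ξ/c. The equation is shown after multiplication by c,
      -- which is then cancelled.
      s₂ : S x 2 ≈ - ξ
      s₂ = x∙y⁻¹≈ε⇒x≈y _ _ (*-cancel-0 ιc≉0 (begin
        ι c * (S x 2 - - ξ)
          ≈⟨ solve 3 (λ c s x → c :* (s :- :- x) := c :* s :+ x :* c) refl (ι c) (S x 2) ξ ⟩
        ι c * S x 2 + ξ * ι c
          ≈⟨ +-congʳ (S-scale (ι c) x 2) ⟨
        S (λ b → ι c * x b) 2 + ξ * ι c
          ≈⟨ +-congʳ (in-middle (λ b → ι c * x b) (λ _ → - ξ * 1#) λ a p q →
               trans (middle a p q) (sym (*-identityʳ _))) ⟩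
        S (λ b → - ξ * 1#) 2 + ξ * ι c
          ≈⟨ +-congʳ (trans (S-scale (- ξ) (λ _ → 1#) 2) (*-congˡ S-1#-2)) ⟩
        - ξ * ι c + ξ * ι c
          ≈⟨ solve 2 (λ x c → :- x :* c :+ x :* c := con (+ 0)) refl ξ (ι c) ⟩
        0# ∎))
        where
        ιc≉0 : ι c ≈ 0# → _
        ιc≉0 = Pos⇒≉0 (≡.subst (Pos ∘ ι) (ℕ.m+[n∸m]≡n 1≤c) (Pos-suc (c ℕ.∸ 1)))

      Q : ℕ → K
      Q = S (square lay 3 lay≥1 lay≤3 x)

      q₂ : ι c * Q 2 ≈ ξ * ξ
      q₂ = begin
        ι c * Q 2
          ≈⟨ S-scale (ι c) _ 2 ⟨
        S (λ b → ι c * (x b * x b)) 2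
          ≈⟨ in-middle _ (λ b → - ξ * x b) (λ a p q → trans (sym (*-assoc _ _ _)) (*-congʳ (middle a p q))) ⟩
        S (λ b → - ξ * x b) 2
          ≈⟨ trans (S-scale (- ξ) x 2) (*-congˡ s₂) ⟩
        - ξ * - ξ
          ≈⟨ neg*neg ξ ξ ⟩
        ξ * ξ ∎

      around-K : ∀ i → ι (around (size lay) i) ≈ S (λ _ → 1#) (suc i) + S (λ _ → 1#) (suc (suc i)) + S (λ _ → 1#) i
      around-K i = trans (sym (degree-sum lay 3 lay≥1 lay≤3 i))
        (trans (sum-cong (λ b → sym (*-identityʳ _))) (near-sum lay 3 lay≥1 lay≤3 (λ _ → 1#) i))

      -- Each of the three layers has excess ξ², and |x|² = 2 ξ² + Q 2. The difference is ξ² - Q 2,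
      -- which by `q₂` equals (c - 1) Q 2.
      bound : Nonneg (ι 1 * (ι c * ⟪ x , x ⟫ - ⟪ x , apply (λ a b → ι (signless A a b)) x ⟫) - ⟪ x , x ⟫)
      bound = bound-from-excess lay 3 lay≥1 lay≤3 A A-sym A-near c x 0 (Nonneg-resp (begin
        (ι c - ι 1) * Q 2
          ≈⟨ solve 2 (λ k q → (k :- (con (+ 1) :+ con (+ 0))) :* q := k :* q :- q) refl (ι c) (Q 2) ⟩
        ι c * Q 2 - Q 2
          ≈⟨ +-congʳ q₂ ⟩
        ξ * ξ - Q 2
          ≈⟨ solve 3 (λ k x q → x :* x :- q :=
               (con (+ 1) :+ con (+ 0)) :* (con (+ 0) :+
                 ((k :+ con (+ 2) :- (con (+ 1) :+ k :+ con (+ 0))) :* (x :* x) :- x :* (x :+ :- x :+ con (+ 0))) :+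
                 ((k :+ con (+ 2) :- (k :+ con (+ 1) :+ con (+ 1))) :* q :- :- x :* (:- x :+ x :+ x)) :+
                 ((k :+ con (+ 2) :- (con (+ 1) :+ con (+ 0) :+ k)) :* (x :* x) :- x :* (x :+ con (+ 0) :+ :- x))) :-
               (con (+ 0) :+ x :* x :+ q :+ x :* x)) refl (ι c) ξ (Q 2) ⟩
        ι 1 * (0# +
          ((ι c + (1# + 1#) - (1# + ι c + 0#)) * (ξ * ξ) - ξ * (ξ + - ξ + 0#)) +
          ((ι c + (1# + 1#) - (ι c + 1# + 1#)) * Q 2 - - ξ * (- ξ + ξ + ξ)) +
          ((ι c + (1# + 1#) - (1# + 0# + ι c)) * (ξ * ξ) - ξ * (ξ + 0# + - ξ))) -
        (0# + ξ * ξ + Q 2 + ξ * ξ)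
          ≈⟨ +-cong (*-congˡ (+-cong (+-cong (+-congˡ
               (+-cong (*-cong (coefficient 0 σ₁ S-1#-2 σ₀) (S-1 _)) (-‿cong (*-cong s₁ (+-cong (+-cong s₁ s₂) (S-0 x))))))
               (+-cong (*-congʳ (coefficient 1 S-1#-2 σ₃ σ₁)) (-‿cong (*-cong s₂ (+-cong (+-cong s₂ s₃) s₁)))))
               (+-cong (*-cong (coefficient 2 σ₃ (S-4 _) S-1#-2) q₃) (-‿cong (*-cong s₃ (+-cong (+-cong s₃ (S-4 x)) s₂))))))
               (-‿cong (trans (norm-layers lay 3 lay≥1 lay≤3 x) (+-cong (+-congʳ (+-congˡ (S-1 _))) q₃))) ⟨
        ι 1 * range-sum 3 (excess lay 3 lay≥1 lay≤3 A A-sym A-near c x) - ⟪ x , x ⟫ ∎)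
        (Nonneg-* (ι-mono 1≤c) (Nonneg-sum λ b → Nonneg-* (Nonneg-× ⟦ 2 ≡ᵇ lay b ⟧) (Nonneg-square (x b)))))
        where
        s₁ : S x 1 ≈ ξ
        s₁ = S-1 x
        s₃ : S x 3 ≈ ξ
        s₃ = trans (S-3 x) xv
        q₃ : Q 3 ≈ ξ * ξ
        q₃ = trans (S-3 _) (*-cong xv xv)
        σ₀ : S (λ _ → 1#) 0 ≈ 0#
        σ₀ = S-0 _
        σ₁ : S (λ _ → 1#) 1 ≈ 1#
        σ₁ = S-1 _
        σ₃ : S (λ _ → 1#) 3 ≈ 1#
        σ₃ = S-3 _
        coefficient : ∀ i {p q r} → S (λ _ → 1#) (suc i) ≈ p → S (λ _ → 1#) (suc (suc i)) ≈ q → S (λ _ → 1#) i ≈ r →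
          ι c + (1# + 1#) - ι (around (size lay) i) ≈ ι c + (1# + 1#) - (p + q + r)
        coefficient i p q r = +-congˡ (-‿cong (trans (around-K i) (+-cong (+-cong p q) r)))

-- The two bounds for graphs.

open import Defs
open import Data.Bool.Base using (if_then_else_)
open import Data.Integer.Base as ℤ using (+_)
open import Data.Nat.Base as ℕ using (ℕ; NonZero; _∸_)
open import Data.Nat.Properties using (_≤?_)
open import Data.Product.Base using (_×_)
open import Data.Product.Base using (_,_)
open import Data.Vec.Functional using (Vector)
open import Relation.Nullary.Decidable.Core using (does)

module GraphSpectrum where
  open RealField using (realRing; realCone; _≋_; _⊕_; _⊗_; ⊖_)
  open RealSpectrum using (castMatrix; many-small-eigenvalues)
  open QuadraticForm realRing realCone using (ι; identity; signless-Nonneg; module Layers)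
  open InnerProduct realRing
  open Ordered realRing realCone using (Nonneg)
  open LayeredForm realRing realCone using (layered-bound)
  open Layering using (Suitable; size; near; around; free)
  open LayerChoice using (module Sizes)
  open DistanceLayers
  open import Algebra.Bundles using (CommutativeRing)
  open import Algebra.Properties.Semiring.Mult (CommutativeRing.semiring realRing)
    using () renaming (_×_ to _×#_)
  open import Data.Bool.Base using (true; false)
  open import Data.Empty using (⊥-elim)
  open import Data.Fin.Base using (Fin)
  import Data.Fin.Properties as Fin
  import Data.Integer.Properties as ℤ
  import Data.Integer.Tactic.RingSolver as ℤSolver
  open import Data.List.Base using (length; lookup)
  open import Data.Nat.Base using (suc; z≤n; s≤s; s≤s⁻¹)
  import Data.Nat.Properties as ℕ
  open import Data.Nat.Solver using (module +-*-Solver)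
  open import Function.Bundles using (mk↣)
  open import Relation.Binary.PropositionalEquality using (_≡_; _≢_; refl; sym; trans; cong; cong₂; subst)
  open import Relation.Nullary.Decidable using (Dec; yes; no; dec-false)

  module _ {n : ℕ} {G : Graph n} {T : ℕ} (layers : LayersOf G T) where
    open LayersOf layers
    open Sizes T surplus (size lay) empty₀ empty-above onto refl public
      using (Choice; choice-large; choice-small; choice-P₄; choice-P₅; choice-five)

  laplacianEntries : ∀ {n} → Graph n → Matrix ℕ n
  laplacianEntries G u v = degreeMatrix G u v ℕ.+ adjacency G u v

  signlessLaplacian≡ : ∀ {n} (G : Graph n) u v → signlessLaplacian G u v ≡ fromℕ (laplacianEntries G u v)
  signlessLaplacian≡ G u v = refl

  adjacency-sym : ∀ {n} (G : Graph n) u v → adjacency G u v ≡ adjacency G v u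
  adjacency-sym G u v = cong (if_then 1 else 0) (adj-sym G u v)

  adjacency≤1 : ∀ {n} (G : Graph n) u v → adjacency G u v ℕ.≤ 1
  adjacency≤1 G u v with adj G u v
  ... | true  = ℕ.≤-refl
  ... | false = z≤n

  laplacianEntries-sym : ∀ {n} (G : Graph n) u v → laplacianEntries G u v ≡ laplacianEntries G v u
  laplacianEntries-sym G u v = cong₂ ℕ._+_ diagonal (adjacency-sym G u v)
    where
    diagonal : degreeMatrix G u v ≡ degreeMatrix G v u
    diagonal with u Fin.≟ v | v Fin.≟ u
    ... | yes refl | yes _   = refl
    ... | yes u≡v  | no v≢u  = ⊥-elim (v≢u (sym u≡v))
    ... | no u≢v   | yes v≡u = ⊥-elim (u≢v (sym v≡u))
    ... | no _     | no _    = refl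

  module _ {n : ℕ} (G : Graph n) {T : ℕ} (layers : LayersOf G T) where
    open LayersOf layers

    adjacency-near : ∀ a b → adjacency G a b ℕ.+ identity a b ℕ.≤ near (lay a) (lay b)
    adjacency-near a b with a Fin.≟ b
    ... | yes refl = ℕ.≤-trans (ℕ.≤-reflexive (cong (λ e → (if e then 1 else 0) ℕ.+ 1) (adj-irrefl G a)))
      (near≥1 (lay a) (lay a) (ℕ.n≤1+n _) (ℕ.n≤1+n _))
    ... | no _ with adj G a b in e
    ...   | true  = lay-near a b e
    ...   | false = z≤n

  module _ {n : ℕ} (G : Graph n) (μ : Vector ℝ n) (spectrum : IsSpectrum (signlessLaplacian G) μ) where

    eigenvalues-below : ∀ {r} (L : Fin r → Fin n → ℝ) b c →
      (∀ x → (∀ j → ⟪ L j , x ⟫ ≋ 0ℝ) →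
        Nonneg (suc b ×# 1ℝ ⊗ (c ×# 1ℝ ⊗ ⟪ x , x ⟫ ⊕ ⊖ ⟪ x , apply (castMatrix (laplacianEntries G)) x ⟫) ⊕ ⊖ ⟪ x , x ⟫)) →
      ∀ k → k ℕ.+ r ℕ.≤ n → AtLeast k of μ lieIn [ 0ℝ , fromℕ c ⟩
    eigenvalues-below = many-small-eigenvalues (laplacianEntries G) (laplacianEntries-sym G)
      (signlessLaplacian G) (signlessLaplacian≡ G) μ spectrum
      (signless-Nonneg (adjacency G) (adjacency-sym G))

    layered-eigenvalues : ∀ {T} (layers : LayersOf G T) (let open LayersOf layers) c Z →
      Suitable T c (size lay) Z → ∀ k → k ℕ.+ length Z ℕ.≤ n → AtLeast k of μ lieIn [ 0ℝ , fromℕ c ⟩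
    layered-eigenvalues {T} layers c Z suitable = eigenvalues-below
      (λ j b → ι (if lookup Z j ℕ.≡ᵇ lay b then 1 else 0)) (Layers.total T c (around (size lay)) (free T Z) T) c
      (layered-bound lay T lay≥1 lay≤T (adjacency G) (adjacency-sym G) (adjacency-near G layers) c Z suitable)
      where open LayersOf layers

    chosen-eigenvalues : ∀ {T} (layers : LayersOf G T) (let open LayersOf layers) {c r} →
      Choice layers c r →
      ∀ k → k ℕ.+ r ℕ.≤ T ℕ.+ surplus → AtLeast k of μ lieIn [ 0ℝ , fromℕ c ⟩
    chosen-eigenvalues layers (Z , suitable , Z≤r) k k+r≤ = layered-eigenvalues layers _ Z suitable k
      (ℕ.≤-trans (ℕ.+-monoʳ-≤ k Z≤r) (ℕ.≤-trans k+r≤ (ℕ.≤-reflexive (LayersOf.T+surplus≡n layers))))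

  none : ∀ {n} (μ : Vector ℝ n) I → AtLeast 0 of μ lieIn I
  none μ I = mk↣ {to = λ ()} (λ {i} → λ {}) , λ ()

  n-2≡ : ∀ c → + (2 ℕ.+ c) ℤ.- + 2 ≡ + c
  n-2≡ c = lemma (+ c)
    where
    lemma : ∀ i → (+ 2 ℤ.+ i) ℤ.- + 2 ≡ i
    lemma = ℤSolver.solve-∀

  n-d+1≡ : ∀ d m → + (suc d ℕ.+ m) ℤ.- + d ℤ.+ + 1 ≡ + (2 ℕ.+ m)
  n-d+1≡ d m = lemma (+ d) (+ m)
    where
    lemma : ∀ i j → (+ 1 ℤ.+ i ℤ.+ j) ℤ.- i ℤ.+ + 1 ≡ + 2 ℤ.+ j
    lemma = ℤSolver.solve-∀

  distance-2⇒≢ : ∀ {n} (G : Graph n) {u v} → Distance G u v 2 → u ≢ v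
  distance-2⇒≢ G (_ , shortest) refl = ℕ.n≮0 (shortest 0 here)

  distance-2⇒nonadjacent : ∀ {n} (G : Graph n) {u v} → Distance G u v 2 → adjacency G u v ≡ 0
  distance-2⇒nonadjacent G {u} {v} (_ , shortest) with adj G u v in e
  ... | false = refl
  ... | true  = ⊥-elim (ℕ.n≮n 1 (shortest 1 (step e here)))

  diameter-two : ∀ {n} (G : Graph n) → Connected G → Diameter G 2 → ∀ (μ : Vector ℝ n) →
    IsSpectrum (signlessLaplacian G) μ → ∀ m → 3 ℕ.+ m ≡ n → AtLeast 1 of μ lieIn [ 0ℝ , fromℕ (suc m) ⟩
  diameter-two G connected ((u , v , walk , shortest) , _) μ spectrum m refl =
    eigenvalues-below G μ spectrum (functional 1≤c u v u≢v A A-sym A≤1 A-irrefl Auv) 0 (suc m)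
      (bound 1≤c u v u≢v A A-sym A≤1 A-irrefl Auv) 1 ℕ.≤-refl
    where
    open DiameterTwo realRing realCone
    1≤c : 1 ℕ.≤ suc m
    1≤c = s≤s z≤n
    A = adjacency G
    A-sym = adjacency-sym G
    A≤1 = adjacency≤1 G
    A-irrefl : ∀ a → A a a ≡ 0
    A-irrefl a = cong (if_then 1 else 0) (adj-irrefl G a)
    u≢v : u ≢ v
    u≢v = distance-2⇒≢ G (walk , shortest)
    Auv : A u v ≡ 0
    Auv = distance-2⇒nonadjacent G (walk , shortest)

  if-≤ : ∀ b {i j k} → i ℕ.≤ k → j ℕ.≤ k → (if b then i else j) ℕ.≤ k
  if-≤ true  p q = p
  if-≤ false p q = q

  -- For d ≤ 1 no eigenvalue is asked for. For d = 3 + e one has n = 4 + e + m, with m the surplus,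
  -- and the general choices of `Z` apply if m ≥ 3 or n - 2 ≥ 4. What remains is e + m ≤ 1: the
  -- paths on four and five vertices, and five vertices with diameter 3.
  first-bound : ∀ {n} (G : Graph n) → Connected G → ∀ d → Diameter G d → ∀ (μ : Vector ℝ n) →
    IsSpectrum (signlessLaplacian G) μ → AtLeast d ∸ 1 of μ lieIn [ 0ℝ , fromℤ (+ n ℤ.- + 2) ⟩
  first-bound {n} G connected 0 diameter μ spectrum = none μ [ 0ℝ , fromℤ (+ n ℤ.- + 2) ⟩
  first-bound {n} G connected 1 diameter μ spectrum = none μ [ 0ℝ , fromℤ (+ n ℤ.- + 2) ⟩
  first-bound {n} G connected 2 diameter μ spectrum =
    subst (λ i → AtLeast 1 of μ lieIn [ 0ℝ , fromℤ i ⟩)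
      (sym (trans (cong (λ k → + k ℤ.- + 2) (sym T+surplus≡n)) (n-2≡ (suc surplus))))
      (diameter-two G connected diameter μ spectrum surplus T+surplus≡n)
    where open LayersOf (distance-layers G connected 2 diameter)
  first-bound {n} G connected (suc (suc (suc e))) diameter μ spectrum =
    subst (λ i → AtLeast (2 ℕ.+ e) of μ lieIn [ 0ℝ , fromℤ i ⟩)
      (sym (trans (cong (λ k → + k ℤ.- + 2) (sym T+surplus≡n)) (n-2≡ (2 ℕ.+ e ℕ.+ surplus))))
      enough
    where
    layers = distance-layers G connected (3 ℕ.+ e) diameter
    open LayersOf layers
    open +-*-Solver using (solve; _:=_; _:+_; con)
    choose : ∀ {c r} → Choice layers c r →
      ∀ k → k ℕ.+ r ℕ.≤ 4 ℕ.+ e ℕ.+ surplus → AtLeast k of μ lieIn [ 0ℝ , fromℕ c ⟩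
    choose = chosen-eigenvalues G μ spectrum layers
    enough : AtLeast (2 ℕ.+ e) of μ lieIn [ 0ℝ , fromℕ (2 ℕ.+ e ℕ.+ surplus) ⟩
    enough = by-size (3 ℕ.≤? surplus) (4 ℕ.≤? (2 ℕ.+ e ℕ.+ surplus))
      where
      by-size : Dec (3 ℕ.≤ surplus) → Dec (4 ℕ.≤ 2 ℕ.+ e ℕ.+ surplus) →
        AtLeast (2 ℕ.+ e) of μ lieIn [ 0ℝ , fromℕ (2 ℕ.+ e ℕ.+ surplus) ⟩
      -- At most m + 1 layers in `Z` leave n - m - 1 = 3 + e eigenvalues, one more than required.
      by-size (yes 3≤m) _ = choose
        (choice-large layers 3≤m
          (s≤s (s≤s (ℕ.m≤n+m surplus e)))) (2 ℕ.+ e)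
        (ℕ.≤-trans (ℕ.≤-reflexive (ℕ.+-suc (2 ℕ.+ e) surplus)) (ℕ.n≤1+n _))
      -- At most 2 m ≤ m + 2 layers in `Z` leave n - m - 2 = 2 + e eigenvalues.
      by-size (no m<3) (yes 4≤c) = choose
        (choice-small layers (s≤s⁻¹ (ℕ.≰⇒> m<3)) 4≤c) (2 ℕ.+ e)
        (ℕ.≤-trans (ℕ.+-monoʳ-≤ (2 ℕ.+ e) (ℕ.+-monoˡ-≤ surplus (s≤s⁻¹ (ℕ.≰⇒> m<3))))
          (ℕ.≤-reflexive (solve 2 (λ e m → con 2 :+ e :+ (con 2 :+ m) := con 4 :+ e :+ m) refl e surplus)))
      by-size (no _) (no c<4) = tiny (e ℕ.≟ 0) (surplus ℕ.≟ 0)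
        where
        e+m≤1 : e ℕ.+ surplus ℕ.≤ 1
        e+m≤1 = s≤s⁻¹ (s≤s⁻¹ (s≤s⁻¹ (ℕ.≰⇒> c<4)))
        small : ∀ {c r} e′ m′ → e ≡ e′ → surplus ≡ m′ → 2 ℕ.+ e′ ℕ.+ m′ ≡ c → r ℕ.≤ 2 ℕ.+ m′ →
          Choice layers c r →
          AtLeast (2 ℕ.+ e) of μ lieIn [ 0ℝ , fromℕ (2 ℕ.+ e ℕ.+ surplus) ⟩
        small {c} {r} e′ m′ e≡ m≡ c≡ r≤ Z =
          subst (λ c → AtLeast (2 ℕ.+ e) of μ lieIn [ 0ℝ , fromℕ c ⟩)
            (trans (sym c≡) (cong₂ (λ e m → 2 ℕ.+ e ℕ.+ m) (sym e≡) (sym m≡)))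
            (choose Z (2 ℕ.+ e) (ℕ.≤-trans (ℕ.+-monoʳ-≤ (2 ℕ.+ e) (ℕ.≤-trans r≤ (ℕ.≤-reflexive (cong (2 ℕ.+_) (sym m≡)))))
              (ℕ.≤-reflexive (solve 2 (λ e m → con 2 :+ e :+ (con 2 :+ m) := con 4 :+ e :+ m) refl e surplus))))
        tiny : Dec (e ≡ 0) → Dec (surplus ≡ 0) →
          AtLeast (2 ℕ.+ e) of μ lieIn [ 0ℝ , fromℕ (2 ℕ.+ e ℕ.+ surplus) ⟩
        tiny (yes e≡0) (yes m≡0) = small 0 0 e≡0 m≡0 refl ℕ.≤-refl
          (choice-P₄ layers m≡0 (cong (4 ℕ.+_) e≡0))
        tiny (yes e≡0) (no m≢0) = small 0 1 e≡0 m≡1 refl ℕ.≤-refl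
          (choice-five layers m≡1 (cong (4 ℕ.+_) e≡0))
          where
          m≡1 : surplus ≡ 1
          m≡1 = ℕ.≤-antisym (ℕ.≤-trans (ℕ.m≤n+m surplus e) e+m≤1) (ℕ.n≢0⇒n>0 m≢0)
        tiny (no e≢0) _ = small 1 0 e≡1 m≡0 refl ℕ.≤-refl
          (choice-P₅ layers m≡0 (cong (4 ℕ.+_) e≡1))
          where
          e≡1 : e ≡ 1
          e≡1 = ℕ.≤-antisym (ℕ.≤-trans (ℕ.m≤m+n e surplus) e+m≤1) (ℕ.n≢0⇒n>0 e≢0)
          m≡0 : surplus ≡ 0
          m≡0 = ℕ.n≤0⇒n≡0 (s≤s⁻¹ (subst (λ e → e ℕ.+ surplus ℕ.≤ 1) e≡1 e+m≤1))

  -- Here n = d + 1 + m, so the bound n - d + 1 is c = m + 2. For m ≥ 3 a `Z` of at most m + 1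
  -- layers leaves d eigenvalues. Otherwise d + 3 ≤ n forces m = 2, where four layers leave d - 1;
  -- this suffices, since d + 5 ≤ n would mean m ≥ 4.
  second-bound : ∀ {n} (G : Graph n) → Connected G → ∀ d → Diameter G d → ∀ (μ : Vector ℝ n) →
    IsSpectrum (signlessLaplacian G) μ → 3 ℕ.≤ d → d ℕ.+ 3 ℕ.≤ n →
    AtLeast (if does ((d ℕ.+ 5) ≤? n) then d else d ∸ 1) of μ lieIn [ 0ℝ , fromℤ (+ n ℤ.- + d ℤ.+ + 1) ⟩
  second-bound {n} G connected d diameter μ spectrum 3≤d d+3≤n =
    subst (λ i → AtLeast k of μ lieIn [ 0ℝ , fromℤ i ⟩)
      (sym (trans (cong (λ k → + k ℤ.- + d ℤ.+ + 1) (sym T+surplus≡n)) (n-d+1≡ d surplus)))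
      enough
    where
    layers = distance-layers G connected d diameter
    open LayersOf layers
    open +-*-Solver using (solve; _:=_; _:+_; con)
    k = if does ((d ℕ.+ 5) ≤? n) then d else d ∸ 1
    enough : AtLeast k of μ lieIn [ 0ℝ , fromℕ (2 ℕ.+ surplus) ⟩
    k≤d : k ℕ.≤ d
    k≤d = if-≤ (does ((d ℕ.+ 5) ≤? n)) ℕ.≤-refl (ℕ.m∸n≤m d 1)
    enough = by-size (3 ℕ.≤? surplus)
      where
      by-size : Dec (3 ℕ.≤ surplus) → AtLeast k of μ lieIn [ 0ℝ , fromℕ (2 ℕ.+ surplus) ⟩
      by-size (yes 3≤m) = chosen-eigenvalues G μ spectrum layers
        (choice-large layers 3≤m ℕ.≤-refl) k
        (ℕ.≤-trans (ℕ.+-monoˡ-≤ (suc surplus) k≤d) (ℕ.≤-reflexive (ℕ.+-suc d surplus)))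
      by-size (no m<3) = chosen-eigenvalues G μ spectrum layers
        (choice-small layers m≤2 (s≤s (s≤s 2≤m))) k
        (begin
          k ℕ.+ (surplus ℕ.+ surplus)           ≡⟨ cong (ℕ._+ (surplus ℕ.+ surplus)) k≡d∸1 ⟩
          d ∸ 1 ℕ.+ (surplus ℕ.+ surplus)       ≤⟨ ℕ.+-monoʳ-≤ (d ∸ 1) (ℕ.+-monoˡ-≤ surplus m≤2) ⟩
          d ∸ 1 ℕ.+ (2 ℕ.+ surplus)             ≡⟨ solve 2 (λ x m → x :+ (con 2 :+ m) := con 1 :+ (x :+ con 1) :+ m) refl (d ∸ 1) surplus ⟩
          suc (d ∸ 1 ℕ.+ 1) ℕ.+ surplus         ≡⟨ cong (λ x → suc x ℕ.+ surplus) (ℕ.m∸n+n≡m (ℕ.≤-trans (s≤s z≤n) 3≤d)) ⟩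
          suc d ℕ.+ surplus                     ∎)
        where
        open ℕ.≤-Reasoning
        m≤2 : surplus ℕ.≤ 2
        m≤2 = s≤s⁻¹ (ℕ.≰⇒> m<3)
        2≤m : 2 ℕ.≤ surplus
        2≤m = ℕ.+-cancelˡ-≤ (suc d) 2 surplus (begin
          suc d ℕ.+ 2          ≡⟨ solve 1 (λ d → con 1 :+ d :+ con 2 := d :+ con 3) refl d ⟩
          d ℕ.+ 3              ≤⟨ d+3≤n ⟩
          n                    ≡⟨ T+surplus≡n ⟨
          suc d ℕ.+ surplus    ∎)
        d+5≰n : ¬ d ℕ.+ 5 ℕ.≤ n
        d+5≰n d+5≤n = ℕ.<⇒≱ (begin-strict
          suc d ℕ.+ surplus    ≤⟨ ℕ.+-monoʳ-≤ (suc d) m≤2 ⟩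
          suc d ℕ.+ 2          ≡⟨ solve 1 (λ d → con 1 :+ d :+ con 2 := d :+ con 3) refl d ⟩
          d ℕ.+ 3              <⟨ ℕ.+-monoʳ-< d {3} {5} (s≤s (s≤s (s≤s (s≤s z≤n)))) ⟩
          d ℕ.+ 5              ∎) (ℕ.≤-trans d+5≤n (ℕ.≤-reflexive (sym T+surplus≡n)))
        k≡d∸1 : k ≡ d ∸ 1
        k≡d∸1 = cong (if_then d else d ∸ 1) (dec-false ((d ℕ.+ 5) ≤? n) d+5≰n)

theorem3p4 : ∀ (n d : ℕ) .{{_ : NonZero n}} (G : Graph n) → Connected G → Diameter G d →
    ∀ (μ : Vector ℝ n) → IsSpectrum (signlessLaplacian G) μ →
    (AtLeast d ∸ 1 of μ lieIn [ 0ℝ , fromℤ (+ n ℤ.- + 2) ⟩)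
    × (3 ℕ.≤ d → d ℕ.+ 3 ℕ.≤ n →
    AtLeast (if does ((d ℕ.+ 5) ≤? n) then d else d ∸ 1) of μ lieIn
    [ 0ℝ , fromℤ (+ n ℤ.- + d ℤ.+ + 1) ⟩)
theorem3p4 n d G connected diameter μ spectrum =
  GraphSpectrum.first-bound G connected d diameter μ spectrum ,
  GraphSpectrum.second-bound G connected d diameter μ spectrum
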